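{- Let $r\geq 2$, $n>r^{8}$, and $0<\alpha<r^{ -8}/36$. If a graph $G$ of order $n$ satisfies \[ e(G)>\left(\frac{r-1}{2r}-\alpha\right)n^{2}, \] then either \[ js^{(2,r+1,2)}(G)>\left(1-\frac{1}{r^{3}}\right)\frac{n^{r-1}}{r^{r+5}}, \] or $G$ contains an induced $r$-chromatic subgraph $G_{0}$ of order at least $(1-2\sqrt{\alpha})n$ with minimum degree \[ \delta(G_{0})>\left(1-\frac{1}{r}-6\sqrt{\alpha}\right)n. \]
   Context: All graphs are finite and simple; $e(G)$ is the number of edges and $\delta(G)$ the minimum degree. A graph is $r$-chromatic if it can be properly vertex-colored with $r$ colors. For a graph $G$, $js^{(2,r+1,2)}(G)$ is the maximum, over all edges $uv$ of $G$, of the number of $(r+1)$-cliques of $G$ containing both $u$ and $v$ (and $0$ if $G$ has no edges). -}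

module Defs where

open import Data.Nat as ℕ using (ℕ; zero; suc; _<ᵇ_)
open import Data.Bool using (Bool; true; false; T; if_then_else_; _∧_)
open import Data.Fin using (Fin; toℕ)
open import Data.Fin.Subset using (Subset; _∈_; ∣_∣)
open import Data.Vec using (Vec; []; _∷_; lookup)
open import Data.List using (List; []; _∷_; map; filter; length; concatMap; foldr; allFin; _++_)
open import Data.Product using (_×_; _,_)
open import Data.Integer using (+_)
open import Data.Rational using (ℚ; _/_; _*_; _≤_; _<_; 0ℚ)
open import Relation.Binary.PropositionalEquality using (_≡_)
open import Relation.Nullary using (¬_)
open import Relation.Nullary.Decidable using (does)

record Graph (n : ℕ) : Set where
  field
    adj   : Fin n → Fin n → Bool
    sym   : ∀ u v → adj u v ≡ adj v u
    irrefl : ∀ v → adj v v ≡ false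
open Graph public

⟦_⟧ : ℕ → ℚ
⟦ m ⟧ = + m / 1

-- 1/m in ℚ (only used for m ≠ 0; the value at 0 is an irrelevant convention)
inv : ℕ → ℚ
inv zero = 0ℚ
inv (suc k) = + 1 / suc k

pairs : (n : ℕ) → List (Fin n × Fin n)
pairs n = concatMap (λ u → map (λ v → (u , v)) (allFin n)) (allFin n)

edges : ∀ {n} → Graph n → ℕ
edges {n} G = length (filter (λ p → Data.Bool.T? (check p)) (pairs n))
  where
    check : _ → Bool
    check (u , v) = (toℕ u <ᵇ toℕ v) ∧ adj G u v
    import Data.Bool

allSubsets : (n : ℕ) → List (Subset n)
allSubsets zero = [] ∷ []
allSubsets (suc n) = map (false ∷_) (allSubsets n) ++ map (true ∷_) (allSubsets n)

isCliqueᵇ : ∀ {n} → Graph n → Subset n → Bool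
isCliqueᵇ {n} G S =
  foldr (λ p b → b ∧ ok p) true (pairs n)
  where
    ok : Fin n × Fin n → Bool
    ok (u , v) =
      if lookup S u ∧ lookup S v ∧ Data.Bool.not (does (u Data.Fin.≟ v))
      then adj G u v else true
      where import Data.Bool; import Data.Fin

cliquesThrough : ∀ {n} → Graph n → ℕ → Fin n → Fin n → ℕ
cliquesThrough {n} G k u v =
  length (filter (λ S → Data.Bool.T? (good S)) (allSubsets n))
  where
    import Data.Bool
    good : Subset n → Bool
    good S = does (∣ S ∣ ℕ.≟ k) ∧ lookup S u ∧ lookup S v ∧ isCliqueᵇ G S

-- js^{(2,r+1,2)}(G): maximum over edges uv of the number of (r+1)-cliques
-- containing u and v; 0 if there are no edges.
js : ∀ {n} → Graph n → ℕ → ℕ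
js {n} G r = foldr step 0 (pairs n)
  where
    step : Fin n × Fin n → ℕ → ℕ
    step (u , v) m = if adj G u v then cliquesThrough G (suc r) u v ℕ.⊔ m else m

degIn : ∀ {n} → Graph n → Subset n → Fin n → ℕ
degIn {n} G S v =
  length (filter (λ w → Data.Bool.T? (lookup S w ∧ adj G v w)) (allFin n))
  where import Data.Bool

Chromatic : ∀ {n} → Graph n → Subset n → ℕ → Set
Chromatic {n} G S r =
  Data.Product.Σ (Fin n → Fin r) λ c →
    ∀ u v → u ∈ S → v ∈ S → T (adj G u v) → ¬ (c u ≡ c v)
  where import Data.Product

-- x ≤ c·√α  (with c ≥ 0, α ≥ 0) expressed without square roots:
-- x ≤ 0, or x² ≤ c²·α.
_≤_√_ : ℚ → ℚ → ℚ → Set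
x ≤ c √ α = (x ≤ 0ℚ) Data.Sum.⊎ (x * x ≤ (c * c) * α)
  where import Data.Sum

-- x < c·√α  (with c ≥ 0, α ≥ 0): x < 0, or x² < c²·α.
_<_√_ : ℚ → ℚ → ℚ → Set
x < c √ α = (x < 0ℚ) Data.Sum.⊎ (x * x < (c * c) * α)
  where import Data.Sum

{-# OPTIONS --safe #-}

-- Vertices of degree below (1 - 1/r) N - T/r, with T ≈ n/(2r³), are deleted one at a time from the
-- current graph of order N; every deletion increases the excess of e(G) over (r-1)/(2r) N².
-- If this continues for 4T steps, the excess is so large that the Moon–Moser inequality gives many
-- (r+1)-cliques, and some edge lies in many of them.
-- Otherwise few vertices are deleted and the remaining graph has large minimum degree. If it
-- contains an (r+1)-clique, one of the edges of that clique has a codegree well above (1 - 2/r) N,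
-- and extending it greedily again gives many (r+1)-cliques on one edge. If it contains none, it is
-- r-colourable, as in the Andrásfai–Erdős–Sós theorem. The edge count then forces the colour classes
-- to have nearly equal size and bounds the number of non-adjacent pairs in different classes, so
-- dropping the few vertices with many such non-neighbours leaves the required subgraph.
module Submission where

-- The value n/(2r³) of T balances two demands. In the clique case the averaging gains about
-- 2N/(r²(r+1)) in codegree while the degree slack costs less than T, so T may not exceed a small
-- multiple of n/r³. On the other side, 4T deletions raise the excess by about 8T², that is 2n²/r⁶;
-- the initial deficit is below n²/(36r⁶) and n²/r⁶ must remain for the bound on `js`, so T cannot
-- be much smaller. The condition n > r⁸ keeps the rounding of T and the loss of r - 1 per deletion
-- harmless. The integer part of the argument sees α only through a natural number `D` < 2rαn², the
-- deficit of 2r e(G) against (r-1)n², and all degrees are scaled by r. The square root enters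
-- through one integer b with 2rb² ≤ D < 2r(b+1)², so that b is at most n√α. The value of `js` is
-- used as an upper bound J on the cliques over every edge, and both clique-rich cases turn this
-- into a lower bound on J.

module Naturals where

  open import Data.Nat as ℕ using (ℕ; zero; suc; _+_; _*_; _∸_; _^_; _≤_; _<_; z≤n; s≤s; _!; NonZero; ∣_-_∣)
  open import Data.Nat.Properties
  open import Data.Nat.DivMod using (_/_; _%_; m≡m%n+[m/n]*n; m%n<n; m/n*n≤m)
  import Data.Nat.ListAction as ListAction
  open import Data.Nat.Tactic.RingSolver using (solve-∀)
  open import Data.Bool as Bool using (Bool; true; false; T?; not; _∧_; if_then_else_)
  open import Data.Bool.Properties as Bool using (∧-zeroʳ; ∧-identityʳ)
  open import Data.Fin as Fin using (Fin; zero; suc; toℕ)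
  open import Data.Fin.Properties as Fin using ()
  open import Data.Fin.Subset using (Subset; ∣_∣)
  open import Data.List as List using (List; []; _∷_; length)
  open import Data.List.Membership.Propositional as List∈ using ()
  open import Data.List.Membership.Propositional.Properties
    using (∈-lookup; ∈-concatMap⁺; ∈-map⁺; ∈-allFin; ∈-++⁺ˡ; ∈-++⁺ʳ)
  open import Data.List.Relation.Unary.All as All using (All; []; _∷_)
  open import Data.List.Relation.Unary.AllPairs using (AllPairs; []; _∷_)
  open import Data.List.Relation.Unary.Any as Any using (here; there)
  open import Data.Vec as Vec using (Vec; []; _∷_; insertAt; removeAt)
  open import Data.Vec.Properties using (removeAt-insertAt; lookup∘tabulate)
  open import Data.Product using (Σ; ∃; _×_; _,_; proj₁; proj₂)
  open import Data.Sum using (_⊎_; inj₁; inj₂)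
  open import Data.Empty using (⊥; ⊥-elim)
  open import Function using (_∘_; id)
  open import Relation.Nullary using (¬_; Dec; yes; no; does)
  open import Relation.Nullary.Decidable using (dec-true; _×-dec_)
  open import Relation.Binary.PropositionalEquality
  open import Algebra.Properties.Semiring.Sum +-*-semiring
    using (sum; sum-cong-≗; ∑-distrib-+; ∑-comm; *-distribˡ-sum; *-distribʳ-sum; sum-replicate-zero)
  open import Defs using (Graph; adj; irrefl; edges; pairs; allSubsets; isCliqueᵇ; cliquesThrough; js; degIn)
  open import Defs using () renaming (sym to adj-sym)

  -- Sums and clique counts over a vertex set

  𝟙 : Bool → ℕ
  𝟙 b = if b then 1 else 0

  𝟙≤1 : ∀ b → 𝟙 b ≤ 1
  𝟙≤1 true  = ≤-refl
  𝟙≤1 false = z≤n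

  𝟙-∧ : ∀ a b → 𝟙 (a ∧ b) ≡ 𝟙 a * 𝟙 b
  𝟙-∧ true  b = sym (+-identityʳ _)
  𝟙-∧ false b = refl

  𝟙-not : ∀ b → 𝟙 b + 𝟙 (not b) ≡ 1
  𝟙-not true  = refl
  𝟙-not false = refl

  -- Nonlinear inequalities below are derived from a sum L ≤ R of multiples of the hypotheses,
  -- whose comparison with x ≤ y is a pair of semiring identities.
  ≤-from : ∀ {x y L R} z → L ≤ R → x + z ≡ L → R ≡ y + z → x ≤ y
  ≤-from {x} {y} z L≤R p q = +-cancelʳ-≤ z x y (≤-trans (≤-reflexive p) (≤-trans L≤R (≤-reflexive q)))

  sum-mono-≤ : ∀ {n} {f g : Fin n → ℕ} → (∀ i → f i ≤ g i) → sum f ≤ sum g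
  sum-mono-≤ {zero}  h = z≤n
  sum-mono-≤ {suc n} h = +-mono-≤ (h zero) (sum-mono-≤ (h ∘ suc))

  sum-const : ∀ n c → sum {n} (λ _ → c) ≡ n * c
  sum-const zero    c = refl
  sum-const (suc n) c = cong (c +_) (sum-const n c)

  term≤sum : ∀ {n} (f : Fin n → ℕ) i → f i ≤ sum f
  term≤sum f zero    = m≤m+n _ _
  term≤sum f (suc i) = ≤-trans (term≤sum (f ∘ suc) i) (m≤n+m _ _)

  sum>0⇒term>0 : ∀ {n} (f : Fin n → ℕ) → 0 < sum f → ∃ λ i → 0 < f i
  sum>0⇒term>0 {suc n} f h with f zero in eq
  ... | suc _ = zero , subst (0 <_) (sym eq) (s≤s z≤n)
  ... | zero  = let i , p = sum>0⇒term>0 (f ∘ suc) h in suc i , p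

  sum-indicator : ∀ {n} (i : Fin n) → sum (λ j → 𝟙 (does (j Fin.≟ i))) ≡ 1
  sum-indicator {suc n} zero    = cong suc (sum-replicate-zero n)
  sum-indicator         (suc i) = sum-indicator i

  module _ {n : ℕ} where

    sumOn : (Fin n → Bool) → (Fin n → ℕ) → ℕ
    sumOn P f = sum (λ v → 𝟙 (P v) * f v)

    card : (Fin n → Bool) → ℕ
    card P = sum (λ v → 𝟙 (P v))

    module _ (P : Fin n → Bool) where

      sumOn-cong : ∀ {f g} → (∀ v → P v ≡ true → f v ≡ g v) → sumOn P f ≡ sumOn P g
      sumOn-cong {f} {g} h = sum-cong-≗ pt where
        pt : ∀ v → 𝟙 (P v) * f v ≡ 𝟙 (P v) * g v
        pt v with P v in eq
        ... | true  = cong (1 *_) (h v eq)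
        ... | false = refl

      sumOn-mono : ∀ {f g} → (∀ v → P v ≡ true → f v ≤ g v) → sumOn P f ≤ sumOn P g
      sumOn-mono {f} {g} h = sum-mono-≤ pt where
        pt : ∀ v → 𝟙 (P v) * f v ≤ 𝟙 (P v) * g v
        pt v with P v in eq
        ... | true  = *-monoʳ-≤ 1 (h v eq)
        ... | false = z≤n

      sumOn-+ : ∀ f g → sumOn P (λ v → f v + g v) ≡ sumOn P f + sumOn P g
      sumOn-+ f g = trans (sum-cong-≗ (λ v → *-distribˡ-+ (𝟙 (P v)) (f v) (g v)))
                          (∑-distrib-+ (λ v → 𝟙 (P v) * f v) _)

      sumOn-*ˡ : ∀ c f → sumOn P (λ v → c * f v) ≡ c * sumOn P f
      sumOn-*ˡ c f = trans (sum-cong-≗ (λ v → swap (𝟙 (P v)) c (f v))) (sym (*-distribˡ-sum c (λ v → 𝟙 (P v) * f v)))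
        where swap : ∀ p c x → p * (c * x) ≡ c * (p * x)
              swap = solve-∀

      sumOn-*ʳ : ∀ c f → sumOn P (λ v → f v * c) ≡ sumOn P f * c
      sumOn-*ʳ c f = trans (sumOn-cong (λ v _ → *-comm (f v) c)) (trans (sumOn-*ˡ c f) (*-comm c _))

      sumOn-const : ∀ c → sumOn P (λ _ → c) ≡ card P * c
      sumOn-const c = sym (*-distribʳ-sum c (λ v → 𝟙 (P v)))

      sumOn-1 : sumOn P (λ _ → 1) ≡ card P
      sumOn-1 = trans (sumOn-const 1) (*-identityʳ _)

      sumOn-comm : ∀ {m} (f : Fin m → Fin n → ℕ) →
                   sumOn P (λ v → sum (λ i → f i v)) ≡ sum (λ i → sumOn P (f i))
      sumOn-comm f = trans (sum-cong-≗ (λ v → *-distribˡ-sum (𝟙 (P v)) (λ i → f i v)))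
                           (∑-comm (λ v i → 𝟙 (P v) * f i v))

      sumOn>0⇒ : ∀ f → 0 < sumOn P f → ∃ λ v → P v ≡ true × 0 < f v
      sumOn>0⇒ f h with sum>0⇒term>0 _ h
      ... | v , p with P v in eq
      ...   | true  = v , eq , subst (0 <_) (+-identityʳ _) p

      sumOn≡0⇒ : ∀ f → sumOn P f ≡ 0 → ∀ v → P v ≡ true → f v ≡ 0
      sumOn≡0⇒ f h v Pv = n≤0⇒n≡0 (begin
        f v            ≡⟨ sym (+-identityʳ _) ⟩
        1 * f v        ≡⟨ cong (λ b → 𝟙 b * f v) (sym Pv) ⟩
        𝟙 (P v) * f v  ≤⟨ term≤sum (λ v → 𝟙 (P v) * f v) v ⟩
        sumOn P f      ≡⟨ h ⟩
        0              ∎)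
        where open ≤-Reasoning

    sumOn-swap : ∀ P Q (f : Fin n → Fin n → ℕ) →
                 sumOn P (λ u → sumOn Q (f u)) ≡ sumOn Q (λ v → sumOn P (λ u → f u v))
    sumOn-swap P Q f = trans (sumOn-comm P (λ v u → 𝟙 (Q v) * f u v))
                             (sum-cong-≗ (λ v → sumOn-*ˡ P (𝟙 (Q v)) (λ u → f u v)))

  module Cliques {n : ℕ} (A : Fin n → Fin n → Bool) (A-sym : ∀ u v → A u v ≡ A v u)
                 (A-irrefl : ∀ v → A v v ≡ false) (P : Fin n → Bool) where

    -- 1 if w is adjacent to every vertex of the list, else 0.
    joined : Fin n → List (Fin n) → ℕ
    joined w []      = 1
    joined w (u ∷ L) = 𝟙 (A u w) * joined w L

    joined≤1 : ∀ w L → joined w L ≤ 1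
    joined≤1 w []      = ≤-refl
    joined≤1 w (u ∷ L) = *-mono-≤ (𝟙≤1 (A u w)) (joined≤1 w L)

    codeg : List (Fin n) → ℕ
    codeg L = sumOn P (λ w → joined w L)

    -- Number of ordered s-tuples of vertices of P that extend L to a clique.
    ext : ℕ → List (Fin n) → ℕ
    ext zero    L = 1
    ext (suc s) L = sumOn P (λ v → joined v L * ext s (v ∷ L))

    deg nondeg : Fin n → ℕ
    deg v    = sumOn P (λ w → 𝟙 (A v w))
    nondeg v = sumOn P (λ w → 𝟙 (not (A v w)))

    N e₂ : ℕ
    N  = card P
    e₂ = sumOn P deg

    deg+nondeg : ∀ v → deg v + nondeg v ≡ N
    deg+nondeg v = trans (sym (sumOn-+ P _ _)) (trans (sumOn-cong P (λ w _ → 𝟙-not (A v w))) (sumOn-1 P))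

    codeg-[] : codeg [] ≡ N
    codeg-[] = sumOn-1 P

    codeg-singleton : ∀ v → codeg (v ∷ []) ≡ deg v
    codeg-singleton v = sumOn-cong P (λ w _ → *-identityʳ (𝟙 (A v w)))

    codeg≤codeg-∷+nondeg : ∀ v L → codeg L ≤ codeg (v ∷ L) + nondeg v
    codeg≤codeg-∷+nondeg v L = ≤-trans (sumOn-mono P pt) (≤-reflexive (sumOn-+ P _ _)) where
      pt : ∀ w → P w ≡ true → joined w L ≤ 𝟙 (A v w) * joined w L + 𝟙 (not (A v w))
      pt w _ with A v w
      ... | true  = ≤-trans (≤-reflexive (sym (*-identityˡ _))) (m≤m+n _ _)
      ... | false = joined≤1 w L

  -- The Moon–Moser inequality

  ∣-∣²-expand : ∀ a b → 2 * (a * b) + ∣ a - b ∣ * ∣ a - b ∣ ≡ a * a + b * b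
  ∣-∣²-expand a b with ≤-total a b
  ... | inj₁ a≤b rewrite m≤n⇒∣m-n∣≡n∸m a≤b = subst (λ x → 2 * (a * x) + (b ∸ a) * (b ∸ a) ≡ a * a + x * x) (m+[n∸m]≡n a≤b) (id₁ a (b ∸ a))
    where id₁ : ∀ a d → 2 * (a * (a + d)) + d * d ≡ a * a + (a + d) * (a + d)
          id₁ = solve-∀
  ... | inj₂ b≤a rewrite m≤n⇒∣n-m∣≡n∸m b≤a = subst (λ x → 2 * (x * b) + (a ∸ b) * (a ∸ b) ≡ x * x + b * b) (m+[n∸m]≡n b≤a) (id₂ b (a ∸ b))
    where id₂ : ∀ b d → 2 * ((b + d) * b) + d * d ≡ (b + d) * (b + d) + b * b
          id₂ = solve-∀

  2ab≤a²+b² : ∀ a b → 2 * (a * b) ≤ a * a + b * b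
  2ab≤a²+b² a b = ≤-trans (m≤m+n _ _) (≤-reflexive (∣-∣²-expand a b))

  ^-distribʳ-* : ∀ k a b → (a * b) ^ k ≡ a ^ k * b ^ k
  ^-distribʳ-* zero    a b = refl
  ^-distribʳ-* (suc k) a b = trans (cong (a * b *_) (^-distribʳ-* k a b)) (swap a b (a ^ k) (b ^ k))
    where swap : ∀ a b x y → a * b * (x * y) ≡ a * x * (b * y)
          swap = solve-∀

  -- For x = t (s+2), y = t (s+3) and q = Q (s+1), Moon-Moser bounds y/x below by ((s+2) q/x -
  -- N)/(s+1), and q/x is at least the previous ratio. The coefficient (s+2)(j+1) - (s+2+j) of N²
  -- equals (s+1)j, so the same shape returns with j lowered by one.
  ratio-step : ∀ s j N F M x y q → (2 + s + j) * N ≡ M → (N * N * suc j + suc s * F) * x ≤ M * q →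
               (2 + s) * q ≤ suc s * y + N * x → (N * N * j + (2 + s) * F) * x ≤ M * y
  ratio-step s j N F M x y q eq h₁ h₂ = *-cancelˡ-≤ (suc s)
    (≤-from ((2 + s) * (M * q) + N * M * x) (+-mono-≤ (*-monoʳ-≤ (2 + s) h₁) (*-monoˡ-≤ M h₂))
            (subst (λ M → suc s * ((N * N * j + (2 + s) * F) * x) + ((2 + s) * (M * q) + N * M * x)
                          ≡ (2 + s) * ((N * N * suc j + suc s * F) * x) + (2 + s) * q * M) eq (left s j N F x q))
            (right s N M x y q))
    where
    left : ∀ s j N F x q → suc s * ((N * N * j + (2 + s) * F) * x) + ((2 + s) * ((2 + s + j) * N * q) + N * ((2 + s + j) * N) * x)
           ≡ (2 + s) * ((N * N * suc j + suc s * F) * x) + (2 + s) * q * ((2 + s + j) * N)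
    left = solve-∀
    right : ∀ s N M x y q → (2 + s) * (M * q) + (suc s * y + N * x) * M ≡ suc s * (M * y) + ((2 + s) * (M * q) + N * M * x)
    right = solve-∀

  module MoonMoser {n : ℕ} (A : Fin n → Fin n → Bool) (A-sym : ∀ u v → A u v ≡ A v u)
                   (A-irrefl : ∀ v → A v v ≡ false) (P : Fin n → Bool) where

    open Cliques A A-sym A-irrefl P

    -- Moon-Moser deletes an arbitrary position of a clique, so tuples are vectors here, whose
    -- positions can be addressed; `t≡ext` converts back to the nested counts `ext`.
    tsum : ∀ s → (Vec (Fin n) s → ℕ) → ℕ
    tsum zero    g = g []
    tsum (suc s) g = sumOn P (λ v → tsum s (λ L → g (v ∷ L)))

    tsum-mono : ∀ s {f g} → (∀ L → f L ≤ g L) → tsum s f ≤ tsum s g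
    tsum-mono zero    h = h []
    tsum-mono (suc s) h = sumOn-mono P (λ v _ → tsum-mono s (λ L → h (v ∷ L)))

    tsum-cong : ∀ s {f g} → (∀ L → f L ≡ g L) → tsum s f ≡ tsum s g
    tsum-cong zero    h = h []
    tsum-cong (suc s) h = sumOn-cong P (λ v _ → tsum-cong s (λ L → h (v ∷ L)))

    tsum-+ : ∀ s f g → tsum s (λ L → f L + g L) ≡ tsum s f + tsum s g
    tsum-+ zero    f g = refl
    tsum-+ (suc s) f g = trans (sumOn-cong P (λ v _ → tsum-+ s (λ L → f (v ∷ L)) (λ L → g (v ∷ L)))) (sumOn-+ P _ _)

    tsum-*ˡ : ∀ s c f → tsum s (λ L → c * f L) ≡ c * tsum s f
    tsum-*ˡ zero    c f = refl
    tsum-*ˡ (suc s) c f = trans (sumOn-cong P (λ v _ → tsum-*ˡ s c (λ L → f (v ∷ L)))) (sumOn-*ˡ P c _)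

    tsum-sumOn : ∀ s (f : Fin n → Vec (Fin n) s → ℕ) →
                 tsum s (λ L → sumOn P (λ w → f w L)) ≡ sumOn P (λ w → tsum s (f w))
    tsum-sumOn zero    f = refl
    tsum-sumOn (suc s) f = trans (sumOn-cong P (λ v _ → tsum-sumOn s (λ w L → f w (v ∷ L))))
                                 (sumOn-swap P P (λ v w → tsum s (λ L → f w (v ∷ L))))

    tsum-sum : ∀ {m} s (f : Fin m → Vec (Fin n) s → ℕ) →
               tsum s (λ L → sum (λ i → f i L)) ≡ sum (λ i → tsum s (f i))
    tsum-sum zero    f = refl
    tsum-sum (suc s) f = trans (sumOn-cong P (λ v _ → tsum-sum s (λ i L → f i (v ∷ L))))
                               (sumOn-comm P (λ i v → tsum s (λ L → f i (v ∷ L))))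

    tsum-insert : ∀ s (i : Fin (suc s)) g →
                  tsum (suc s) g ≡ sumOn P (λ v → tsum s (λ L → g (insertAt L i v)))
    tsum-insert s       zero    g = refl
    tsum-insert (suc s) (suc i) g =
      trans (sumOn-cong P (λ u _ → tsum-insert s i (λ L → g (u ∷ L))))
            (sumOn-swap P P (λ u v → tsum s (λ L → g (u ∷ insertAt L i v))))

    joinedᵛ : ∀ {s} → Fin n → Vec (Fin n) s → ℕ
    joinedᵛ w L = joined w (Vec.toList L)

    codegᵛ : ∀ {s} → Vec (Fin n) s → ℕ
    codegᵛ L = codeg (Vec.toList L)

    clique : ∀ {s} → Vec (Fin n) s → ℕ
    clique []      = 1
    clique (v ∷ L) = joinedᵛ v L * clique L

    joined-insert : ∀ {s} w (L : Vec (Fin n) s) i v → joinedᵛ w (insertAt L i v) ≡ joinedᵛ w (v ∷ L)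
    joined-insert w L       zero    v = refl
    joined-insert w (u ∷ L) (suc i) v =
      trans (cong (𝟙 (A u w) *_) (joined-insert w L i v)) (swap (𝟙 (A u w)) (𝟙 (A v w)) (joinedᵛ w L))
      where swap : ∀ x y z → x * (y * z) ≡ y * (x * z)
            swap = solve-∀

    clique-insert : ∀ {s} (L : Vec (Fin n) s) i v → clique (insertAt L i v) ≡ clique (v ∷ L)
    clique-insert L       zero    v = refl
    clique-insert (u ∷ L) (suc i) v =
      trans (cong₂ _*_ (joined-insert u L i v) (clique-insert L i v))
      (trans (cong (λ b → 𝟙 b * joinedᵛ u L * (joinedᵛ v L * clique L)) (A-sym v u))
             (swap (𝟙 (A u v)) (joinedᵛ u L) (joinedᵛ v L) (clique L)))
      where swap : ∀ x y z w → x * y * (z * w) ≡ x * z * (y * w)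
            swap = solve-∀

    t Q : ℕ → ℕ
    t s = tsum s clique
    Q s = tsum s (λ L → clique L * (codegᵛ L * codegᵛ L))

    extend-sum : ∀ s (h : Vec (Fin n) s → ℕ) → sumOn P (λ v → tsum s (λ L → clique (v ∷ L) * h L)) ≡ tsum s (λ L → clique L * (codegᵛ L * h L))
    extend-sum s h = trans (sym (tsum-sumOn s (λ v L → clique (v ∷ L) * h L))) (tsum-cong s (λ L →
      trans (sumOn-cong P (λ v _ → assoc (joinedᵛ v L) (clique L) (h L)))
      (trans (sumOn-*ʳ P (clique L * h L) (λ v → joinedᵛ v L)) (shift (codegᵛ L) (clique L) (h L)))))
      where assoc : ∀ x y z → x * y * z ≡ x * (y * z)
            assoc = solve-∀
            shift : ∀ x y z → x * (y * z) ≡ y * (x * z)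
            shift = solve-∀

    t-suc : ∀ s → t (suc s) ≡ tsum s (λ L → clique L * codegᵛ L)
    t-suc s = trans (sumOn-cong P (λ v _ → tsum-cong s (λ L → sym (*-identityʳ (clique (v ∷ L))))))
                    (trans (extend-sum s (λ _ → 1)) (tsum-cong s {f = λ L → clique L * (codegᵛ L * 1)} (λ L → cong (clique L *_) (*-identityʳ (codegᵛ L)))))

    -- If w is joined to all of L every term is 1; otherwise at most one term is 1.
    removals : ∀ {s} w (L : Vec (Fin n) (suc s)) →
               sum (λ i → joinedᵛ w (removeAt L i)) ≤ s * joinedᵛ w L + 1
    removals {zero}  w (v ∷ []) = ≤-refl
    removals {suc s} w (v ∷ L@(_ ∷ _)) with A v w
    ... | true  = begin
      joinedᵛ w L + sum (λ i → joinedᵛ w (removeAt L i) + 0) ≡⟨ cong (joinedᵛ w L +_) (sum-cong-≗ (λ i → +-identityʳ (joinedᵛ w (removeAt L i)))) ⟩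
      joinedᵛ w L + sum (λ i → joinedᵛ w (removeAt L i))     ≤⟨ +-monoʳ-≤ (joinedᵛ w L) (removals w L) ⟩
      joinedᵛ w L + (s * joinedᵛ w L + 1)                    ≡⟨ regroup s (joinedᵛ w L) ⟩
      suc s * (joinedᵛ w L + 0) + 1                          ∎
      where open ≤-Reasoning
            regroup : ∀ s x → x + (s * x + 1) ≡ suc s * (x + 0) + 1
            regroup = solve-∀
    ... | false = begin
      joinedᵛ w L + sum {suc s} (λ _ → 0) ≡⟨ cong (joinedᵛ w L +_) (sum-replicate-zero (suc s)) ⟩
      joinedᵛ w L + 0                     ≤⟨ +-monoˡ-≤ 0 (joined≤1 w (Vec.toList L)) ⟩
      1                                   ≤⟨ m≤n+m 1 (suc s * 0) ⟩
      suc s * 0 + 1                       ∎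
      where open ≤-Reasoning

    codeg-removals : ∀ {s} (L : Vec (Fin n) (suc s)) → sum (λ i → codegᵛ (removeAt L i)) ≤ s * codegᵛ L + N
    codeg-removals {s} L = begin
      sum (λ i → codegᵛ (removeAt L i))                      ≡⟨ sym (sumOn-comm P (λ i w → joinedᵛ w (removeAt L i))) ⟩
      sumOn P (λ w → sum (λ i → joinedᵛ w (removeAt L i)))   ≤⟨ sumOn-mono P (λ w _ → removals w L) ⟩
      sumOn P (λ w → s * joinedᵛ w L + 1)                    ≡⟨ sumOn-+ P _ _ ⟩
      sumOn P (λ w → s * joinedᵛ w L) + sumOn P (λ _ → 1)    ≡⟨ cong₂ _+_ (sumOn-*ˡ P s _) (sumOn-1 P) ⟩
      s * codegᵛ L + N                                       ∎
      where open ≤-Reasoning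

    -- Double count of a clique of s+1 vertices, a position i and a vertex w joined to all the other
    -- vertices. Deleting position i leaves an s-clique with two independent choices from its common
    -- neighbourhood, so each position contributes `Q s`; with the clique fixed first,
    -- `codeg-removals` applies.
    moonMoser : ∀ s → suc s * Q s ≤ s * t (2 + s) + N * t (1 + s)
    moonMoser s = begin
      suc s * Q s
        ≡⟨ sym (sum-const (suc s) (Q s)) ⟩
      sum {suc s} (λ _ → Q s)
        ≡⟨ sum-cong-≗ (λ i → sym (position i)) ⟩
      sum (λ i → tsum (suc s) (λ L → clique L * codegᵛ (removeAt L i)))
        ≡⟨ sym (tsum-sum (suc s) (λ i L → clique L * codegᵛ (removeAt L i))) ⟩
      tsum (suc s) (λ L → sum (λ i → clique L * codegᵛ (removeAt L i)))
        ≤⟨ tsum-mono (suc s) (λ L → ≤-trans (≤-reflexive (sym (*-distribˡ-sum (clique L) (λ i → codegᵛ (removeAt L i)))))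
                                            (*-monoʳ-≤ (clique L) (codeg-removals L))) ⟩
      tsum (suc s) (λ L → clique L * (s * codegᵛ L + N))
        ≡⟨ tsum-cong (suc s) (λ L → expand (clique L) s (codegᵛ L) N) ⟩
      tsum (suc s) (λ L → s * (clique L * codegᵛ L) + N * clique L)
        ≡⟨ tsum-+ (suc s) (λ L → s * (clique L * codegᵛ L)) (λ L → N * clique L) ⟩
      tsum (suc s) (λ L → s * (clique L * codegᵛ L)) + tsum (suc s) (λ L → N * clique L)
        ≡⟨ cong₂ _+_ (trans (tsum-*ˡ (suc s) s (λ L → clique L * codegᵛ L)) (cong (s *_) (sym (t-suc (suc s))))) (tsum-*ˡ (suc s) N clique) ⟩
      s * t (2 + s) + N * t (1 + s) ∎
      where
      open ≤-Reasoning
      expand : ∀ x s c m → x * (s * c + m) ≡ s * (x * c) + m * x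
      expand = solve-∀
      position : ∀ i → tsum (suc s) (λ L → clique L * codegᵛ (removeAt L i)) ≡ Q s
      position i = trans (tsum-insert s i (λ L → clique L * codegᵛ (removeAt L i)))
        (trans (sumOn-cong P (λ v _ → tsum-cong s (λ L →
                  cong₂ (λ x M → x * codegᵛ M) (clique-insert L i v) (removeAt-insertAt L i v))))
               (extend-sum s codegᵛ))

    -- Indicator of complete adjacency between the two lists. It separates the edges inside an
    -- extension from those to the list being extended, which is how `ext` becomes a `tsum`.
    cross : ∀ {s} → Vec (Fin n) s → List (Fin n) → ℕ
    cross []       L = 1
    cross (v ∷ L′) L = joined v L * cross L′ L

    cross-∷ : ∀ {s} (L′ : Vec (Fin n) s) v L → cross L′ (v ∷ L) ≡ joinedᵛ v L′ * cross L′ L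
    cross-∷ []       v L = refl
    cross-∷ (u ∷ L′) v L =
      trans (cong (𝟙 (A v u) * joined u L *_) (cross-∷ L′ v L))
      (trans (cong (λ b → 𝟙 b * joined u L * (joinedᵛ v L′ * cross L′ L)) (A-sym v u))
             (swap (𝟙 (A u v)) (joined u L) (joinedᵛ v L′) (cross L′ L)))
      where swap : ∀ x y z w → x * y * (z * w) ≡ x * z * (y * w)
            swap = solve-∀

    ext-tsum : ∀ s L → ext s L ≡ tsum s (λ L′ → clique L′ * cross L′ L)
    ext-tsum zero    L = refl
    ext-tsum (suc s) L = sumOn-cong P (λ v _ →
      trans (cong (joined v L *_) (ext-tsum s (v ∷ L)))
      (trans (sym (tsum-*ˡ s (joined v L) (λ L′ → clique L′ * cross L′ (v ∷ L)))) (tsum-cong s (λ L′ →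
        trans (cong (λ x → joined v L * (clique L′ * x)) (cross-∷ L′ v L))
              (regroup (joined v L) (clique L′) (joinedᵛ v L′) (cross L′ L))))))
      where regroup : ∀ x y z w → x * (y * (z * w)) ≡ (z * y) * (x * w)
            regroup = solve-∀

    t≡ext : ∀ s → t s ≡ ext s []
    t≡ext s = trans (tsum-cong s (λ L → sym (trans (cong (clique L *_) (cross-[] L)) (*-identityʳ _)))) (sym (ext-tsum s []))
      where cross-[] : ∀ {s} (L : Vec (Fin n) s) → cross L [] ≡ 1
            cross-[] []      = refl
            cross-[] (v ∷ L) = trans (+-identityʳ _) (cross-[] L)

    t1≡N : t 1 ≡ N
    t1≡N = trans (t-suc 0) (trans (+-identityʳ _) codeg-[])

    t2≡e₂ : t 2 ≡ e₂
    t2≡e₂ = trans (t-suc 1) (sumOn-cong P (λ v _ → trans (+-identityʳ _) (codeg-singleton v)))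

    -- The successive ratios t (1 + s) / t s are at least those of the r-partite Turán graph,
    -- plus a gain of s F / (r N): the Moon–Moser inequality propagates this from s to s + 1.
    module Supersaturation (k F J : ℕ) (N>0 : 0 < N) (density : suc k * (N * N) + F ≤ (2 + k) * e₂)
                           (ext≤ : ∀ u v → P u ≡ true → P v ≡ true → A u v ≡ true →
                                   ext (suc k) (v ∷ u ∷ []) ≤ suc k ! * J) where

      r M : ℕ
      r = 2 + k
      M = r * N

      instance
        N≢0 : NonZero N
        N≢0 = ℕ.>-nonZero N>0
        M≢0 : NonZero M
        M≢0 = m*n≢0 r N

      ratio : ∀ s j → suc s + j ≡ r → (N * N * j + suc s * F) * t (suc s) ≤ M * t (2 + s)
      ratio zero j eq = begin
        (N * N * j + 1 * F) * t 1     ≡⟨ cong₂ (λ j x → (N * N * j + 1 * F) * x) (suc-injective eq) t1≡N ⟩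
        (N * N * suc k + 1 * F) * N   ≡⟨ regroup N k F ⟩
        (suc k * (N * N) + F) * N     ≤⟨ *-monoˡ-≤ N density ⟩
        (2 + k) * e₂ * N              ≡⟨ trans (swap (2 + k) e₂ N) (cong (M *_) (sym t2≡e₂)) ⟩
        M * t 2                       ∎
        where
        open ≤-Reasoning
        regroup : ∀ N k F → (N * N * suc k + 1 * F) * N ≡ (suc k * (N * N) + F) * N
        regroup = solve-∀
        swap : ∀ r e N → r * e * N ≡ r * N * e
        swap = solve-∀
      ratio (suc s) j eq = ratio-step s j N F M x (t (3 + s)) (Q (suc s)) (cong (_* N) eq) MQ (moonMoser (suc s))
        where
        x p : ℕ
        x = t (2 + s)
        p = N * N * suc j + suc s * F
        IH : p * t (suc s) ≤ M * x
        IH = ratio s (suc j) (trans (cong suc (+-suc s j)) eq)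
        -- Cauchy-Schwarz in tangent form: the square of p - M c is summed over all cliques with
        -- codegree c, where p/M is the lower bound on their mean codegree. The induction hypothesis
        -- then eliminates `t (suc s)` without a division.
        cauchy : 2 * (p * M) * x ≤ M * M * Q (suc s) + p * p * t (suc s)
        cauchy = begin
          2 * (p * M) * x                                                       ≡⟨ cong (2 * (p * M) *_) (t-suc (suc s)) ⟩
          2 * (p * M) * tsum (suc s) (λ L → clique L * codegᵛ L)                ≡⟨ sym (tsum-*ˡ (suc s) (2 * (p * M)) (λ L → clique L * codegᵛ L)) ⟩
          tsum (suc s) (λ L → 2 * (p * M) * (clique L * codegᵛ L))              ≤⟨ tsum-mono (suc s) (λ L → pt (clique L) (codegᵛ L)) ⟩
          tsum (suc s) (λ L → M * M * (clique L * (codegᵛ L * codegᵛ L)) + p * p * clique L)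
                                                                                ≡⟨ tsum-+ (suc s) (λ L → M * M * (clique L * (codegᵛ L * codegᵛ L))) (λ L → p * p * clique L) ⟩
          tsum (suc s) (λ L → M * M * (clique L * (codegᵛ L * codegᵛ L))) + tsum (suc s) (λ L → p * p * clique L)
                                                                                ≡⟨ cong₂ _+_ (tsum-*ˡ (suc s) (M * M) (λ L → clique L * (codegᵛ L * codegᵛ L))) (tsum-*ˡ (suc s) (p * p) clique) ⟩
          M * M * Q (suc s) + p * p * t (suc s)                                 ∎
          where
          open ≤-Reasoning
          pt : ∀ q c → 2 * (p * M) * (q * c) ≤ M * M * (q * (c * c)) + p * p * q
          pt q c = subst₂ _≤_ (i₁ q c p M) (i₂ q c p M) (*-monoʳ-≤ q (2ab≤a²+b² p (M * c)))
            where i₁ : ∀ q c p M → q * (2 * (p * (M * c))) ≡ 2 * (p * M) * (q * c)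
                  i₁ = solve-∀
                  i₂ : ∀ q c p M → q * (p * p + M * c * (M * c)) ≡ M * M * (q * (c * c)) + p * p * q
                  i₂ = solve-∀
        MQ : p * x ≤ M * Q (suc s)
        MQ = *-cancelˡ-≤ M (≤-from (p * p * t (suc s) + p * M * x) (+-mono-≤ cauchy (*-monoʳ-≤ p IH))
               (i₁ M p x (t (suc s))) (i₂ M p x (t (suc s)) (Q (suc s))))
          where i₁ : ∀ M p x y → M * (p * x) + (p * p * y + p * M * x) ≡ 2 * (p * M) * x + p * (p * y)
                i₁ = solve-∀
                i₂ : ∀ M p x y q → M * M * q + p * p * y + p * (M * x) ≡ M * (M * q) + (p * p * y + p * M * x)
                i₂ = solve-∀

      chain : ∀ i j → i + j ≡ k → (N * N) ^ i * k ! * t 2 ≤ t (2 + i) * M ^ i * j !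
      chain zero    j refl = ≤-reflexive (regroup (k !) (t 2))
        where regroup : ∀ a b → 1 * a * b ≡ b * 1 * a
              regroup = solve-∀
      chain (suc i) j eq   = begin
        N * N * (N * N) ^ i * k ! * t 2          ≡⟨ out (N * N) ((N * N) ^ i) (k !) (t 2) ⟩
        N * N * ((N * N) ^ i * k ! * t 2)        ≤⟨ *-monoʳ-≤ (N * N) (chain i (suc j) (trans (+-suc i j) eq)) ⟩
        N * N * (t (2 + i) * M ^ i * (suc j !))  ≡⟨ regroup N (t (2 + i)) (M ^ i) j (j !) ⟩
        (N * N * suc j) * t (2 + i) * (M ^ i * j !)
                                                 ≤⟨ *-monoˡ-≤ (M ^ i * j !) (≤-trans (*-monoˡ-≤ (t (2 + i)) (m≤m+n (N * N * suc j) ((2 + i) * F))) (ratio (suc i) (suc j) (cong (2 +_) (trans (+-suc i j) eq)))) ⟩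
        M * t (3 + i) * (M ^ i * j !)            ≡⟨ back M (t (3 + i)) (M ^ i) (j !) ⟩
        t (3 + i) * M ^ suc i * j !              ∎
        where
        open ≤-Reasoning
        out : ∀ a b c d → a * b * c * d ≡ a * (b * c * d)
        out = solve-∀
        regroup : ∀ N t m j f → N * N * (t * m * (suc j * f)) ≡ (N * N * suc j) * t * (m * f)
        regroup = solve-∀
        back : ∀ M t m f → M * t * (m * f) ≡ t * (M * m) * f
        back = solve-∀

      t≤ext : t (3 + k) ≤ suc k ! * J * t 2
      t≤ext = begin
        t (3 + k)                                            ≡⟨ t≡ext (3 + k) ⟩
        ext (3 + k) []                                       ≤⟨ sumOn-mono P (λ u Pu → ≤-trans (≤-reflexive (+-identityʳ _)) (sumOn-mono P (λ v Pv → edge u v Pu Pv))) ⟩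
        sumOn P (λ u → sumOn P (λ v → 𝟙 (A u v) * (suc k ! * J)))
                                                             ≡⟨ sumOn-cong P (λ u _ → sumOn-*ʳ P (suc k ! * J) (λ v → 𝟙 (A u v))) ⟩
        sumOn P (λ u → deg u * (suc k ! * J))                ≡⟨ sumOn-*ʳ P (suc k ! * J) deg ⟩
        e₂ * (suc k ! * J)                                   ≡⟨ trans (*-comm e₂ _) (cong (suc k ! * J *_) (sym t2≡e₂)) ⟩
        suc k ! * J * t 2                                    ∎
        where
        open ≤-Reasoning
        edge : ∀ u v → P u ≡ true → P v ≡ true →
               joined v (u ∷ []) * ext (suc k) (v ∷ u ∷ []) ≤ 𝟙 (A u v) * (suc k ! * J)
        edge u v Pu Pv with A u v in Auv
        ... | true  = *-monoʳ-≤ 1 (ext≤ u v Pu Pv Auv)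
        ... | false = z≤n

      e₂>0 : 0 < t 2
      e₂>0 with t 2 in eq
      ... | suc _ = s≤s z≤n
      ... | zero  = ⊥-elim (<⇒≱ (*-mono-< N>0 N>0) (begin
        N * N                   ≤⟨ m≤m+n _ _ ⟩
        suc k * (N * N)         ≤⟨ m≤m+n _ F ⟩
        suc k * (N * N) + F     ≤⟨ density ⟩
        (2 + k) * e₂            ≡⟨ cong ((2 + k) *_) (trans (sym t2≡e₂) eq) ⟩
        (2 + k) * 0             ≡⟨ *-zeroʳ (2 + k) ⟩
        0                       ∎))
        where open ≤-Reasoning

      supersaturation : F * N ^ k ≤ suc k * J * r ^ k * N
      supersaturation = *-cancelˡ-≤ (N ^ k) {{m^n≢0 N k}} (*-cancelˡ-≤ (k !) {{k !≢0}} (*-cancelˡ-≤ r (*-cancelˡ-≤ (t 2) {{ℕ.>-nonZero e₂>0}} (begin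
        t 2 * (r * (k ! * (N ^ k * (F * N ^ k))))      ≡⟨ left (t 2) r (k !) (N ^ k) F ⟩
        r * F * (N ^ k * N ^ k * k ! * t 2)            ≡⟨ cong (λ x → r * F * (x * k ! * t 2)) (sym (^-distribʳ-* k N N)) ⟩
        r * F * ((N * N) ^ k * k ! * t 2)              ≤⟨ *-monoʳ-≤ (r * F) (chain k 0 (+-identityʳ k)) ⟩
        r * F * (t r * M ^ k * 1)                      ≡⟨ mid r F (t r) (M ^ k) ⟩
        -- At j = 0 the Turán part of the ratio vanishes, so the passage from r-cliques to
        -- (r+1)-cliques is paid by F alone.
        r * F * t r * M ^ k                            ≤⟨ *-monoˡ-≤ (M ^ k) (≤-trans (*-monoˡ-≤ (t r) (m≤n+m (r * F) (N * N * 0))) (ratio (suc k) 0 (+-identityʳ r))) ⟩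
        M * t (suc r) * M ^ k                          ≤⟨ *-monoˡ-≤ (M ^ k) (*-monoʳ-≤ M t≤ext) ⟩
        M * (suc k ! * J * t 2) * M ^ k                ≡⟨ cong (M * (suc k ! * J * t 2) *_) (^-distribʳ-* k r N) ⟩
        M * (suc k ! * J * t 2) * (r ^ k * N ^ k)      ≡⟨ right r N k (k !) J (t 2) (r ^ k) (N ^ k) ⟩
        t 2 * (r * (k ! * (N ^ k * (suc k * J * r ^ k * N)))) ∎))))
        where
        open ≤-Reasoning
        left : ∀ t r f x F → t * (r * (f * (x * (F * x)))) ≡ r * F * (x * x * f * t)
        left = solve-∀
        mid : ∀ r F t m → r * F * (t * m * 1) ≡ r * F * t * m
        mid = solve-∀
        right : ∀ r N k f J t x y → r * N * (suc k * f * J * t) * (x * y) ≡ t * (r * (f * (y * (suc k * J * x * N))))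
        right = solve-∀

  -- Greedy extension in graphs of large minimum degree

  -- Equivalent to (d - c) (d - c - 1) ≥ 0, valid for integers.
  consecutive-product : ∀ c d → (2 * c + 1) * d ≤ d * d + c * (c + 1)
  consecutive-product c d with d ℕ.≤? c
  ... | yes d≤c = subst (λ c → (2 * c + 1) * d ≤ d * d + c * (c + 1)) (m+[n∸m]≡n d≤c)
                    (≤-trans (m≤m+n _ _) (≤-reflexive (identity d (c ∸ d))))
    where identity : ∀ d e → (2 * (d + e) + 1) * d + (e * e + e) ≡ d * d + (d + e) * (d + e + 1)
          identity = solve-∀
  ... | no  d≰c = subst (λ d → (2 * c + 1) * d ≤ d * d + c * (c + 1)) (m+[n∸m]≡n (≰⇒> d≰c))
                    (≤-trans (m≤m+n _ _) (≤-reflexive (identity c (d ∸ suc c))))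
    where identity : ∀ c e → (2 * c + 1) * (suc c + e) + (e * e + e) ≡ (suc c + e) * (suc c + e) + c * (c + 1)
          identity = solve-∀

  module Extraction {n : ℕ} (A : Fin n → Fin n → Bool) (A-sym : ∀ u v → A u v ≡ A v u)
                    (A-irrefl : ∀ v → A v v ≡ false) (P : Fin n → Bool) where

    open Cliques A A-sym A-irrefl P

    InP : List (Fin n) → Set
    InP = All (λ v → P v ≡ true)

    Clique : List (Fin n) → Set
    Clique = AllPairs (λ v u → A u v ≡ true)

    joined>0⇒All : ∀ v L → 0 < joined v L → All (λ u → A u v ≡ true) L
    joined>0⇒All v []      h = []
    joined>0⇒All v (u ∷ L) h with A u v in Auv
    ... | true = Auv ∷ joined>0⇒All v L (subst (0 <_) (+-identityʳ _) h)

    factors>0 : ∀ a b → 0 < a * b → 0 < a × 0 < b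
    factors>0 (suc a) (suc b) h = s≤s z≤n , s≤s z≤n
    factors>0 (suc a) zero    h = ⊥-elim (<-irrefl refl (subst (0 <_) (*-zeroʳ a) h))

    ext>0⇒clique : ∀ s L → InP L → Clique L → 0 < ext s L →
                   ∃ λ L′ → length L′ ≡ s + length L × InP L′ × Clique L′
    ext>0⇒clique zero    L inP cl h = L , refl , inP , cl
    ext>0⇒clique (suc s) L inP cl h =
      let v , Pv , h′ = sumOn>0⇒ P _ h
          j>0 , e>0 = factors>0 (joined v L) _ h′
          L′ , len , rest = ext>0⇒clique s (v ∷ L) (Pv ∷ inP) (joined>0⇒All v L j>0 ∷ cl) e>0
      in L′ , trans len (+-suc s _) , rest

    -- Supplies the anchors `κ` of the colouring: without (r+1)-cliques, the vertices of an r-clique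
    -- have no common neighbour in P, so every vertex misses one of them.
    ext>0⇒maximal : ∀ s L → InP L → 0 < ext s L → ext (suc s) L ≡ 0 →
                    ∃ λ L′ → length L′ ≡ s + length L × InP L′ × codeg L′ ≡ 0
    ext>0⇒maximal zero    L inP h z =
      L , refl , inP , trans (sumOn-cong P (λ v _ → sym (*-identityʳ (joined v L)))) z
    ext>0⇒maximal (suc s) L inP h z =
      let v , Pv , h′ = sumOn>0⇒ P _ h
          j>0 , e>0 = factors>0 (joined v L) _ h′
          z′ = m*n≡0⇒m≡0∨n≡0 (joined v L) (sumOn≡0⇒ P (λ v → joined v L * ext (suc s) (v ∷ L)) z v Pv)
          L′ , len , rest = ext>0⇒maximal s (v ∷ L) (Pv ∷ inP) e>0 (pick z′ j>0)
      in L′ , trans len (+-suc s _) , rest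
      where pick : ∀ {a b} → a ≡ 0 ⊎ b ≡ 0 → 0 < a → b ≡ 0
            pick (inj₁ refl) ()
            pick (inj₂ eq)   _ = eq

  module HighDegree {n : ℕ} (A : Fin n → Fin n → Bool) (A-sym : ∀ u v → A u v ≡ A v u)
                    (A-irrefl : ∀ v → A v v ≡ false) (P : Fin n → Bool) (r T : ℕ) where

    open Cliques A A-sym A-irrefl P
    open Extraction A A-sym A-irrefl P

    module _ (nondeg≤ : ∀ v → P v ≡ true → r * nondeg v ≤ N + T) where

      -- Each new vertex lowers r times the codegree by at most N + T. With z as the reserve for the
      -- last vertex, the numbers of choices are at least s(N+T)/r, ..., (N+T)/r and finally z/r.
      -- The bound is linear in z, which `codeg≤B` exploits.
      greedy : ∀ s L z → s * (N + T) + z ≤ r * codeg L → s ! * N ^ s * z ≤ r ^ suc s * ext (suc s) L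
      greedy zero    L z h = begin
        1 * 1 * z           ≡⟨ trans (*-assoc 1 1 z) (trans (*-identityˡ _) (*-identityˡ z)) ⟩
        z                   ≤⟨ h ⟩
        r * codeg L         ≡⟨ cong₂ _*_ (sym (*-identityʳ r)) (sumOn-cong P (λ v _ → sym (*-identityʳ (joined v L)))) ⟩
        r * 1 * ext 1 L     ∎
        where open ≤-Reasoning
      greedy (suc s) L z h = begin
        suc s * s ! * (N * N ^ s) * z                 ≡⟨ regroup s (s !) N (N ^ s) z ⟩
        suc s * N * (s ! * N ^ s * z)                 ≤⟨ *-monoˡ-≤ (s ! * N ^ s * z) (≤-trans (*-monoʳ-≤ (suc s) (m≤m+n N T)) (≤-trans (m≤m+n _ z) h)) ⟩
        r * codeg L * (s ! * N ^ s * z)               ≡⟨ *-assoc r _ _ ⟩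
        r * (codeg L * (s ! * N ^ s * z))             ≡⟨ cong (r *_) (sym (sumOn-*ʳ P (s ! * N ^ s * z) (λ v → joined v L))) ⟩
        r * sumOn P (λ v → joined v L * (s ! * N ^ s * z))
                                                      ≤⟨ *-monoʳ-≤ r (sumOn-mono P (λ v Pv → *-monoʳ-≤ (joined v L) (greedy s (v ∷ L) z (room v Pv)))) ⟩
        r * sumOn P (λ v → joined v L * (r ^ suc s * ext (suc s) (v ∷ L)))
                                                      ≡⟨ cong (r *_) (trans (sumOn-cong P (λ v _ → swap (joined v L) (r ^ suc s) (ext (suc s) (v ∷ L)))) (sumOn-*ˡ P (r ^ suc s) (λ v → joined v L * ext (suc s) (v ∷ L)))) ⟩
        r * (r ^ suc s * ext (2 + s) L)               ≡⟨ sym (*-assoc r (r ^ suc s) _) ⟩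
        r ^ (2 + s) * ext (2 + s) L                   ∎
        where
        open ≤-Reasoning
        regroup : ∀ s f N x z → suc s * f * (N * x) * z ≡ suc s * N * (f * x * z)
        regroup = solve-∀
        swap : ∀ x y z → x * (y * z) ≡ y * (x * z)
        swap = solve-∀
        room : ∀ v → P v ≡ true → s * (N + T) + z ≤ r * codeg (v ∷ L)
        room v Pv = ≤-from (N + T + r * nondeg v)
          (+-mono-≤ (≤-trans h (*-monoʳ-≤ r (codeg≤codeg-∷+nondeg v L))) (nondeg≤ v Pv))
          (i₁ s (N + T) z r (nondeg v)) (i₂ r (codeg (v ∷ L)) (nondeg v) (N + T))
          where i₁ : ∀ s m z r d → s * m + z + (m + r * d) ≡ suc s * m + z + r * d
                i₁ = solve-∀
                i₂ : ∀ r c d m → r * (c + d) + m ≡ r * c + (m + r * d)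
                i₂ = solve-∀

      greedy>0 : ∀ s L → 0 < N → s * (N + T) < r * codeg L → 0 < ext (suc s) L
      greedy>0 s L N>0 h with ext (suc s) L in eq
      ... | suc _ = s≤s z≤n
      ... | zero  = ⊥-elim (<⇒≱ (*-mono-< (*-mono-< (1≤n! s) (m^n>0 N {{ℕ.>-nonZero N>0}} s)) (s≤s z≤n))
                                (≤-trans (greedy s L 1 (≤-trans (≤-reflexive (+-comm _ 1)) h))
                                         (≤-reflexive (trans (cong (r ^ suc s *_) eq) (*-zeroʳ (r ^ suc s))))))

    -- `hitPairs w L` is the binomial coefficient of `hits w L` over 2, written so that it splits
    -- along the list. Summed over w it gives the codegrees of all pairs in L.
    hits hitPairs : Fin n → List (Fin n) → ℕ
    hits w []       = 0
    hits w (v ∷ L)  = 𝟙 (A v w) + hits w L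
    hitPairs w []      = 0
    hitPairs w (v ∷ L) = 𝟙 (A v w) * hits w L + hitPairs w L

    hitPairs-hits : ∀ w L → 2 * hitPairs w L + hits w L ≡ hits w L * hits w L
    hitPairs-hits w []      = refl
    hitPairs-hits w (v ∷ L) with A v w
    ... | false = hitPairs-hits w L
    ... | true  = trans (i₁ (hitPairs w L) (hits w L)) (trans (cong (λ x → suc (2 * hits w L) + x) (hitPairs-hits w L)) (i₂ (hits w L)))
      where i₁ : ∀ p h → 2 * (1 * h + p) + suc h ≡ suc (2 * h) + (2 * p + h)
            i₁ = solve-∀
            i₂ : ∀ h → suc (2 * h) + h * h ≡ suc h * suc h
            i₂ = solve-∀

    hits-sum : (nondeg≤ : ∀ v → P v ≡ true → r * nondeg v ≤ N + T) → ∀ L → InP L →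
               length L * (r * N) ≤ r * sumOn P (λ w → hits w L) + length L * (N + T)
    hits-sum nondeg≤ []      []         = z≤n
    hits-sum nondeg≤ (v ∷ L) (Pv ∷ inP) = ≤-from (r * nondeg v)
      (+-mono-≤ (hits-sum nondeg≤ L inP) (+-monoʳ-≤ (r * N) (nondeg≤ v Pv)))
      (i₁ r N (length L) (nondeg v))
      (trans (cong (λ x → r * sumOn P (λ w → hits w L) + length L * (N + T) + (r * x + (N + T))) (sym (deg+nondeg v)))
      (trans (i₂ r (sumOn P (λ w → hits w L)) (length L) (N + T) (deg v) (nondeg v))
             (cong (λ x → r * x + suc (length L) * (N + T) + r * nondeg v) (sym (sumOn-+ P _ _)))))
      where i₁ : ∀ r N l d → suc l * (r * N) + r * d ≡ l * (r * N) + (r * N + r * d)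
            i₁ = solve-∀
            i₂ : ∀ r h l m d e → r * h + l * m + (r * (d + e) + m) ≡ r * (d + h) + suc l * m + r * e
            i₂ = solve-∀

    module _ (x B : ℕ) (codeg≤ : ∀ u v → P u ≡ true → P v ≡ true → A u v ≡ true → x * codeg (v ∷ u ∷ []) ≤ B) where

      star-sum : ∀ v L → P v ≡ true → InP L → All (λ u → A u v ≡ true) L →
                 x * sumOn P (λ w → 𝟙 (A v w) * hits w L) ≤ length L * B
      star-sum v []      Pv []         []       = ≤-reflexive (trans (cong (x *_) (trans (sumOn-cong P (λ w _ → *-zeroʳ (𝟙 (A v w)))) (trans (sumOn-const P 0) (*-zeroʳ N)))) (*-zeroʳ x))
      star-sum v (u ∷ L) Pv (Pu ∷ inP) (a ∷ as) = begin
        x * sumOn P (λ w → 𝟙 (A v w) * (𝟙 (A u w) + hits w L))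
          ≡⟨ cong (x *_) (trans (sumOn-cong P (λ w _ → i₁ (𝟙 (A v w)) (𝟙 (A u w)) (hits w L))) (sumOn-+ P (λ w → joined w (v ∷ u ∷ [])) _)) ⟩
        x * (codeg (v ∷ u ∷ []) + sumOn P (λ w → 𝟙 (A v w) * hits w L))
          ≡⟨ *-distribˡ-+ x (codeg (v ∷ u ∷ [])) _ ⟩
        x * codeg (v ∷ u ∷ []) + x * sumOn P (λ w → 𝟙 (A v w) * hits w L)
          ≤⟨ +-mono-≤ (codeg≤ u v Pu Pv a) (star-sum v L Pv inP as) ⟩
        B + length L * B ∎
        where
        open ≤-Reasoning
        i₁ : ∀ a b c → a * (b + c) ≡ a * (b * 1) + a * c
        i₁ = solve-∀

      -- Each of the l(l-1) ordered pairs of the clique is an edge, so x times its codegree is at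
      -- most B. The term l B stands on the left in place of a subtraction.
      hitPairs-sum : ∀ L → InP L → Clique L →
                  2 * (x * sumOn P (λ w → hitPairs w L)) + length L * B ≤ length L * length L * B
      hitPairs-sum []      []         []       = ≤-reflexive (cong (λ y → 2 * y + 0) (trans (cong (x *_) (trans (sumOn-const P 0) (*-zeroʳ N))) (*-zeroʳ x)))
      hitPairs-sum (v ∷ L) (Pv ∷ inP) (a ∷ as) = begin
        2 * (x * sumOn P (λ w → 𝟙 (A v w) * hits w L + hitPairs w L)) + suc l * B
          ≡⟨ cong (λ y → 2 * (x * y) + suc l * B) (sumOn-+ P (λ w → 𝟙 (A v w) * hits w L) (λ w → hitPairs w L)) ⟩
        2 * (x * (star + sumOn P (λ w → hitPairs w L))) + suc l * B
          ≡⟨ i₁ x star (sumOn P (λ w → hitPairs w L)) l B ⟩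
        2 * (x * star) + B + (2 * (x * sumOn P (λ w → hitPairs w L)) + l * B)
          ≤⟨ +-mono-≤ (+-monoˡ-≤ B (*-monoʳ-≤ 2 (star-sum v L Pv inP a))) (hitPairs-sum L inP as) ⟩
        2 * (l * B) + B + l * l * B
          ≡⟨ i₂ l B ⟩
        suc l * suc l * B ∎
        where
        open ≤-Reasoning
        l = length L
        star = sumOn P (λ w → 𝟙 (A v w) * hits w L)
        i₁ : ∀ x s p l B → 2 * (x * (s + p)) + suc l * B ≡ 2 * (x * s) + B + (2 * (x * p) + l * B)
        i₁ = solve-∀
        i₂ : ∀ l B → 2 * (l * B) + B + l * l * B ≡ suc l * suc l * B
        i₂ = solve-∀

  -- Used with k = r - 2, c = r - 1 and s = r + 1. The constant 2 in the first equation is the net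
  -- gain of the averaging, the coefficient of N that survives; t collects all the costs of T.
  clique-case-arithmetic : ∀ k c r s t N T X H Q Z →
    let B = X * (k * (N + T)) + Z; D = c * (c + 1) in
    2 * c * s * r ≡ 2 + (2 * c * s + r * D + s * r * k) → 2 * c * s + s * r * k ≡ t → s * s ≡ s * r + s →
    s * (r * N) ≤ r * H + s * (N + T) →
    2 * c * H ≤ 2 * Q + N * D →
    2 * (X * r * Q) + s * B ≤ s * s * B →
    X * (2 * N) ≤ r * s * Z + X * (t * T)
  clique-case-arithmetic k c r s t N T X H Q Z e₁ e₂ s² h₁ h₂ h₃ =
    ≤-from (rest + X * N * E)
           (+-mono-≤ (*-monoʳ-≤ (X * (2 * c)) h₁) (+-mono-≤ (*-monoʳ-≤ (X * r) h₂) h₃))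
           (trans (sym (left X c r s k N T H Q Z E))
             (trans (cong (λ e → X * N * e + rest) (sym e₁)) (assoc X c r s N H Q (s * B))))
           (trans (cong (λ w → X * (2 * c) * (r * H + s * (N + T)) + (X * r * (2 * Q + N * D) + w * B)) s²)
             (trans (right X c r s k N T H Q Z D) (cong (λ t → r * s * Z + X * (t * T) + (rest + X * N * E)) e₂)))
    where
    D E B rest : ℕ
    D = c * (c + 1)
    E = 2 * c * s + r * D + s * r * k
    B = X * (k * (N + T)) + Z
    rest = X * r * (2 * c * H) + 2 * (X * r * Q) + s * B
    left : ∀ X c r s k N T H Q Z E →
      X * N * (2 + E) + (X * r * (2 * c * H) + 2 * (X * r * Q) + s * (X * (k * (N + T)) + Z))
      ≡ X * (2 * N) + (X * r * (2 * c * H) + 2 * (X * r * Q) + s * (X * (k * (N + T)) + Z) + X * N * E)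
    left = solve-∀
    assoc : ∀ X c r s N H Q b →
      X * N * (2 * c * s * r) + (X * r * (2 * c * H) + 2 * (X * r * Q) + b)
      ≡ X * (2 * c) * (s * (r * N)) + (X * r * (2 * c * H) + (2 * (X * r * Q) + b))
    assoc = solve-∀
    right : ∀ X c r s k N T H Q Z D →
      X * (2 * c) * (r * H + s * (N + T)) + (X * r * (2 * Q + N * D) + (s * r + s) * (X * (k * (N + T)) + Z))
      ≡ r * s * Z + X * ((2 * c * s + s * r * k) * T)
        + (X * r * (2 * c * H) + 2 * (X * r * Q) + s * (X * (k * (N + T)) + Z) + X * N * (2 * c * s + r * D + s * r * k))
    right = solve-∀

  -- Averaging over the pairs of an (r+1)-clique produces an edge whose codegree exceeds (1 - 2/r) N
  -- by a constant fraction of N, which leaves room for the last step of the greedy extension.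
  module CliqueCase {n : ℕ} (A : Fin n → Fin n → Bool) (A-sym : ∀ u v → A u v ≡ A v u)
                    (A-irrefl : ∀ v → A v v ≡ false) (P : Fin n → Bool) (k T J : ℕ) where

    open Cliques A A-sym A-irrefl P
    open Extraction A A-sym A-irrefl P
    open HighDegree A A-sym A-irrefl P (2 + k) T

    module _ (nondeg≤ : ∀ v → P v ≡ true → (2 + k) * nondeg v ≤ N + T)
             (ext≤ : ∀ u v → P u ≡ true → P v ≡ true → A u v ≡ true → ext (suc k) (v ∷ u ∷ []) ≤ suc k ! * J) where

      private
        Z B : ℕ
        Z = (2 + k) ^ suc k * (suc k * J)
        B = N ^ k * (k * (N + T)) + Z

      -- If r times the codegree exceeds k (N + T) by z, `greedy` turns the reserve z into at least
      -- k! N^k z / r^(k+1) ordered extensions of the edge, and the bound on these caps N^k z by Z.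
      -- The factor N^k lets one inequality cover both cases.
      codeg≤B : ∀ u v → P u ≡ true → P v ≡ true → A u v ≡ true → N ^ k * (2 + k) * codeg (v ∷ u ∷ []) ≤ B
      codeg≤B u v Pu Pv Auv with (2 + k) * codeg (v ∷ u ∷ []) ℕ.≤? k * (N + T)
      ... | yes small = begin
        N ^ k * (2 + k) * codeg (v ∷ u ∷ [])       ≡⟨ *-assoc (N ^ k) (2 + k) _ ⟩
        N ^ k * ((2 + k) * codeg (v ∷ u ∷ []))     ≤⟨ *-monoʳ-≤ (N ^ k) small ⟩
        N ^ k * (k * (N + T))                      ≤⟨ m≤m+n _ Z ⟩
        B                                          ∎
        where open ≤-Reasoning
      ... | no large = begin
        N ^ k * (2 + k) * codeg (v ∷ u ∷ [])       ≡⟨ *-assoc (N ^ k) (2 + k) _ ⟩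
        N ^ k * ((2 + k) * codeg (v ∷ u ∷ []))     ≡⟨ cong (N ^ k *_) (sym split) ⟩
        N ^ k * (k * (N + T) + z)                  ≡⟨ *-distribˡ-+ (N ^ k) _ z ⟩
        N ^ k * (k * (N + T)) + N ^ k * z          ≤⟨ +-monoʳ-≤ _ bound ⟩
        B                                          ∎
        where
        open ≤-Reasoning
        z : ℕ
        z = (2 + k) * codeg (v ∷ u ∷ []) ∸ k * (N + T)
        split : k * (N + T) + z ≡ (2 + k) * codeg (v ∷ u ∷ [])
        split = m+[n∸m]≡n (<⇒≤ (≰⇒> large))
        i₁ : ∀ f x z → f * x * z ≡ f * (x * z)
        i₁ = solve-∀
        i₂ : ∀ y k f J → y * (suc k * f * J) ≡ f * (y * (suc k * J))
        i₂ = solve-∀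
        bound : N ^ k * z ≤ Z
        bound = *-cancelˡ-≤ (k !) {{k !≢0}} (begin
          k ! * (N ^ k * z)                              ≡⟨ sym (i₁ (k !) (N ^ k) z) ⟩
          k ! * N ^ k * z                                ≤⟨ greedy nondeg≤ k (v ∷ u ∷ []) z (≤-reflexive split) ⟩
          (2 + k) ^ suc k * ext (suc k) (v ∷ u ∷ [])     ≤⟨ *-monoʳ-≤ ((2 + k) ^ suc k) (ext≤ u v Pu Pv Auv) ⟩
          (2 + k) ^ suc k * (suc k ! * J)                ≡⟨ i₂ ((2 + k) ^ suc k) k (k !) J ⟩
          k ! * Z                                        ∎)

      -- Integrality enters here. On average a vertex has at least about r - 1/r neighbours in the
      -- (r+1)-clique, a number between the integers r - 1 and r, and the binomial coefficient lies
      -- above the chord through these two. The chord raises the mean codegree to (1 - 2/r)N +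
      -- 2N/(r²(r+1)), up to terms in T; Cauchy-Schwarz would add only N/r³.
      hits-hitPairs : ∀ L → let c = 1 + k in
                   2 * c * sumOn P (λ w → hits w L) ≤ 2 * sumOn P (λ w → hitPairs w L) + N * (c * (c + 1))
      hits-hitPairs L = begin
        2 * c * sumOn P (λ w → hits w L)                       ≡⟨ sym (sumOn-*ˡ P (2 * c) (λ w → hits w L)) ⟩
        sumOn P (λ w → 2 * c * hits w L)                       ≤⟨ sumOn-mono P (λ w _ → pt w) ⟩
        sumOn P (λ w → 2 * hitPairs w L + c * (c + 1))            ≡⟨ sumOn-+ P (λ w → 2 * hitPairs w L) _ ⟩
        sumOn P (λ w → 2 * hitPairs w L) + sumOn P (λ _ → c * (c + 1))
                                                               ≡⟨ cong₂ _+_ (sumOn-*ˡ P 2 (λ w → hitPairs w L)) (sumOn-const P (c * (c + 1))) ⟩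
        2 * sumOn P (λ w → hitPairs w L) + N * (c * (c + 1))      ∎
        where
        open ≤-Reasoning
        c = 1 + k
        pt : ∀ w → 2 * c * hits w L ≤ 2 * hitPairs w L + c * (c + 1)
        pt w = ≤-from (hits w L) (consecutive-product c (hits w L)) (i₁ c (hits w L))
                 (trans (cong (_+ c * (c + 1)) (sym (hitPairs-hits w L))) (i₂ (2 * hitPairs w L) (hits w L) (c * (c + 1))))
          where i₁ : ∀ c h → 2 * c * h + h ≡ (2 * c + 1) * h
                i₁ = solve-∀
                i₂ : ∀ p h d → p + h + d ≡ p + d + h
                i₂ = solve-∀

      clique⇒joint : 0 < ext (3 + k) [] →
        N ^ k * (2 * N) ≤ (2 + k) * (3 + k) * ((2 + k) ^ suc k * (suc k * J)) + N ^ k * ((3 + k) * (k * k + 4 * k + 2) * T)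
      clique⇒joint h = let L , len , inP , cl = ext>0⇒clique (3 + k) [] [] [] h in
        joint L (trans len (+-identityʳ (3 + k))) inP cl
        where
        c₁ : ∀ k → 2 * (1 + k) * (3 + k) * (2 + k)
                 ≡ 2 + (2 * (1 + k) * (3 + k) + (2 + k) * ((1 + k) * (1 + k + 1)) + (3 + k) * (2 + k) * k)
        c₁ = solve-∀
        c₂ : ∀ k → 2 * (1 + k) * (3 + k) + (3 + k) * (2 + k) * k ≡ (3 + k) * (k * k + 4 * k + 2)
        c₂ = solve-∀
        c₃ : ∀ k → (3 + k) * (3 + k) ≡ (3 + k) * (2 + k) + (3 + k)
        c₃ = solve-∀
        joint : ∀ L → length L ≡ 3 + k → InP L → Clique L →
          N ^ k * (2 * N) ≤ (2 + k) * (3 + k) * ((2 + k) ^ suc k * (suc k * J)) + N ^ k * ((3 + k) * (k * k + 4 * k + 2) * T)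
        joint L len inP cl = clique-case-arithmetic k (1 + k) (2 + k) (3 + k) ((3 + k) * (k * k + 4 * k + 2)) N T (N ^ k)
          (sumOn P (λ w → hits w L)) (sumOn P (λ w → hitPairs w L)) Z (c₁ k) (c₂ k) (c₃ k)
          (subst (λ l → l * ((2 + k) * N) ≤ (2 + k) * sumOn P (λ w → hits w L) + l * (N + T)) len (hits-sum nondeg≤ L inP))
          (hits-hitPairs L)
          (subst (λ l → 2 * (N ^ k * (2 + k) * sumOn P (λ w → hitPairs w L)) + l * B ≤ l * l * B) len
                 (hitPairs-sum (N ^ k * (2 + k)) B codeg≤B L inP cl))

  -- Colouring graphs without (r+1)-cliques

  two-terms≤sum : ∀ {n} (f : Fin n → ℕ) {i j} → i ≢ j → f i + f j ≤ sum f
  two-terms≤sum f {zero}  {zero}  i≢j = ⊥-elim (i≢j refl)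
  two-terms≤sum f {zero}  {suc j} i≢j = +-monoʳ-≤ (f zero) (term≤sum (f ∘ suc) j)
  two-terms≤sum f {suc i} {zero}  i≢j = ≤-trans (≤-reflexive (+-comm (f (suc i)) _)) (+-monoʳ-≤ (f zero) (term≤sum (f ∘ suc) i))
  two-terms≤sum f {suc i} {suc j} i≢j = ≤-trans (two-terms≤sum (f ∘ suc) (i≢j ∘ cong suc)) (m≤n+m _ (f zero))

  sum-all-but-one : ∀ {m} (f : Fin (suc m) → ℕ) i c → (∀ j → j ≢ i → f j ≤ c) → sum f ≤ f i + m * c
  sum-all-but-one {m} f zero c h =
    +-monoʳ-≤ (f zero) (≤-trans (sum-mono-≤ (λ j → h (suc j) λ ())) (≤-reflexive (sum-const m c)))
  sum-all-but-one {suc m} f (suc i) c h = begin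
    f zero + sum (f ∘ suc)              ≤⟨ +-mono-≤ (h zero λ ()) (sum-all-but-one (f ∘ suc) i c (λ j j≢i → h (suc j) (j≢i ∘ Fin.suc-injective))) ⟩
    c + (f (suc i) + m * c)             ≡⟨ swap c (f (suc i)) (m * c) ⟩
    f (suc i) + suc m * c               ∎
    where
    open ≤-Reasoning
    swap : ∀ a b d → a + (b + d) ≡ b + (a + d)
    swap = solve-∀

  zone-arithmetic : ∀ N T c r x y o₁ o₂ m o → N ≤ c * T + r * x → N ≤ c * T + r * y → x ≤ o₁ + c * T → y ≤ o₂ + c * T →
                    o₁ + o₂ ≤ m + o → o ≤ T → r * m ≤ N + T → N ≤ (2 * c + 1 + 2 * r * c + r) * T
  zone-arithmetic N T c r x y o₁ o₂ m o h₁ h₂ h₃ h₄ h₅ h₆ h₇ = ≤-from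
    (N + r * x + r * y + r * (o₁ + o₂) + r * o + r * m)
    (+-mono-≤ h₁ (+-mono-≤ h₂ (+-mono-≤ (*-monoʳ-≤ r h₃) (+-mono-≤ (*-monoʳ-≤ r h₄)
      (+-mono-≤ (*-monoʳ-≤ r h₅) (+-mono-≤ (*-monoʳ-≤ r h₆) h₇))))))
    (left N r x y o₁ o₂ m o) (right N T c r x y o₁ o₂ m o)
    where
    left : ∀ N r x y o₁ o₂ m o → N + (N + r * x + r * y + r * (o₁ + o₂) + r * o + r * m)
           ≡ N + (N + (r * x + (r * y + (r * (o₁ + o₂) + (r * o + r * m)))))
    left = solve-∀
    right : ∀ N T c r x y o₁ o₂ m o → c * T + r * x + (c * T + r * y + (r * (o₁ + c * T) + (r * (o₂ + c * T)
           + (r * (m + o) + (r * T + (N + T)))))) ≡ (2 * c + 1 + 2 * r * c + r) * T + (N + r * x + r * y + r * (o₁ + o₂) + r * o + r * m)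
    right = solve-∀

  -- A weak Andrásfai–Erdős–Sós theorem: two adjacent vertices have at most T common non-neighbours,
  -- while two vertices whose only non-neighbour among r fixed vertices is the same have many.
  module Colouring {n : ℕ} (A : Fin n → Fin n → Bool) (A-sym : ∀ u v → A u v ≡ A v u)
                   (A-irrefl : ∀ v → A v v ≡ false) (P : Fin n → Bool) (k T : ℕ) where

    open Cliques A A-sym A-irrefl P
    open Extraction A A-sym A-irrefl P
    open HighDegree A A-sym A-irrefl P (2 + k) T

    module _ (nondeg≤ : ∀ v → P v ≡ true → (2 + k) * nondeg v ≤ N + T)
             (clique-free : ext (3 + k) [] ≡ 0)
             (T-small : (2 * k + 3) * (k + 3) * T < N) where

      private
        r : ℕ
        r = 2 + k

        N>0 : 0 < N
        N>0 = ≤-trans (s≤s z≤n) T-small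

        ē : Fin n → Fin n → ℕ
        ē v w = 𝟙 (not (A v w))

        -- All contradictions below have the form N ≤ a T. The number b pads a up to the coefficient
        -- in `T-small`; the padding is 0 in `zone-independent`, which fixes that coefficient.
        absurd : ∀ a b → a + b ≡ (2 * k + 3) * (k + 3) → ¬ (N ≤ a * T)
        absurd a b eq h = <⇒≱ T-small (≤-trans h (*-monoˡ-≤ T (≤-trans (m≤m+n a b) (≤-reflexive eq))))

      edge-free : ∀ u → P u ≡ true → ext (2 + k) (u ∷ []) ≡ 0
      edge-free u Pu = trans (sym (+-identityʳ _)) (sumOn≡0⇒ P (λ v → 1 * ext (2 + k) (v ∷ [])) clique-free u Pu)

      triangle-free : ∀ u v → P u ≡ true → P v ≡ true → A u v ≡ true → ext (1 + k) (v ∷ u ∷ []) ≡ 0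
      triangle-free u v Pu Pv Auv =
        trans (sym (+-identityʳ _)) (subst (λ b → 𝟙 b * 1 * ext (1 + k) (v ∷ u ∷ []) ≡ 0) Auv
          (sumOn≡0⇒ P (λ v → joined v (u ∷ []) * ext (1 + k) (v ∷ u ∷ [])) (edge-free u Pu) v Pv))

      small-codeg : ∀ s L → ext (suc s) L ≡ 0 → r * codeg L ≤ s * (N + T)
      small-codeg s L z = ≮⇒≥ (λ h → <-irrefl (sym z) (greedy>0 nondeg≤ s L N>0 h))

      -- A vertex of larger degree would extend greedily to an (r+1)-clique. Together with
      -- `nondeg≤`, all numbers of non-neighbours equal N/r up to a multiple of T.
      N≤nondeg : ∀ w → P w ≡ true → N ≤ (1 + k) * T + r * nondeg w
      N≤nondeg w Pw = ≤-from ((1 + k) * N + r * deg w)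
        (+-monoʳ-≤ (r * N) (≤-trans (≤-reflexive (cong (r *_) (sym (codeg-singleton w)))) (small-codeg (1 + k) (w ∷ []) (edge-free w Pw))))
        (i₁ k N (r * deg w)) (trans (cong (λ x → r * x + (1 + k) * (N + T)) (sym (deg+nondeg w))) (i₂ (1 + k) N T r (deg w) (nondeg w)))
        where i₁ : ∀ k N x → N + ((1 + k) * N + x) ≡ (2 + k) * N + x
              i₁ = solve-∀
              i₂ : ∀ c N T r d e → r * (d + e) + c * (N + T) ≡ c * T + r * e + (c * N + r * d)
              i₂ = solve-∀

      common : Fin n → Fin n → ℕ
      common u v = sumOn P (λ w → ē u w * ē v w)

      -- Without (r+1)-cliques an edge has codegree at most k(N+T)/r. Inclusion-exclusion with two
      -- non-neighbourhoods of size at most (N+T)/r leaves exactly T.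
      common≤T : ∀ u v → P u ≡ true → P v ≡ true → A u v ≡ true → common u v ≤ T
      common≤T u v Pu Pv Auv = *-cancelˡ-≤ r (≤-from (r * N)
        (+-mono-≤ (small-codeg k (v ∷ u ∷ []) (triangle-free u v Pu Pv Auv)) (+-mono-≤ (nondeg≤ u Pu) (nondeg≤ v Pv)))
        (trans (sym (*-distribˡ-+ r (common u v) N)) (trans (cong (r *_) inclusion-exclusion) (i₁ r (codeg (v ∷ u ∷ [])) (nondeg u) (nondeg v))))
        (i₂ k N T))
        where
        i₁ : ∀ r c x y → r * (c + x + y) ≡ r * c + (r * x + r * y)
        i₁ = solve-∀
        i₂ : ∀ k N T → k * (N + T) + (N + T + (N + T)) ≡ (2 + k) * T + (2 + k) * N
        i₂ = solve-∀
        inclusion-exclusion : common u v + N ≡ codeg (v ∷ u ∷ []) + nondeg u + nondeg v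
        inclusion-exclusion = trans (cong (common u v +_) (sym (sumOn-1 P)))
          (trans (sym (sumOn-+ P (λ w → ē u w * ē v w) (λ _ → 1)))
          (trans (sumOn-cong P (λ w _ → pt (A u w) (A v w)))
          (trans (sumOn-+ P (λ w → joined w (v ∷ u ∷ []) + ē u w) (ē v)) (cong (_+ nondeg v) (sumOn-+ P (λ w → joined w (v ∷ u ∷ [])) (ē u))))))
          where pt : ∀ a b → 𝟙 (not a) * 𝟙 (not b) + 1 ≡ 𝟙 b * (𝟙 a * 1) + 𝟙 (not a) + 𝟙 (not b)
                pt true  true  = refl
                pt true  false = refl
                pt false true  = refl
                pt false false = refl

      module _ (κ : Fin r → Fin n) (Pκ : ∀ i → P (κ i) ≡ true)
               (cover : ∀ w → P w ≡ true → ∃ λ i → A (κ i) w ≡ false) where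

        missed : Fin n → ℕ
        missed u = sum (λ i → ē (κ i) u)

        -- The vertices whose only non-neighbour among the κ j is κ i.
        zone : Fin r → Fin n → Bool
        zone i u = not (A (κ i) u) ∧ (missed u ℕ.≡ᵇ 1)

        missed>0 : ∀ u → P u ≡ true → 0 < missed u
        missed>0 u Pu = let i , eq = cover u Pu in
          ≤-trans (≤-reflexive (cong (λ b → 𝟙 (not b)) (sym eq))) (term≤sum (λ i → ē (κ i) u) i)

        zone⇒ : ∀ i u → zone i u ≡ true → A (κ i) u ≡ false × missed u ≡ 1
        zone⇒ i u z with A (κ i) u | missed u ℕ.≡ᵇ 1 in eq
        ... | false | true = refl , ≡ᵇ⇒≡ (missed u) 1 (subst Bool.T (sym eq) _)

        zone-joined : ∀ i u → zone i u ≡ true → ∀ j → j ≢ i → A (κ j) u ≡ true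
        zone-joined i u z j j≢i with zone⇒ i u z | two-terms≤sum (λ i → ē (κ i) u) j≢i
        ... | eq₁ , eq₂ | h with A (κ j) u
        ...   | true  = refl
        ...   | false rewrite eq₁ | eq₂ = ⊥-elim (<-irrefl refl h)

        nondeg≤Σcommon : ∀ u → nondeg u ≤ sum (λ j → common u (κ j))
        nondeg≤Σcommon u = ≤-trans (sumOn-mono P pt) (≤-reflexive (sumOn-comm P (λ j w → ē u w * ē (κ j) w)))
          where pt : ∀ w → P w ≡ true → ē u w ≤ sum (λ j → ē u w * ē (κ j) w)
                pt w Pw = begin
                  ē u w                           ≡⟨ sym (*-identityʳ _) ⟩
                  ē u w * 1                       ≤⟨ *-monoʳ-≤ (ē u w) (missed>0 w Pw) ⟩
                  ē u w * missed w                ≡⟨ *-distribˡ-sum (ē u w) (λ j → ē (κ j) w) ⟩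
                  sum (λ j → ē u w * ē (κ j) w)   ∎
                  where open ≤-Reasoning

        -- Non-neighbours of u are covered by those of the `κ j`. For j ≠ i the vertex `κ j` is
        -- adjacent to u and covers at most T of them, so nearly all lie outside the neighbourhood
        -- of `κ i`.
        zone-common : ∀ i u → P u ≡ true → zone i u ≡ true → nondeg u ≤ common u (κ i) + (1 + k) * T
        zone-common i u Pu z = ≤-trans (nondeg≤Σcommon u) (sum-all-but-one (λ j → common u (κ j)) i T
          (λ j j≢i → common≤T u (κ j) Pu (Pκ j) (trans (A-sym u (κ j)) (zone-joined i u z j j≢i))))

        -- Both u and y have about N/r non-neighbours inside a set of about N/r vertices, the
        -- non-neighbours of `κ i`. The two sets overlap almost completely, whereas adjacency would
        -- cap the overlap at T.
        zone-independent : ∀ i u y → P u ≡ true → P y ≡ true → zone i u ≡ true → zone i y ≡ true → A u y ≡ false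
        zone-independent i u y Pu Py zu zy with A u y in Auy
        ... | false = refl
        ... | true  = ⊥-elim (absurd (2 * c + 1 + 2 * r * c + r) 0 (i₁ k) (zone-arithmetic N T c r (nondeg u) (nondeg y)
                (common u (κ i)) (common y (κ i)) (nondeg (κ i)) (common u y) (N≤nondeg u Pu) (N≤nondeg y Py)
                (zone-common i u Pu zu) (zone-common i y Py zy) shared (common≤T u y Pu Py Auy) (nondeg≤ (κ i) (Pκ i))))
          where
          c = 1 + k
          i₁ : ∀ k → 2 * (1 + k) + 1 + 2 * (2 + k) * (1 + k) + (2 + k) + 0 ≡ (2 * k + 3) * (k + 3)
          i₁ = solve-∀
          shared : common u (κ i) + common y (κ i) ≤ nondeg (κ i) + common u y
          shared = ≤-trans (≤-reflexive (sym (sumOn-+ P (λ w → ē u w * ē (κ i) w) (λ w → ē y w * ē (κ i) w))))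
            (≤-trans (sumOn-mono P (λ w _ → pt (A u w) (A y w) (A (κ i) w))) (≤-reflexive (sumOn-+ P (ē (κ i)) (λ w → ē u w * ē y w))))
            where pt : ∀ a b c → 𝟙 (not a) * 𝟙 (not c) + 𝟙 (not b) * 𝟙 (not c) ≤ 𝟙 (not c) + 𝟙 (not a) * 𝟙 (not b)
                  pt true  true  c     = z≤n
                  pt true  false c     = ≤-refl
                  pt false true  c     = ≤-reflexive (+-identityʳ _)
                  pt false false true  = z≤n
                  pt false false false = ≤-refl

        missing-sum : r * sum (λ j → nondeg (κ j)) ≤ r * (N + T)
        missing-sum = ≤-trans (≤-reflexive (*-distribˡ-sum r (λ j → nondeg (κ j))))
          (≤-trans (sum-mono-≤ (λ j → nondeg≤ (κ j) (Pκ j))) (≤-reflexive (sum-const r (N + T))))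

        missed-sum : sumOn P missed ≡ sum (λ j → nondeg (κ j))
        missed-sum = sumOn-comm P (λ j → ē (κ j))

        module _ (w : Fin n) (Pw : P w ≡ true) where

          private
            reached avoided : Fin r → ℕ
            reached i = sumOn P (λ u → 𝟙 (zone i u) * 𝟙 (A w u))
            avoided i = sumOn P (λ u → ē w u * 𝟙 (zone i u))

          -- A neighbour y of w in the zone has the whole zone among its non-neighbours, so what w
          -- avoids there consists of common non-neighbours of the adjacent vertices w and y.
          avoided≤T : ∀ i → 0 < reached i → avoided i ≤ T
          avoided≤T i h =
            let y , Py , h′ = sumOn>0⇒ P _ h
                zy , Awy = both (zone i y) (A w y) h′
            in ≤-trans (sumOn-mono P (λ u Pu → pt y Py zy u Pu)) (common≤T w y Pw Py Awy)
            where
            both : ∀ a b → 0 < 𝟙 a * 𝟙 b → a ≡ true × b ≡ true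
            both true true _ = refl , refl
            pt : ∀ y → P y ≡ true → zone i y ≡ true → ∀ u → P u ≡ true → ē w u * 𝟙 (zone i u) ≤ ē w u * ē y u
            pt y Py zy u Pu with zone i u in zu
            ... | false = *-monoʳ-≤ (ē w u) z≤n
            ... | true  rewrite zone-independent i y u Py Pu zy zu = ≤-refl

          -- Pointwise, a vertex missed twice already provides 2 on the right, and a vertex missed
          -- once lies in a zone. As the last sum is at most N + T, the vertices outside all zones
          -- cost at most T.
          nondeg≤Σavoided : nondeg w + N ≤ sum avoided + sum (λ j → nondeg (κ j))
          nondeg≤Σavoided = begin
            nondeg w + N                                                              ≡⟨ cong (nondeg w +_) (sym (sumOn-1 P)) ⟩
            nondeg w + sumOn P (λ _ → 1)                                              ≡⟨ sym (sumOn-+ P (ē w) (λ _ → 1)) ⟩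
            sumOn P (λ u → ē w u + 1)                                                 ≤⟨ sumOn-mono P pt ⟩
            sumOn P (λ u → sum (λ i → ē w u * 𝟙 (zone i u)) + missed u)               ≡⟨ sumOn-+ P (λ u → sum (λ i → ē w u * 𝟙 (zone i u))) missed ⟩
            sumOn P (λ u → sum (λ i → ē w u * 𝟙 (zone i u))) + sumOn P missed         ≡⟨ cong₂ _+_ (sumOn-comm P (λ i u → ē w u * 𝟙 (zone i u))) missed-sum ⟩
            sum avoided + sum (λ j → nondeg (κ j))                                    ∎
            where
            open ≤-Reasoning
            pt : ∀ u → P u ≡ true → ē w u + 1 ≤ sum (λ i → ē w u * 𝟙 (zone i u)) + missed u
            pt u Pu with missed u in eq | missed>0 u Pu
            ... | suc (suc m) | _ = ≤-trans (+-monoˡ-≤ 1 (𝟙≤1 (not (A w u)))) (≤-trans (s≤s (s≤s z≤n)) (m≤n+m (2 + m) _))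
            ... | suc zero    | _ = +-monoˡ-≤ 1 (≤-trans (≤-reflexive missed-by-w) (term≤sum (λ i → ē w u * 𝟙 (not (A (κ i) u) ∧ true)) (proj₁ (cover u Pu))))
              where missed-by-w : ē w u ≡ ē w u * 𝟙 (not (A (κ (proj₁ (cover u Pu))) u) ∧ true)
                    missed-by-w = sym (trans (cong (λ b → ē w u * 𝟙 (not b ∧ true)) (proj₂ (cover u Pu))) (*-identityʳ _))

          -- Otherwise w has at most T non-neighbours in each zone, hence too few altogether.
          some-unreached : ∃ λ i → reached i ≡ 0
          some-unreached with Fin.any? (λ i → reached i ℕ.≟ 0)
          ... | yes p = p
          ... | no ¬p = ⊥-elim (absurd (1 + k + r * (r + 1)) ((1 + k) * (2 + k)) (i₁ k) (arithmetic N T (1 + k) r (nondeg w) (sum avoided) (sum (λ j → nondeg (κ j)))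
                          (N≤nondeg w Pw) nondeg≤Σavoided all-avoided missing-sum))
            where
            all-avoided : sum avoided ≤ r * T
            all-avoided = ≤-trans (sum-mono-≤ (λ i → avoided≤T i (n≢0⇒n>0 (λ z → ¬p (i , z))))) (≤-reflexive (sum-const r T))
            i₁ : ∀ k → 1 + k + (2 + k) * (2 + k + 1) + (1 + k) * (2 + k) ≡ (2 * k + 3) * (k + 3)
            i₁ = solve-∀
            arithmetic : ∀ N T c r x a s → N ≤ c * T + r * x → x + N ≤ a + s → a ≤ r * T → r * s ≤ r * (N + T) → N ≤ (c + r * (r + 1)) * T
            arithmetic N T c r x a s h₁ h₂ h₃ h₄ = ≤-from (r * (x + N) + r * a + r * s)
              (+-mono-≤ h₁ (+-mono-≤ (*-monoʳ-≤ r h₂) (+-mono-≤ (*-monoʳ-≤ r h₃) h₄)))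
              (left N r x a s) (right N T c r x a s)
              where left : ∀ N r x a s → N + (r * (x + N) + r * a + r * s) ≡ N + (r * (x + N) + (r * a + r * s))
                    left = solve-∀
                    right : ∀ N T c r x a s → c * T + r * x + (r * (a + s) + (r * (r * T) + r * (N + T))) ≡ (c + r * (r + 1)) * T + (r * (x + N) + r * a + r * s)
                    right = solve-∀

          -- Up to T vertices may lie outside every zone, so the zones are not taken as the colour
          -- classes: each vertex receives the index of a zone in which it has no neighbour.
          colour : Fin r
          colour = proj₁ some-unreached

          unreached : ∀ u → P u ≡ true → zone colour u ≡ true → A w u ≡ false
          unreached u Pu z with A w u in Awu
          ... | false = refl
          ... | true  = ⊥-elim (1≢0 (subst₂ (λ a b → 𝟙 a * 𝟙 b ≡ 0) z Awu
                          (sumOn≡0⇒ P (λ u → 𝟙 (zone colour u) * 𝟙 (A w u)) (proj₂ some-unreached) u Pu)))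
            where 1≢0 : 1 ≢ 0
                  1≢0 ()

        zone-size : ∀ i → N + nondeg (κ i) ≤ sumOn P (λ u → 𝟙 (zone i u)) + sum (λ j → nondeg (κ j))
        zone-size i = begin
          N + nondeg (κ i)                                          ≡⟨ cong (_+ nondeg (κ i)) (sym (sumOn-1 P)) ⟩
          sumOn P (λ _ → 1) + nondeg (κ i)                          ≡⟨ sym (sumOn-+ P (λ _ → 1) (ē (κ i))) ⟩
          sumOn P (λ u → 1 + ē (κ i) u)                             ≤⟨ sumOn-mono P pt ⟩
          sumOn P (λ u → 𝟙 (zone i u) + missed u)                   ≡⟨ sumOn-+ P (λ u → 𝟙 (zone i u)) missed ⟩
          sumOn P (λ u → 𝟙 (zone i u)) + sumOn P missed             ≡⟨ cong (sumOn P (λ u → 𝟙 (zone i u)) +_) missed-sum ⟩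
          sumOn P (λ u → 𝟙 (zone i u)) + sum (λ j → nondeg (κ j))   ∎
          where
          open ≤-Reasoning
          pt : ∀ u → P u ≡ true → 1 + ē (κ i) u ≤ 𝟙 (zone i u) + missed u
          pt u Pu with missed u in eq | missed>0 u Pu | A (κ i) u
          ... | suc m       | _ | true  = s≤s z≤n
          ... | suc zero    | _ | false = ≤-refl
          ... | suc (suc m) | _ | false = s≤s (s≤s z≤n)

        -- The shared zone would consist of common non-neighbours of u and v, hence of at most T
        -- vertices, but by `zone-size` a zone has about N/r.
        colour-proper : ∀ u v (Pu : P u ≡ true) (Pv : P v ≡ true) → A u v ≡ true → colour u Pu ≢ colour v Pv
        colour-proper u v Pu Pv Auv same = absurd (1 + k + 2 * r) (2 * k * k + 6 * k + 4) (i₁ k)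
          (arithmetic N T (1 + k) r (nondeg (κ i)) (sumOn P (λ w → 𝟙 (zone i w))) (sum (λ j → nondeg (κ j)))
            (N≤nondeg (κ i) (Pκ i)) (zone-size i) (≤-trans (sumOn-mono P pt) (common≤T u v Pu Pv Auv)) missing-sum)
          where
          i : Fin r
          i = colour u Pu
          pt : ∀ w → P w ≡ true → 𝟙 (zone i w) ≤ ē u w * ē v w
          pt w Pw with zone i w in z
          ... | false = z≤n
          ... | true  rewrite unreached u Pu w Pw z | unreached v Pv w Pw (subst (λ j → zone j w ≡ true) same z) = ≤-refl
          i₁ : ∀ k → 1 + k + 2 * (2 + k) + (2 * k * k + 6 * k + 4) ≡ (2 * k + 3) * (k + 3)
          i₁ = solve-∀
          arithmetic : ∀ N T c r m z s → N ≤ c * T + r * m → N + m ≤ z + s → z ≤ T → r * s ≤ r * (N + T) → N ≤ (c + 2 * r) * T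
          arithmetic N T c r m z s h₁ h₂ h₃ h₄ = ≤-from (r * (N + m) + r * z + r * s)
            (+-mono-≤ h₁ (+-mono-≤ (*-monoʳ-≤ r h₂) (+-mono-≤ (*-monoʳ-≤ r h₃) h₄)))
            (left N r m z s) (right N T c r m z s)
            where left : ∀ N r m z s → N + (r * (N + m) + r * z + r * s) ≡ N + (r * (N + m) + (r * z + r * s))
                  left = solve-∀
                  right : ∀ N T c r m z s → c * T + r * m + (r * (z + s) + (r * T + r * (N + T))) ≡ (c + 2 * r) * T + (r * (N + m) + r * z + r * s)
                  right = solve-∀

      maximal-clique : ∃ λ L → length L ≡ r × InP L × codeg L ≡ 0
      maximal-clique =
        let L , len , rest = ext>0⇒maximal r [] [] (greedy>0 nondeg≤ (1 + k) [] N>0 room) clique-free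
        in L , trans len (+-identityʳ r) , rest
        where
        room : (1 + k) * (N + T) < r * codeg []
        room = ≤-from ((2 + k) * N + ((2 * k + 3) * (k + 3)) * T)
          (+-mono-≤ (≤-reflexive (cong (r *_) (sym codeg-[]))) (+-mono-≤ (m≤m+n _ ((2 * k * k + 8 * k + 8) * T)) T-small))
          (left k N T) (right k N T (r * codeg []) )
          where left : ∀ k N T → suc ((1 + k) * (N + T)) + ((2 + k) * N + ((2 * k + 3) * (k + 3)) * T)
                       ≡ (2 + k) * N + ((1 + k) * N + (1 + k) * T + suc (((2 * k + 3) * (k + 3)) * T))
                left = solve-∀
                right : ∀ k N T x → x + ((1 + k) * N + (1 + k) * T + (2 * k * k + 8 * k + 8) * T + N) ≡ x + ((2 + k) * N + ((2 * k + 3) * (k + 3)) * T)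
                right = solve-∀

      cover-by : ∀ r′ L → length L ≡ r′ → InP L → codeg L ≡ 0 →
                 Σ (Fin r′ → Fin n) λ κ → (∀ i → P (κ i) ≡ true) × (∀ w → P w ≡ true → ∃ λ i → A (κ i) w ≡ false)
      cover-by _ L refl inP z = List.lookup L , (λ i → All.lookup inP (∈-lookup i)) , λ w Pw → find w L (sumOn≡0⇒ P (λ w → joined w L) z w Pw)
        where
        find : ∀ w L → joined w L ≡ 0 → ∃ λ i → A (List.lookup L i) w ≡ false
        find w (u ∷ L) z with A u w in Auw
        ... | false = zero , Auw
        ... | true  = let i , eq = find w L (trans (sym (+-identityʳ _)) z) in suc i , eq

      colouring : Σ (Fin n → Fin r) λ c → ∀ u v → P u ≡ true → P v ≡ true → A u v ≡ true → c u ≢ c v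
      colouring = let L , len , inP , z = maximal-clique
                      κ , Pκ , cover = cover-by r L len inP z
                  in total κ Pκ cover , proper κ Pκ cover
        where
        module _ (κ : Fin r → Fin n) (Pκ : ∀ i → P (κ i) ≡ true) (cover : ∀ w → P w ≡ true → ∃ λ i → A (κ i) w ≡ false) where
          -- `colour` takes a proof of membership in P, so the boolean is matched together with its
          -- equation; vertices outside P get the default `zero`.
          choose : ∀ w b → P w ≡ b → Fin r
          choose w true  Pw = colour κ Pκ cover w Pw
          choose w false _  = zero
          choose-true : ∀ w b (eq : P w ≡ b) (Pw : P w ≡ true) → ∃ λ Pw′ → choose w b eq ≡ colour κ Pκ cover w Pw′
          choose-true w true  eq Pw = eq , refl
          choose-true w false eq Pw with trans (sym eq) Pw
          ... | ()
          total : Fin n → Fin r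
          total w = choose w (P w) refl
          proper : ∀ u v → P u ≡ true → P v ≡ true → A u v ≡ true → total u ≢ total v
          proper u v Pu Pv Auv eq =
            let Pu′ , eu = choose-true u (P u) refl Pu
                Pv′ , ev = choose-true v (P v) refl Pv
            in colour-proper κ Pκ cover u v Pu′ Pv′ Auv (trans (sym eu) (trans eq ev))

  -- From ordered to unordered counts

  listSum : ∀ {A : Set} → (A → ℕ) → List A → ℕ
  listSum f xs = ListAction.sum (List.map f xs)

  listSum-++ : ∀ {A : Set} (f : A → ℕ) xs ys → listSum f (xs List.++ ys) ≡ listSum f xs + listSum f ys
  listSum-++ f []       ys = refl
  listSum-++ f (x ∷ xs) ys = trans (cong (f x +_) (listSum-++ f xs ys)) (sym (+-assoc (f x) _ _))

  listSum-mono : ∀ {A : Set} {f g : A → ℕ} xs → (∀ x → f x ≤ g x) → listSum f xs ≤ listSum g xs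
  listSum-mono []       h = z≤n
  listSum-mono (x ∷ xs) h = +-mono-≤ (h x) (listSum-mono xs h)

  listSum-*ˡ : ∀ {A : Set} c (f : A → ℕ) xs → listSum (λ x → c * f x) xs ≡ c * listSum f xs
  listSum-*ˡ c f []       = sym (*-zeroʳ c)
  listSum-*ˡ c f (x ∷ xs) = trans (cong (c * f x +_) (listSum-*ˡ c f xs)) (sym (*-distribˡ-+ c (f x) _))

  ∈⇒≤listSum : ∀ {A : Set} (f : A → ℕ) {x xs} → x List∈.∈ xs → f x ≤ listSum f xs
  ∈⇒≤listSum f (here refl) = m≤m+n _ _
  ∈⇒≤listSum f (there i)   = ≤-trans (∈⇒≤listSum f i) (m≤n+m _ _)

  listSum-sumOn : ∀ {n} {A : Set} P (f : Fin n → A → ℕ) xs →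
                  sumOn P (λ v → listSum (f v) xs) ≡ listSum (λ x → sumOn P (λ v → f v x)) xs
  listSum-sumOn P f []       = trans (sumOn-const P 0) (*-zeroʳ (card P))
  listSum-sumOn P f (x ∷ xs) = trans (sumOn-+ P (λ v → f v x) _) (cong (_ +_) (listSum-sumOn P f xs))

  listSum-tabulate : ∀ {n} {A : Set} (g : A → ℕ) (h : Fin n → A) → listSum g (List.tabulate h) ≡ sum (g ∘ h)
  listSum-tabulate {zero}  g h = refl
  listSum-tabulate {suc n} g h = cong (g (h zero) +_) (listSum-tabulate g (h ∘ suc))

  listSum-allFin : ∀ {n} (g : Fin n → ℕ) → listSum g (List.allFin n) ≡ sum g
  listSum-allFin g = listSum-tabulate g id

  listSum-map : ∀ {A B : Set} (g : B → ℕ) (h : A → B) xs → listSum g (List.map h xs) ≡ listSum (g ∘ h) xs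
  listSum-map g h []       = refl
  listSum-map g h (x ∷ xs) = cong (g (h x) +_) (listSum-map g h xs)

  listSum-concatMap : ∀ {A B : Set} (g : B → ℕ) (h : A → List B) xs →
                      listSum g (List.concatMap h xs) ≡ listSum (λ x → listSum g (h x)) xs
  listSum-concatMap g h []       = refl
  listSum-concatMap g h (x ∷ xs) = trans (listSum-++ g (h x) _) (cong (listSum g (h x) +_) (listSum-concatMap g h xs))

  length-filter : ∀ {A : Set} (p : A → Bool) xs → length (List.filter (λ x → T? (p x)) xs) ≡ listSum (λ x → 𝟙 (p x)) xs
  length-filter p []       = refl
  length-filter p (x ∷ xs) with p x
  ... | true  = cong suc (length-filter p xs)
  ... | false = length-filter p xs

  listSum-pairs : ∀ {n} (f : Fin n × Fin n → ℕ) → listSum f (pairs n) ≡ sum (λ u → sum (λ v → f (u , v)))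
  listSum-pairs {n} f = trans (listSum-concatMap f (λ u → List.map (u ,_) (List.allFin n)) (List.allFin n))
    (trans (listSum-allFin (λ u → listSum f (List.map (u ,_) (List.allFin n))))
           (sum-cong-≗ (λ u → trans (listSum-map f (u ,_) (List.allFin n)) (listSum-allFin (λ v → f (u , v))))))

  ∈-pairs : ∀ {n} (u v : Fin n) → (u , v) List∈.∈ pairs n
  ∈-pairs {n} u v = ∈-concatMap⁺ (λ u → List.map (λ v → u , v) (List.allFin n))
                      (Any.map (λ { refl → ∈-map⁺ (u ,_) (∈-allFin v) }) (∈-allFin u))

  ∈-allSubsets : ∀ {n} (S : Subset n) → S List∈.∈ allSubsets n
  ∈-allSubsets []          = here refl
  ∈-allSubsets (false ∷ S) = ∈-++⁺ˡ (∈-map⁺ (false ∷_) (∈-allSubsets S))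
  ∈-allSubsets (true ∷ S)  = ∈-++⁺ʳ (List.map (false ∷_) (allSubsets _)) (∈-map⁺ (true ∷_) (∈-allSubsets S))

  ∣∣≡card : ∀ {n} (S : Subset n) → ∣ S ∣ ≡ card (Vec.lookup S)
  ∣∣≡card []          = refl
  ∣∣≡card (true ∷ S)  = cong suc (∣∣≡card S)
  ∣∣≡card (false ∷ S) = ∣∣≡card S

  module _ {n : ℕ} (G : Graph n) where

    degIn≡ : ∀ S v → degIn G S v ≡ sumOn (Vec.lookup S) (λ w → 𝟙 (adj G v w))
    degIn≡ S v = trans (length-filter (λ w → Vec.lookup S w ∧ adj G v w) (List.allFin n))
      (trans (listSum-allFin (λ w → 𝟙 (Vec.lookup S w ∧ adj G v w))) (sum-cong-≗ (λ w → 𝟙-∧ (Vec.lookup S w) (adj G v w))))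

    2edges≤ : 2 * edges G ≤ sumOn (λ _ → true) (λ u → sumOn (λ _ → true) (λ v → 𝟙 (adj G u v)))
    2edges≤ = begin
      2 * edges G                                                                       ≡⟨ cong (2 *_) (trans (length-filter _ (pairs n)) (listSum-pairs (λ p → below (proj₁ p) (proj₂ p)))) ⟩
      2 * sum (λ u → sum (λ v → below u v))                                             ≡⟨ cong (sum (λ u → sum (λ v → below u v)) +_) (trans (+-identityʳ _) (∑-comm below)) ⟩
      sum (λ u → sum (λ v → below u v)) + sum (λ u → sum (λ v → below v u))             ≡⟨ sym (∑-distrib-+ (λ u → sum (λ v → below u v)) (λ u → sum (λ v → below v u))) ⟩
      sum (λ u → sum (λ v → below u v) + sum (λ v → below v u))                         ≡⟨ sum-cong-≗ (λ u → sym (∑-distrib-+ (λ v → below u v) (λ v → below v u))) ⟩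
      sum (λ u → sum (λ v → below u v + below v u))                                     ≤⟨ sum-mono-≤ (λ u → ≤-trans (sum-mono-≤ (pt u)) (≤-reflexive (sym (*-identityˡ _)))) ⟩
      sumOn (λ _ → true) (λ u → sumOn (λ _ → true) (λ v → 𝟙 (adj G u v)))              ∎
      where
      open ≤-Reasoning
      below : Fin n → Fin n → ℕ
      below u v = 𝟙 ((toℕ u ℕ.<ᵇ toℕ v) ∧ adj G u v)
      asym : ∀ a b → (a ℕ.<ᵇ b) ≡ true → (b ℕ.<ᵇ a) ≡ true → ⊥
      asym a b p q = <-asym (<ᵇ⇒< a b (subst Bool.T (sym p) _)) (<ᵇ⇒< b a (subst Bool.T (sym q) _))
      pt : ∀ u v → below u v + below v u ≤ 1 * 𝟙 (adj G u v)
      pt u v rewrite adj-sym G v u with toℕ u ℕ.<ᵇ toℕ v in p | toℕ v ℕ.<ᵇ toℕ u in q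
      ... | false | false = z≤n
      ... | false | true  = ≤-reflexive (sym (*-identityˡ _))
      ... | true  | false = ≤-refl
      ... | true  | true  = ⊥-elim (asym (toℕ u) (toℕ v) p q)

    cliques≤js : ∀ r u v → adj G u v ≡ true → cliquesThrough G (suc r) u v ≤ js G r
    cliques≤js r u v Auv = go _ (pairs n) grow (∈-pairs u v) reach
      where
      go : ∀ {c : ℕ} {B : Set} {x : B} (step : B → ℕ → ℕ) xs → (∀ y m → m ≤ step y m) → x List∈.∈ xs →
           (∀ m → c ≤ step x m) → c ≤ List.foldr step 0 xs
      go step (x ∷ xs) grow (here refl) reach = reach _
      go step (y ∷ xs) grow (there i)   reach = ≤-trans (go step xs grow i reach) (grow y _)
      grow : ∀ p m → m ≤ (if adj G (proj₁ p) (proj₂ p) then cliquesThrough G (suc r) (proj₁ p) (proj₂ p) ℕ.⊔ m else m)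
      grow (a , b) m with adj G a b
      ... | true  = m≤n⊔m _ m
      ... | false = ≤-refl
      reach : ∀ m → cliquesThrough G (suc r) u v ≤ (if adj G u v then cliquesThrough G (suc r) u v ℕ.⊔ m else m)
      reach m rewrite Auv = m≤m⊔n _ m

  module CliqueSets {n : ℕ} (G : Graph n) (P : Fin n → Bool) where

    open Cliques (adj G) (adj-sym G) (irrefl G) P
    open Extraction (adj G) (adj-sym G) (irrefl G) P

    count : Fin n → List (Fin n) → ℕ
    count v []      = 0
    count v (u ∷ L) = 𝟙 (does (v Fin.≟ u)) + count v L

    Σcount : ∀ L → sum (λ v → count v L) ≡ length L
    Σcount []      = sum-replicate-zero n
    Σcount (u ∷ L) = trans (∑-distrib-+ (λ v → 𝟙 (does (v Fin.≟ u))) (λ v → count v L)) (cong₂ _+_ (sum-indicator u) (Σcount L))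

    neighbours⇒count≡0 : ∀ v L → All (λ u → adj G u v ≡ true) L → count v L ≡ 0
    neighbours⇒count≡0 v []      []       = refl
    neighbours⇒count≡0 v (u ∷ L) (a ∷ as) with v Fin.≟ u
    ... | no  _    = neighbours⇒count≡0 v L as
    ... | yes refl with trans (sym a) (irrefl G v)
    ...   | ()

    contains : Subset n → List (Fin n) → Bool
    contains S []      = true
    contains S (u ∷ L) = Vec.lookup S u ∧ contains S L

    count≤ : ∀ S v L → Clique L → contains S L ≡ true → count v L ≤ 𝟙 (Vec.lookup S v)
    count≤ S v []      cl       h = z≤n
    count≤ S v (u ∷ L) (a ∷ cl) h with v Fin.≟ u | Vec.lookup S u in Su
    ... | no  _    | true = count≤ S v L cl h
    ... | yes refl | true = ≤-reflexive (trans (cong suc (neighbours⇒count≡0 v L a)) (cong 𝟙 (sym Su)))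

    test : ℕ → List (Fin n) → Subset n → Bool
    test m L S = does (∣ S ∣ ℕ.≟ m) ∧ contains S L ∧ isCliqueᵇ G S

    sets : ℕ → List (Fin n) → ℕ
    sets m L = listSum (λ S → 𝟙 (test m L S)) (allSubsets n)

    -- On a clique list all multiplicities are 0 or 1, since irreflexivity excludes repetitions; the
    -- boolean test for 1 is then membership.
    support : List (Fin n) → Subset n
    support L = Vec.tabulate (λ v → count v L ℕ.≡ᵇ 1)

    support-card : ∀ L → Clique L → ∣ support L ∣ ≡ length L
    support-card L cl = trans (∣∣≡card (support L)) (trans (sum-cong-≗ (λ v → trans (cong 𝟙 (lookup∘tabulate _ v)) (pt (count v L) (bound L cl v)))) (Σcount L))
      where
      pt : ∀ c → c ≤ 1 → 𝟙 (c ℕ.≡ᵇ 1) ≡ c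
      pt zero          _ = refl
      pt (suc zero)    _ = refl
      pt (suc (suc _)) (s≤s ())
      bound : ∀ L → Clique L → ∀ v → count v L ≤ 1
      -- The full vertex set contains every list, so `count≤` applied to it bounds each multiplicity
      -- by 1.
      bound L cl v = ≤-trans (count≤ (Vec.tabulate (λ _ → true)) v L cl (all L)) (𝟙≤1 _)
        where all : ∀ L → contains (Vec.tabulate (λ _ → true)) L ≡ true
              all []      = refl
              all (u ∷ L) rewrite lookup∘tabulate {n = n} (λ _ → true) u = all L

    clique⇒isCliqueᵇ : ∀ S → (∀ u v → Vec.lookup S u ≡ true → Vec.lookup S v ≡ true → u ≢ v → adj G u v ≡ true) →
                       isCliqueᵇ G S ≡ true
    clique⇒isCliqueᵇ S h = go _ (pairs n) ok
      where
      go : ∀ {B : Set} (f : B → Bool) xs → (∀ x → f x ≡ true) → List.foldr (λ p b → b ∧ f p) true xs ≡ true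
      go f []       h = refl
      go f (x ∷ xs) h rewrite go f xs h = h x
      ok : ∀ p → (if Vec.lookup S (proj₁ p) ∧ Vec.lookup S (proj₂ p) ∧ not (does (proj₁ p Fin.≟ proj₂ p)) then adj G (proj₁ p) (proj₂ p) else true) ≡ true
      ok (u , v) with Vec.lookup S u in Su | Vec.lookup S v in Sv | u Fin.≟ v
      ... | false | _     | _      = refl
      ... | true  | false | _      = refl
      ... | true  | true  | yes _  = refl
      ... | true  | true  | no u≢v = h u v Su Sv u≢v

    member⇒count≡1 : ∀ {u} L → Clique L → u List∈.∈ L → count u L ≡ 1
    member⇒count≡1 {u} (.u ∷ L) (a ∷ cl) (here refl) with u Fin.≟ u
    ... | yes _  = cong suc (neighbours⇒count≡0 u L a)
    ... | no u≢u = ⊥-elim (u≢u refl)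
    member⇒count≡1 {u} (v ∷ L) (a ∷ cl) (there i) with u Fin.≟ v
    ... | no  _    = member⇒count≡1 L cl i
    ... | yes refl with trans (sym (All.lookup a i)) (irrefl G u)
    ...   | ()

    count≡1⇒member : ∀ u L → count u L ≡ 1 → u List∈.∈ L
    count≡1⇒member u (v ∷ L) h with u Fin.≟ v
    ... | yes refl = here refl
    ... | no  _    = there (count≡1⇒member u L h)

    members-adjacent : ∀ {u v} L → Clique L → u List∈.∈ L → v List∈.∈ L → u ≢ v → adj G u v ≡ true
    members-adjacent L       cl       (here refl) (here refl) u≢v = ⊥-elim (u≢v refl)
    members-adjacent (u ∷ L) (a ∷ cl) (here refl) (there j)   u≢v = trans (adj-sym G _ _) (All.lookup a j)
    members-adjacent (v ∷ L) (a ∷ cl) (there i)   (here refl) u≢v = All.lookup a i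
    members-adjacent (w ∷ L) (a ∷ cl) (there i)   (there j)   u≢v = members-adjacent L cl i j u≢v

    support⇒member : ∀ L u → Vec.lookup (support L) u ≡ true → u List∈.∈ L
    support⇒member L u h = count≡1⇒member u L (≡ᵇ⇒≡ (count u L) 1
      (subst Bool.T (trans (sym h) (lookup∘tabulate (λ v → count v L ℕ.≡ᵇ 1) u)) _))

    member⇒support : ∀ L u → Clique L → u List∈.∈ L → Vec.lookup (support L) u ≡ true
    member⇒support L u cl i = trans (lookup∘tabulate (λ v → count v L ℕ.≡ᵇ 1) u) (cong (ℕ._≡ᵇ 1) (member⇒count≡1 L cl i))

    support-contains : ∀ L → Clique L → contains (support L) L ≡ true
    support-contains L cl = go L (All.tabulate (member⇒support L _ cl))
      where
      go : ∀ M → All (λ u → Vec.lookup (support L) u ≡ true) M → contains (support L) M ≡ true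
      go []      []       = refl
      go (u ∷ M) (h ∷ hs) rewrite h = go M hs

    support-test : ∀ L → Clique L → test (length L) L (support L) ≡ true
    support-test L cl = cong₂ _∧_ (dec-true (∣ support L ∣ ℕ.≟ length L) (support-card L cl)) (cong₂ _∧_ (support-contains L cl)
      (clique⇒isCliqueᵇ (support L) (λ u v hu hv → members-adjacent L cl (support⇒member L u hu) (support⇒member L v hv))))

    -- Each set of the right size is reached from at most s + 1 choices of the next vertex,
    -- which is where the factorial in ext≤sets comes from.
    extensions≤ : ∀ S s L → Clique L → contains S L ≡ true → ∣ S ∣ ≡ suc s + length L →
                  sumOn P (λ v → joined v L * 𝟙 (Vec.lookup S v)) ≤ suc s
    extensions≤ S s L cl h size = +-cancelʳ-≤ (length L) _ _ (begin
      sumOn P (λ v → joined v L * 𝟙 (Vec.lookup S v)) + length L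
        ≡⟨ cong (sumOn P (λ v → joined v L * 𝟙 (Vec.lookup S v)) +_) (sym (Σcount L)) ⟩
      sumOn P (λ v → joined v L * 𝟙 (Vec.lookup S v)) + sum (λ v → count v L)
        ≡⟨ sym (∑-distrib-+ (λ v → 𝟙 (P v) * (joined v L * 𝟙 (Vec.lookup S v))) (λ v → count v L)) ⟩
      sum (λ v → 𝟙 (P v) * (joined v L * 𝟙 (Vec.lookup S v)) + count v L)
        ≤⟨ sum-mono-≤ pt ⟩
      card (Vec.lookup S)
        ≡⟨ trans (sym (∣∣≡card S)) size ⟩
      suc s + length L ∎)
      where
      open ≤-Reasoning
      pt : ∀ v → 𝟙 (P v) * (joined v L * 𝟙 (Vec.lookup S v)) + count v L ≤ 𝟙 (Vec.lookup S v)
      pt v with joined v L in eq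
      ... | zero  rewrite *-zeroʳ (𝟙 (P v)) = count≤ S v L cl h
      ... | suc j rewrite neighbours⇒count≡0 v L (joined>0⇒All v L (subst (0 <_) (sym eq) (s≤s z≤n))) = begin
        𝟙 (P v) * (suc j * 𝟙 (Vec.lookup S v)) + 0   ≡⟨ +-identityʳ _ ⟩
        𝟙 (P v) * (suc j * 𝟙 (Vec.lookup S v))       ≤⟨ *-mono-≤ (𝟙≤1 (P v)) (*-monoˡ-≤ _ (≤-trans (≤-reflexive (sym eq)) (joined≤1 v L))) ⟩
        1 * (1 * 𝟙 (Vec.lookup S v))                 ≡⟨ trans (*-identityˡ _) (*-identityˡ _) ⟩
        𝟙 (Vec.lookup S v)                           ∎

    ext≤sets : ∀ s L → Clique L → ext s L ≤ s ! * sets (s + length L) L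
    ext≤sets zero    L cl = begin
      1                                          ≡⟨ cong 𝟙 (sym (support-test L cl)) ⟩
      𝟙 (test (length L) L (support L))          ≤⟨ ∈⇒≤listSum (λ S → 𝟙 (test (length L) L S)) (∈-allSubsets (support L)) ⟩
      sets (length L) L                          ≡⟨ sym (*-identityˡ _) ⟩
      1 * sets (length L) L                      ∎
      where open ≤-Reasoning
    ext≤sets (suc s) L cl = begin
      sumOn P (λ v → joined v L * ext s (v ∷ L))
        ≤⟨ sumOn-mono P (λ v _ → step v) ⟩
      sumOn P (λ v → s ! * (joined v L * sets m (v ∷ L)))
        ≡⟨ sumOn-*ˡ P (s !) (λ v → joined v L * sets m (v ∷ L)) ⟩
      s ! * sumOn P (λ v → joined v L * sets m (v ∷ L))
        ≡⟨ cong (s ! *_) (trans (sumOn-cong P (λ v _ → sym (listSum-*ˡ (joined v L) (λ S → 𝟙 (test m (v ∷ L) S)) (allSubsets n))))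
                                (listSum-sumOn P (λ v S → joined v L * 𝟙 (test m (v ∷ L) S)) (allSubsets n))) ⟩
      s ! * listSum (λ S → sumOn P (λ v → joined v L * 𝟙 (test m (v ∷ L) S))) (allSubsets n)
        ≤⟨ *-monoʳ-≤ (s !) (listSum-mono (allSubsets n) per-set) ⟩
      s ! * listSum (λ S → suc s * 𝟙 (test m L S)) (allSubsets n)
        ≡⟨ cong (s ! *_) (listSum-*ˡ (suc s) (λ S → 𝟙 (test m L S)) (allSubsets n)) ⟩
      s ! * (suc s * sets m L)
        ≡⟨ regroup (s !) (suc s) (sets m L) ⟩
      suc s ! * sets m L ∎
      where
      open ≤-Reasoning
      m : ℕ
      m = suc s + length L
      regroup : ∀ a b c → a * (b * c) ≡ b * a * c
      regroup = solve-∀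
      swap : ∀ a b c → a * (b * c) ≡ b * (a * c)
      swap = solve-∀
      step : ∀ v → joined v L * ext s (v ∷ L) ≤ s ! * (joined v L * sets m (v ∷ L))
      step v with joined v L in eq
      ... | zero  = z≤n
      ... | suc j = ≤-trans (*-monoʳ-≤ (suc j) (ext≤sets s (v ∷ L) (joined>0⇒All v L (subst (0 <_) (sym eq) (s≤s z≤n)) ∷ cl)))
                      (≤-reflexive (trans (cong (λ m → suc j * (s ! * sets m (v ∷ L))) (+-suc s (length L))) (swap (suc j) (s !) (sets m (v ∷ L)))))
      per-set : ∀ S → sumOn P (λ v → joined v L * 𝟙 (test m (v ∷ L) S)) ≤ suc s * 𝟙 (test m L S)
      per-set S = per (does (∣ S ∣ ℕ.≟ m)) (contains S L) (isCliqueᵇ G S)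
                      (λ size cS → extensions≤ S s L cl cS (≡ᵇ⇒≡ ∣ S ∣ m (subst Bool.T (sym size) _)))
        where
        vanish : ∀ {f : Fin n → Bool} → (∀ v → f v ≡ false) → sumOn P (λ v → joined v L * 𝟙 (f v)) ≤ suc s * 0
        vanish h = ≤-trans (≤-reflexive (trans (sumOn-cong P (λ v _ → trans (cong (λ b → joined v L * 𝟙 b) (h v)) (*-zeroʳ (joined v L))))
                                        (trans (sumOn-const P 0) (*-zeroʳ (card P))))) z≤n
        per : ∀ a c d → (a ≡ true → c ≡ true → sumOn P (λ v → joined v L * 𝟙 (Vec.lookup S v)) ≤ suc s) →
              sumOn P (λ v → joined v L * 𝟙 (a ∧ (Vec.lookup S v ∧ c) ∧ d)) ≤ suc s * 𝟙 (a ∧ c ∧ d)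
        per false c     d     h = vanish (λ v → refl)
        per true  false d     h = vanish (λ v → cong (_∧ d) (∧-zeroʳ (Vec.lookup S v)))
        per true  true  false h = vanish (λ v → ∧-zeroʳ (Vec.lookup S v ∧ true))
        per true  true  true  h = ≤-trans (≤-reflexive (sumOn-cong P (λ v _ → cong (λ b → joined v L * 𝟙 b)
                                    (trans (∧-identityʳ (Vec.lookup S v ∧ true)) (∧-identityʳ (Vec.lookup S v))))))
                                    (≤-trans (h refl refl) (≤-reflexive (sym (*-identityʳ (suc s)))))

    ext≤js : ∀ k u v → adj G u v ≡ true → ext (suc k) (v ∷ u ∷ []) ≤ suc k ! * js G (2 + k)
    ext≤js k u v Auv = begin
      ext (suc k) (v ∷ u ∷ [])                                ≤⟨ ext≤sets (suc k) (v ∷ u ∷ []) ((Auv ∷ []) ∷ [] ∷ []) ⟩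
      suc k ! * sets (suc k + 2) (v ∷ u ∷ [])                 ≡⟨ cong (λ m → suc k ! * sets m (v ∷ u ∷ [])) (+-comm (suc k) 2) ⟩
      suc k ! * sets (3 + k) (v ∷ u ∷ [])                     ≤⟨ *-monoʳ-≤ (suc k !) (listSum-mono (allSubsets n) pt) ⟩
      suc k ! * listSum (λ S → 𝟙 (good S)) (allSubsets n)     ≡⟨ cong (suc k ! *_) (sym (length-filter good (allSubsets n))) ⟩
      suc k ! * cliquesThrough G (3 + k) u v                  ≤⟨ *-monoʳ-≤ (suc k !) (cliques≤js G (2 + k) u v Auv) ⟩
      suc k ! * js G (2 + k)                                  ∎
      where
      open ≤-Reasoning
      good : Subset n → Bool
      good S = does (∣ S ∣ ℕ.≟ 3 + k) ∧ Vec.lookup S u ∧ Vec.lookup S v ∧ isCliqueᵇ G S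
      perm : ∀ a b c d → 𝟙 (a ∧ (c ∧ (b ∧ true)) ∧ d) ≤ 𝟙 (a ∧ b ∧ c ∧ d)
      perm false b     c     d = z≤n
      perm true  false false d = z≤n
      perm true  true  false d = z≤n
      perm true  false true  d = z≤n
      perm true  true  true  d = ≤-refl
      pt : ∀ S → 𝟙 (test (3 + k) (v ∷ u ∷ []) S) ≤ 𝟙 (good S)
      pt S = perm (does (∣ S ∣ ℕ.≟ 3 + k)) (Vec.lookup S u) (Vec.lookup S v) (isCliqueᵇ G S)

  -- Deleting vertices

  sum-pick : ∀ {m} (j : Fin m) (f : Fin m → ℕ) → sum (λ i → 𝟙 (does (j Fin.≟ i)) * f i) ≡ f j
  sum-pick {suc m} zero    f = trans (cong₂ _+_ (+-identityʳ (f zero)) (sum-replicate-zero m)) (+-identityʳ (f zero))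
  sum-pick         (suc j) f = sum-pick j (f ∘ suc)

  -- Passing from order m+1 to m lowers c N² by 2c(m+1) - c and r e₂ by 2rd. As r d ≤ c(m+1) - T,
  -- the excess grows by at least 2T - c = g.
  delete-arithmetic : ∀ c T g D r m d e j → 2 * T ≡ g + c → c * (suc m * suc m) + j * g ≤ r * (2 * d + e) + D →
                      r * d + T ≤ c * suc m → c * (m * m) + suc j * g ≤ r * e + D
  delete-arithmetic c T g D r m d e j eq h₁ h₂ = ≤-from (2 * (c * suc m) + 2 * (r * d) + 2 * T)
    (+-mono-≤ (+-mono-≤ h₁ (*-monoʳ-≤ 2 h₂)) (≤-reflexive (sym eq)))
    (left c T g r m d j) (right c T D r m d e)
    where
    left : ∀ c T g r m d j → c * (m * m) + suc j * g + (2 * (c * suc m) + 2 * (r * d) + 2 * T)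
                           ≡ c * (suc m * suc m) + j * g + 2 * (r * d + T) + (g + c)
    left = solve-∀
    right : ∀ c T D r m d e → r * (2 * d + e) + D + 2 * (c * suc m) + 2 * T
                            ≡ r * e + D + (2 * (c * suc m) + 2 * (r * d) + 2 * T)
    right = solve-∀

  budget-arithmetic : ∀ c D m e C M y x → let r = suc c in e + (C + M) ≡ m * m → c * (m * m) + x ≤ r * e + D →
                      r * (m * m) + y ≤ r * r * C → y + r * (r * M + x) ≤ r * D
  budget-arithmetic c D m e C M y x eq h₁ h₂ = ≤-from
    (r * (c * (m * m)) + r * r * e + r * (m * m) + r * r * C)
    (+-mono-≤ (+-mono-≤ (*-monoʳ-≤ r h₁) h₂) (≤-reflexive (cong (r * r *_) eq)))
    (left c m e C M y x) (right c D m e C)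
    where
    r : ℕ
    r = suc c
    left : ∀ c m e C M y x → let r = suc c in
           y + r * (r * M + x) + (r * (c * (m * m)) + r * r * e + r * (m * m) + r * r * C)
           ≡ r * (c * (m * m) + x) + (r * (m * m) + y) + r * r * (e + (C + M))
    left = solve-∀
    right : ∀ c D m e C → let r = suc c in
            r * (r * e + D) + r * r * C + r * r * (m * m)
            ≡ r * D + (r * (c * (m * m)) + r * r * e + r * (m * m) + r * r * C)
    right = solve-∀

  kept-arithmetic : ∀ c n m i d s b B y → let r = suc c in m + i ≡ n → m ≤ d + (s + b) + B → r * s ≤ m + y →
                    c * n ≤ r * d + (r * (B + i) + r * b + y)
  kept-arithmetic c n m i d s b B y refl h₁ h₂ = ≤-from (m + r * s)
    (+-mono-≤ (+-mono-≤ (*-monoʳ-≤ r h₁) h₂) (m≤m+n (c * i) i)) (left c m i s) (right c m i d s b B y)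
    where
    r : ℕ
    r = suc c
    left : ∀ c m i s → c * (m + i) + (m + suc c * s) ≡ suc c * m + suc c * s + c * i
    left = solve-∀
    right : ∀ c m i d s b B y → suc c * (d + (s + b) + B) + (m + y) + (c * i + i)
                              ≡ suc c * d + (suc c * (B + i) + suc c * b + y) + (m + suc c * s)
    right = solve-∀

  module Deletion {n : ℕ} (A : Fin n → Fin n → Bool) (A-sym : ∀ u v → A u v ≡ A v u)
                  (A-irrefl : ∀ v → A v v ≡ false) (c T g D : ℕ) (2T≡g+c : 2 * T ≡ g + c) where

    open Cliques A A-sym A-irrefl

    r : ℕ
    r = suc c

    remove : (Fin n → Bool) → Fin n → Fin n → Bool
    remove P v w = P w ∧ not (does (w Fin.≟ v))

    sumOn-remove : ∀ P v f → P v ≡ true → sumOn P f ≡ f v + sumOn (remove P v) f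
    sumOn-remove P v f Pv = begin
      sumOn P f
        ≡⟨ sum-cong-≗ pt ⟩
      sum (λ w → 𝟙 (does (w Fin.≟ v)) * f v + 𝟙 (remove P v w) * f w)
        ≡⟨ ∑-distrib-+ (λ w → 𝟙 (does (w Fin.≟ v)) * f v) (λ w → 𝟙 (remove P v w) * f w) ⟩
      sum (λ w → 𝟙 (does (w Fin.≟ v)) * f v) + sumOn (remove P v) f
        ≡⟨ cong (_+ sumOn (remove P v) f) (trans (sym (*-distribʳ-sum (f v) (λ w → 𝟙 (does (w Fin.≟ v)))))
                                                  (trans (cong (_* f v) (sum-indicator v)) (*-identityˡ (f v)))) ⟩
      f v + sumOn (remove P v) f ∎
      where
      open ≡-Reasoning
      pt : ∀ w → 𝟙 (P w) * f w ≡ 𝟙 (does (w Fin.≟ v)) * f v + 𝟙 (remove P v w) * f w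
      pt w with w Fin.≟ v
      ... | no  _    = cong (λ b → 𝟙 b * f w) (sym (∧-identityʳ (P w)))
      ... | yes refl rewrite Pv = sym (+-identityʳ _)

    N-remove : ∀ P v → P v ≡ true → N P ≡ suc (N (remove P v))
    N-remove P v Pv = trans (sym (sumOn-1 P)) (trans (sumOn-remove P v (λ _ → 1) Pv) (cong suc (sumOn-1 (remove P v))))

    e₂-remove : ∀ P v → P v ≡ true → e₂ P ≡ 2 * deg P v + e₂ (remove P v)
    e₂-remove P v Pv = begin
      e₂ P
        ≡⟨ sumOn-remove P v (deg P) Pv ⟩
      deg P v + sumOn P′ (deg P)
        ≡⟨ cong (deg P v +_) (trans (sumOn-cong P′ (λ u _ → sumOn-remove P v (λ w → 𝟙 (A u w)) Pv)) (sumOn-+ P′ (λ u → 𝟙 (A u v)) (deg P′))) ⟩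
      deg P v + (sumOn P′ (λ u → 𝟙 (A u v)) + e₂ P′)
        ≡⟨ cong (λ x → deg P v + (x + e₂ P′)) (trans (sumOn-cong P′ (λ u _ → cong 𝟙 (A-sym u v))) (sym deg-v)) ⟩
      deg P v + (deg P v + e₂ P′)
        ≡⟨ regroup (deg P v) (e₂ P′) ⟩
      2 * deg P v + e₂ P′ ∎
      where
      open ≡-Reasoning
      P′ = remove P v
      deg-v : deg P v ≡ deg P′ v
      deg-v = trans (sumOn-remove P v (λ w → 𝟙 (A v w)) Pv) (cong (λ b → 𝟙 b + deg P′ v) (A-irrefl v))
      regroup : ∀ d e → d + (d + e) ≡ 2 * d + e
      regroup = solve-∀

    -- Each deletion raises r e₂ - c N² by at least g.
    record Stage (j : ℕ) (P : Fin n → Bool) : Set where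
      field
        size    : N P + j ≡ n
        density : c * (N P * N P) + j * g ≤ r * e₂ P + D

    open Stage public

    delete : ∀ {j P} v → P v ≡ true → r * deg P v + T ≤ c * N P → Stage j P → Stage (suc j) (remove P v)
    delete {j} {P} v Pv low st = record
      { size    = trans (+-suc (N P′) j) (trans (cong (_+ j) (sym (N-remove P v Pv))) (size st))
      ; density = delete-arithmetic c T g D r (N P′) (deg P v) (e₂ P′) j 2T≡g+c density′ low′ }
      where
      P′ = remove P v
      density′ : c * (suc (N P′) * suc (N P′)) + j * g ≤ r * (2 * deg P v + e₂ P′) + D
      density′ = subst₂ (λ x y → c * (x * x) + j * g ≤ r * y + D) (N-remove P v Pv) (e₂-remove P v Pv) (density st)
      low′ : r * deg P v + T ≤ c * suc (N P′)
      low′ = subst (λ x → r * deg P v + T ≤ c * x) (N-remove P v Pv) low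

    HighDegrees : (Fin n → Bool) → Set
    HighDegrees P = ∀ v → P v ≡ true → r * nondeg P v ≤ N P + T

    not-low : ∀ P v → ¬ (r * deg P v + T ≤ c * N P) → r * nondeg P v ≤ N P + T
    not-low P v h = ≤-from (r * deg P v) (+-monoʳ-≤ (N P) (<⇒≤ (≰⇒> h)))
      (trans (sym (*-distribˡ-+ r (nondeg P v) (deg P v))) (cong (r *_) (trans (+-comm (nondeg P v) (deg P v)) (deg+nondeg P v))))
      (regroup (N P) (r * deg P v) T)
      where regroup : ∀ a b c → a + (b + c) ≡ a + c + b
            regroup = solve-∀

    delete-all : ∀ fuel {j} P → Stage j P →
                 (∃ λ P′ → Stage (fuel + j) P′) ⊎ (∃ λ P′ → ∃ λ j′ → j′ ≤ fuel + j × Stage j′ P′ × HighDegrees P′)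
    delete-all zero       P st = inj₁ (P , st)
    delete-all (suc fuel) {j} P st
      with Fin.any? (λ v → (P v Bool.≟ true) ×-dec (r * deg P v + T ℕ.≤? c * N P))
    ... | no  ¬low = inj₂ (P , j , m≤n+m j (suc fuel) , st , λ v Pv → not-low P v (λ low → ¬low (v , Pv , low)))
    ... | yes (v , Pv , low) with delete-all fuel (remove P v) (delete v Pv low st)
    ...   | inj₁ (P′ , st′)               = inj₁ (P′ , subst (λ m → Stage m P′) (+-suc fuel j) st′)
    ...   | inj₂ (P′ , j′ , j′≤ , rest)   = inj₂ (P′ , j′ , ≤-trans j′≤ (≤-reflexive (+-suc fuel j)) , rest)

    module Cleanup {i : ℕ} (P : Fin n → Bool) (st : Stage i P) (col : Fin n → Fin r)
                   (proper : ∀ u v → P u ≡ true → P v ≡ true → A u v ≡ true → col u ≢ col v)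
                   (b : ℕ) (rq≤g : r * suc b ≤ g) where

      class : Fin r → ℕ
      class j = sumOn P (λ w → 𝟙 (does (col w Fin.≟ j)))

      missing : Fin n → Fin n → ℕ
      missing v w = 𝟙 (not (A v w)) * 𝟙 (not (does (col w Fin.≟ col v)))

      missings : Fin n → ℕ
      missings v = sumOn P (missing v)

      nondeg≡ : ∀ v → P v ≡ true → nondeg P v ≡ class (col v) + missings v
      nondeg≡ v Pv = trans (sumOn-cong P pt) (sumOn-+ P (λ w → 𝟙 (does (col w Fin.≟ col v))) (missing v))
        where pt : ∀ w → P w ≡ true → 𝟙 (not (A v w)) ≡ 𝟙 (does (col w Fin.≟ col v)) + missing v w
              pt w Pw with A v w in Avw | col w Fin.≟ col v
              ... | true  | yes eq = ⊥-elim (proper v w Pv Pw Avw (sym eq))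
              ... | true  | no  _  = refl
              ... | false | yes _  = refl
              ... | false | no  _  = refl

      classes : ℕ
      classes = sum (λ j → class j * class j)

      Σclass : sum class ≡ N P
      Σclass = trans (sym (sumOn-comm P (λ j w → 𝟙 (does (col w Fin.≟ j)))))
        (trans (sumOn-cong P (λ w _ → trans (sum-cong-≗ (λ j → sym (*-identityʳ (𝟙 (does (col w Fin.≟ j)))))) (sum-pick (col w) (λ _ → 1)))) (sumOn-1 P))

      Σclass² : sumOn P (λ v → class (col v)) ≡ classes
      Σclass² = trans (sumOn-cong P (λ v _ → sym (sum-pick (col v) class)))
        (trans (sumOn-comm P (λ j v → 𝟙 (does (col v Fin.≟ j)) * class j)) (sum-cong-≗ (λ j → sumOn-*ʳ P (class j) (λ v → 𝟙 (does (col v Fin.≟ j))))))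

      totalMissing : ℕ
      totalMissing = sumOn P missings

      e₂≡ : e₂ P + (classes + totalMissing) ≡ N P * N P
      e₂≡ = begin
        e₂ P + (classes + totalMissing)        ≡⟨ cong (λ x → e₂ P + (x + totalMissing)) (sym Σclass²) ⟩
        e₂ P + (sumOn P (λ v → class (col v)) + sumOn P missings)
                                               ≡⟨ cong (e₂ P +_) (trans (sym (sumOn-+ P (λ v → class (col v)) missings)) (sumOn-cong P (λ v Pv → sym (nondeg≡ v Pv)))) ⟩
        e₂ P + sumOn P (nondeg P)              ≡⟨ trans (sym (sumOn-+ P (deg P) (nondeg P))) (sumOn-cong P (λ v _ → deg+nondeg P v)) ⟩
        sumOn P (λ _ → N P)                    ≡⟨ sumOn-const P (N P) ⟩
        N P * N P                              ∎
        where open ≡-Reasoning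

      deviation : Fin r → ℕ
      deviation j = ∣ r * class j - N P ∣

      -- The squared deviations sum to r² `classes` - r N², a multiple of the variance of the class
      -- sizes; a single one of them is kept.
      deviation-bound : ∀ j → r * (N P * N P) + deviation j * deviation j ≤ r * r * classes
      deviation-bound j = ≤-from (r * (N P * N P)) (+-monoʳ-≤ (2 * (r * N P * N P)) (term≤sum (λ i → deviation i * deviation i) j))
        (i₁ r (N P) (deviation j * deviation j)) (begin
          2 * (r * N P * N P) + sum (λ i → deviation i * deviation i)
            ≡⟨ cong (_+ sum (λ i → deviation i * deviation i)) (trans (i₂ r (N P)) (trans (cong (2 * r * N P *_) (sym Σclass)) (*-distribˡ-sum (2 * r * N P) class))) ⟩
          sum (λ i → 2 * r * N P * class i) + sum (λ i → deviation i * deviation i)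
            ≡⟨ sym (∑-distrib-+ (λ i → 2 * r * N P * class i) (λ i → deviation i * deviation i)) ⟩
          sum (λ i → 2 * r * N P * class i + deviation i * deviation i)
            ≡⟨ sum-cong-≗ (λ i → trans (cong (_+ deviation i * deviation i) (i₃ r (N P) (class i))) (trans (∣-∣²-expand (r * class i) (N P)) (cong (_+ N P * N P) (i₄ r (class i))))) ⟩
          sum (λ i → r * r * (class i * class i) + N P * N P)
            ≡⟨ ∑-distrib-+ (λ i → r * r * (class i * class i)) (λ _ → N P * N P) ⟩
          sum (λ i → r * r * (class i * class i)) + sum {r} (λ _ → N P * N P)
            ≡⟨ cong₂ _+_ (sym (*-distribˡ-sum (r * r) (λ i → class i * class i))) (sum-const r (N P * N P)) ⟩
          r * r * classes + r * (N P * N P) ∎)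
        where
        open ≡-Reasoning
        i₁ : ∀ r m d → r * (m * m) + d + r * (m * m) ≡ 2 * (r * m * m) + d
        i₁ = solve-∀
        i₂ : ∀ r m → 2 * (r * m * m) ≡ 2 * r * m * m
        i₂ = solve-∀
        i₃ : ∀ r m c → 2 * r * m * c ≡ 2 * (r * c * m)
        i₃ = solve-∀
        i₄ : ∀ r c → r * c * (r * c) ≡ r * r * (c * c)
        i₄ = solve-∀

      -- An r-partite graph falls short of the Turán value of r e₂ by the imbalance of its classes
      -- and by the missing cross pairs, while `density` limits the shortfall to D - i g. So the one
      -- budget D pays for the imbalance, the missing pairs and the earlier deletions.
      budget : ∀ j → deviation j * deviation j + r * (r * totalMissing + i * g) ≤ r * D
      budget j = budget-arithmetic c D (N P) (e₂ P) classes totalMissing (deviation j * deviation j) (i * g) e₂≡ (density st) (deviation-bound j)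

      bad : Fin n → Bool
      bad v = suc b ℕ.≤ᵇ missings v

      kept : Fin n → Bool
      kept v = P v ∧ not (bad v)

      removed : ℕ
      removed = sumOn P (λ v → 𝟙 (bad v)) + i

      N-kept : N kept + removed ≡ n
      N-kept = trans (sym (+-assoc (N kept) (sumOn P (λ v → 𝟙 (bad v))) i)) (trans (cong (_+ i) split) (size st))
        where
        split : N kept + sumOn P (λ v → 𝟙 (bad v)) ≡ N P
        split = trans (sym (∑-distrib-+ (λ v → 𝟙 (kept v)) (λ v → 𝟙 (P v) * 𝟙 (bad v)))) (sum-cong-≗ (λ v → pt (P v) (bad v)))
          where pt : ∀ p q → 𝟙 (p ∧ not q) + 𝟙 p * 𝟙 q ≡ 𝟙 p
                pt true  true  = refl
                pt true  false = refl
                pt false q     = refl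

      -- A bad vertex consumes at least r(b+1) of the budget, a deleted one g. The condition `rq≤g`
      -- makes r(b+1) a common lower price for both kinds.
      removed-bound : r * suc b * removed ≤ D
      removed-bound = ≤-trans (≤-reflexive (*-distribˡ-+ (r * suc b) (sumOn P (λ v → 𝟙 (bad v))) i))
        (≤-trans (+-mono-≤ bad-bound (≤-trans (*-monoˡ-≤ i rq≤g) (≤-reflexive (*-comm g i))))
          (*-cancelˡ-≤ r (≤-trans (m≤n+m _ (deviation zero * deviation zero)) (budget zero))))
        where
        pt : ∀ v → suc b * 𝟙 (bad v) ≤ missings v
        pt v with suc b ℕ.≤ᵇ missings v in eq
        ... | true  = ≤-trans (≤-reflexive (*-identityʳ (suc b))) (≤ᵇ⇒≤ (suc b) (missings v) (subst Bool.T (sym eq) _))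
        ... | false = ≤-trans (≤-reflexive (*-zeroʳ (suc b))) z≤n
        bad-bound : r * suc b * sumOn P (λ v → 𝟙 (bad v)) ≤ r * totalMissing
        bad-bound = ≤-trans (≤-reflexive (trans (*-assoc r (suc b) _) (cong (r *_) (sym (sumOn-*ˡ P (suc b) (λ v → 𝟙 (bad v)))))))
          (*-monoʳ-≤ r (sumOn-mono P (λ v _ → pt v)))

      kept⇒P : ∀ v → kept v ≡ true → P v ≡ true × missings v ≤ b
      kept⇒P v h with P v | suc b ℕ.≤ᵇ missings v in eq
      ... | true | false = refl , ≮⇒≥ (λ lt → subst Bool.T eq (≤⇒≤ᵇ lt))

      -- The non-neighbours of v are its own class, of size at most (N + deviation)/r, and at most b
      -- further vertices; each removed vertex costs at most one more neighbour.
      kept-degree : ∀ v → kept v ≡ true → c * n ≤ r * deg kept v + (r * removed + r * b + deviation (col v))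
      kept-degree v kv = kept-arithmetic c n (N P) i (deg kept v) (class (col v)) b (sumOn P (λ v → 𝟙 (bad v))) (deviation (col v))
        (size st) (≤-trans cover (+-monoˡ-≤ _ (+-monoʳ-≤ (deg kept v) (≤-trans (≤-reflexive (nondeg≡ v Pv)) (+-monoʳ-≤ (class (col v)) few)))))
        (m≤n+∣m-n∣ (r * class (col v)) (N P))
        where
        Pv : P v ≡ true
        Pv = proj₁ (kept⇒P v kv)
        few : missings v ≤ b
        few = proj₂ (kept⇒P v kv)
        cover : N P ≤ deg kept v + nondeg P v + sumOn P (λ w → 𝟙 (bad w))
        cover = ≤-trans (sum-mono-≤ (λ w → pt (P w) (bad w) (A v w)))
          (≤-reflexive (trans (∑-distrib-+ (λ w → 𝟙 (kept w) * 𝟙 (A v w) + 𝟙 (P w) * 𝟙 (not (A v w))) (λ w → 𝟙 (P w) * 𝟙 (bad w)))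
            (cong (_+ sumOn P (λ w → 𝟙 (bad w))) (∑-distrib-+ (λ w → 𝟙 (kept w) * 𝟙 (A v w)) (λ w → 𝟙 (P w) * 𝟙 (not (A v w)))))))
          where pt : ∀ p q a → 𝟙 p ≤ 𝟙 (p ∧ not q) * 𝟙 a + 𝟙 p * 𝟙 (not a) + 𝟙 p * 𝟙 q
                pt false q     a     = z≤n
                pt true  true  true  = ≤-refl
                pt true  true  false = s≤s z≤n
                pt true  false true  = ≤-refl
                pt true  false false = ≤-refl

  -- Numerical estimates

  square-cancel-< : ∀ a b → a * a < b * b → a < b
  square-cancel-< a b h = ≰⇒> (λ b≤a → <⇒≱ h (*-mono-≤ b≤a b≤a))

  sqrt-between : ∀ m D → 0 < m → ∃ λ b → m * (b * b) ≤ D × D < m * (suc b * suc b)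
  sqrt-between m zero    m>0 = 0 , ≤-reflexive (*-zeroʳ m) , ≤-trans m>0 (≤-reflexive (sym (*-identityʳ m)))
  sqrt-between m (suc D) m>0 with sqrt-between m D m>0
  ... | b , lo , hi with m * (suc b * suc b) ℕ.≤? suc D
  ...   | yes le = suc b , le , ≤-<-trans hi (*-monoʳ-< m {{ℕ.>-nonZero m>0}} (*-mono-< (n<1+n (suc b)) (n<1+n (suc b))))
  ...   | no  gt = b , m≤n⇒m≤1+n lo , ≰⇒> gt

  -- (1 - 2/q)^k ≥ 1 - 2k/q, cleared of denominators. The ratio N/n is at least 1 - 2/q because at
  -- most 4T ≤ 2n/q vertices are deleted.
  bernoulli : ∀ q N n k → N ≤ n → q * n ≤ q * N + 2 * n → q * n ^ k ≤ q * N ^ k + 2 * k * n ^ k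
  bernoulli q N n zero    N≤n h = m≤m+n _ _
  bernoulli q N n (suc k) N≤n h = ≤-from (n * (q * N ^ k) + 2 * (n * N ^ k))
    (+-mono-≤ (+-mono-≤ (*-monoʳ-≤ n (bernoulli q N n k N≤n h)) (*-monoʳ-≤ (N ^ k) h)) (*-monoʳ-≤ 2 (*-monoʳ-≤ n (^-monoˡ-≤ k N≤n))))
    (left q n (n ^ k) (N ^ k)) (right q N n k (n ^ k) (N ^ k))
    where
    left : ∀ q n x y → q * (n * x) + (n * (q * y) + 2 * (n * y)) ≡ n * (q * x) + y * (q * n) + 2 * (n * y)
    left = solve-∀
    right : ∀ q N n k x y → n * (q * y + 2 * k * x) + y * (q * N + 2 * n) + 2 * (n * x)
                          ≡ q * (N * y) + 2 * suc k * (n * x) + (n * (q * y) + 2 * (n * y))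
    right = solve-∀

  -- T ≈ n / (2r³) is the degree deficit (times r) that makes a vertex deletable; at most 4T are deleted.
  record Parameters (r c q n : ℕ) : Set where
    field
      T g       : ℕ
      2qT≤n     : 2 * q * T ≤ n
      n<2q[T+1] : n < 2 * q * suc T
      16r≤2T+1  : 16 * r ≤ 2 * T + 1
      2T≡g+c    : 2 * T ≡ g + c

  parameters : ∀ k n → (2 + k) ^ 8 < n → Parameters (2 + k) (1 + k) ((2 + k) * (2 + k) * (2 + k)) n
  parameters k n large = record
    { T = T ; g = 2 * T ∸ c ; 2qT≤n = ≤-trans (≤-reflexive (*-comm (2 * q) T)) (m/n*n≤m n (2 * q))
    ; n<2q[T+1] = upper ; 16r≤2T+1 = 16r≤ T upper ; 2T≡g+c = sym (m∸n+n≡m (c≤ T (16r≤ T upper))) }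
    where
    r c q T : ℕ
    r = 2 + k
    c = 1 + k
    q = r * r * r
    T = n / (2 * q)
    upper : n < 2 * q * suc T
    upper = begin-strict
      n                            ≡⟨ m≡m%n+[m/n]*n n (2 * q) ⟩
      n % (2 * q) + T * (2 * q)    <⟨ +-monoˡ-< (T * (2 * q)) (m%n<n n (2 * q)) ⟩
      2 * q + T * (2 * q)          ≡⟨ *-comm (suc T) (2 * q) ⟩
      2 * q * suc T                ∎
      where open ≤-Reasoning
    eighth : ∀ k → let r = 2 + k in r * (r * (r * (r * (r * (r * (r * (r * 1))))))) ≡ r * r * r * (r * (r * r * (r * r)))
    eighth = solve-∀
    fifth : ∀ k → let r = 2 + k in r * (r * r * (r * r)) ≡ 16 * r + r * (32 * k + 24 * (k * k) + 8 * (k * k * k) + k * k * (k * k))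
    fifth = solve-∀
    16r≤ : ∀ T → n < 2 * q * suc T → 16 * r ≤ 2 * T + 1
    16r≤ T upper = ≤-trans (≤-trans (m≤m+n _ _) (≤-reflexive (sym (fifth k)))) (ℕ.s≤s⁻¹ (≤-trans bound (≤-reflexive (i₂ T))))
      where
      i₁ : ∀ q T → 2 * q * suc T ≡ q * (2 * suc T)
      i₁ = solve-∀
      i₂ : ∀ T → 2 * suc T ≡ suc (2 * T + 1)
      i₂ = solve-∀
      -- Since r⁸ = q r⁵, dividing r⁸ < n < 2q(T+1) by q gives r⁵ < 2(T+1); then r⁴ ≥ 16 is applied.
      bound : r * (r * r * (r * r)) < 2 * suc T
      bound = *-cancelˡ-< q _ _ (≤-trans (≤-reflexive (cong suc (sym (eighth k)))) (≤-trans large (≤-trans (<⇒≤ upper) (≤-reflexive (i₁ q T)))))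
    c≤ : ∀ T → 16 * r ≤ 2 * T + 1 → c ≤ 2 * T
    c≤ T h = ℕ.s≤s⁻¹ (≤-trans (m≤m*n r 16) (≤-trans (≤-reflexive (*-comm r 16)) (≤-trans h (≤-reflexive (+-comm (2 * T) 1)))))

  -- 4 T g is 8T² up to lower order terms, where n² ≈ 4q²T².
  gain-arithmetic : ∀ r c q T g n → 0 < r → r ≡ suc c → n < 2 * q * suc T → 16 * r ≤ 2 * T + 1 → 2 * T ≡ g + c →
                    37 * (n * n) ≤ 36 * (q * q) * (4 * T * g)
  gain-arithmetic r c q T g n r>0 refl h₁ h₂ h₃ = begin
      37 * (n * n)                             ≤⟨ *-monoʳ-≤ 37 (*-mono-≤ (<⇒≤ h₁) (<⇒≤ h₁)) ⟩
      37 * (2 * q * suc T * (2 * q * suc T))   ≡⟨ i₃ q (suc T) ⟩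
      4 * (q * q) * (37 * (suc T * suc T))     ≤⟨ *-monoʳ-≤ (4 * (q * q)) Tg ⟩
      4 * (q * q) * (36 * (T * g))             ≡⟨ i₄ q T g ⟩
      36 * (q * q) * (4 * T * g)               ∎
    where
    open ≤-Reasoning
    i₃ : ∀ q s → 37 * (2 * q * s * (2 * q * s)) ≡ 4 * (q * q) * (37 * (s * s))
    i₃ = solve-∀
    i₄ : ∀ q T g → 4 * (q * q) * (36 * (T * g)) ≡ 36 * (q * q) * (4 * T * g)
    i₄ = solve-∀
    T≥3 : 3 ≤ T
    T≥3 = ≮⇒≥ (λ T<3 → <⇒≱ (≤-<-trans (+-monoˡ-≤ 1 (*-monoʳ-≤ 2 T<3)) (m≤n+m 8 8)) (≤-trans (*-monoʳ-≤ 16 r>0) (≤-trans h₂ (+-monoˡ-≤ 1 (*-monoʳ-≤ 2 (n≤1+n T))))))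
    16g : 30 * T + 15 ≤ 16 * g
    16g = ≤-from (16 * c + 2 * T + 1) (+-mono-≤ h₂ (≤-reflexive (cong (16 *_) h₃))) (j₁ T c) (j₂ T g c)
      where
      j₁ : ∀ T c → 30 * T + 15 + (16 * c + 2 * T + 1) ≡ 16 * suc c + 16 * (2 * T)
      j₁ = solve-∀
      j₂ : ∀ T g c → 2 * T + 1 + 16 * (g + c) ≡ 16 * g + (16 * c + 2 * T + 1)
      j₂ = solve-∀
    T≡ : 3 + (T ∸ 3) ≡ T
    T≡ = m+[n∸m]≡n T≥3
    Tg : 37 * (suc T * suc T) ≤ 36 * (T * g)
    Tg = *-cancelˡ-≤ 16 (≤-trans (subst Goal T≡ (shifted (T ∸ 3))) (≤-trans (*-monoʳ-≤ (36 * T) 16g) (≤-reflexive (j₂ T g))))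
      where
      Goal : ℕ → Set
      Goal T = 16 * (37 * (suc T * suc T)) ≤ 36 * T * (30 * T + 15)
      j₁ : ∀ t → 16 * (37 * (suc (3 + t) * suc (3 + t))) + (1868 + 2284 * t + 488 * (t * t)) ≡ 36 * (3 + t) * (30 * (3 + t) + 15)
      j₁ = solve-∀
      shifted : ∀ t → Goal (3 + t)
      shifted t = ≤-trans (m≤m+n (16 * (37 * (suc (3 + t) * suc (3 + t)))) (1868 + 2284 * t + 488 * (t * t))) (≤-reflexive (j₁ t))
      j₂ : ∀ T g → 36 * T * (16 * g) ≡ 16 * (36 * (T * g))
      j₂ = solve-∀

  -- The deficit takes at most 1/36 of n²/q² and the gain is at least 37/36 of it, so F retains
  -- n²/q².
  excess-arithmetic : ∀ q D n G → 0 < n → 36 * (q * q) * D ≤ n * n → 37 * (n * n) ≤ 36 * (q * q) * G →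
                      ∃ λ F → G ≡ D + F × n * n ≤ q * q * F
  excess-arithmetic q D n G n>0 h₁ h₂ = G ∸ D , sym split ,
    *-cancelˡ-≤ 36 (≤-from (n * n) (≤-trans h₂ (≤-trans (≤-reflexive (trans (cong (36 * (q * q) *_) (sym split)) (i₁ q D (G ∸ D)))) (+-monoˡ-≤ _ h₁)))
      (i₂ (n * n)) (+-comm (n * n) _))
    where
    i₁ : ∀ q D F → 36 * (q * q) * (D + F) ≡ 36 * (q * q) * D + 36 * (q * q * F)
    i₁ = solve-∀
    i₂ : ∀ x → 36 * x + x ≡ 37 * x
    i₂ = solve-∀
    split : D + (G ∸ D) ≡ G
    split = m+[n∸m]≡n (≮⇒≥ λ G<D → <⇒≱ (m<m+n (n * n) (*-mono-≤ (s≤s {n = 35} z≤n) (*-mono-< n>0 n>0)))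
      (≤-trans h₂ (≤-trans (*-monoʳ-≤ (36 * (q * q)) (<⇒≤ G<D)) h₁)))

  -- The conclusion is the bound on `js` multiplied by r^(r+8). Supersaturation yields r - 1 where
  -- the target has r; this surplus, with the 1/r³ of the target, outweighs the factor 1 - 2k/q lost
  -- in N^k. The comparison is `gap`.
  excess⇒joint : ∀ k r q n N F J → r ≡ 2 + k → q ≡ r * r * r → 0 < n → N ≤ n → q * n ≤ q * N + 2 * n → n * n ≤ q * q * F →
                 F * N ^ k ≤ (1 + k) * J * r ^ k * N → q * n ^ (1 + k) < r ^ (10 + k) * J + n ^ (1 + k)
  excess⇒joint k r q n N F J refl refl n>0 N≤n h₁ h₂ h₃ = *-cancelˡ-< c _ _ (≤-from (2 * k * r * X + q * X)
    (+-mono-≤ (*-monoʳ-≤ r qX) gap) (i₁ k (q * X) (2 * k * r * X)) (i₂ k c r q X Y (r ^ (10 + k) * J) (i₃ r (r ^ k) J)))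
    where
    open ≤-Reasoning
    c X Y : ℕ
    c = 1 + k
    X = n ^ (1 + k)
    Y = q * (q * q) * (J * r ^ k)
    nN : n * N ^ k ≤ q * q * (c * J * r ^ k)
    nN = *-cancelˡ-≤ n {{ℕ.>-nonZero n>0}} (begin
      n * (n * N ^ k)                        ≡⟨ sym (*-assoc n n _) ⟩
      n * n * N ^ k                          ≤⟨ *-monoˡ-≤ (N ^ k) h₂ ⟩
      q * q * F * N ^ k                      ≡⟨ *-assoc (q * q) F _ ⟩
      q * q * (F * N ^ k)                    ≤⟨ *-monoʳ-≤ (q * q) (≤-trans h₃ (*-monoʳ-≤ (c * J * r ^ k) N≤n)) ⟩
      q * q * (c * J * r ^ k * n)            ≡⟨ swap (q * q) (c * J * r ^ k) n ⟩
      n * (q * q * (c * J * r ^ k))          ∎)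
      where swap : ∀ a b n → a * (b * n) ≡ n * (a * b)
            swap = solve-∀
    qX : q * X ≤ c * Y + 2 * k * X
    qX = begin
      q * (n * n ^ k)                                    ≡⟨ j₁ q n (n ^ k) ⟩
      n * (q * n ^ k)                                    ≤⟨ *-monoʳ-≤ n (bernoulli q N n k N≤n h₁) ⟩
      n * (q * N ^ k + 2 * k * n ^ k)                    ≡⟨ j₂ q n k (N ^ k) (n ^ k) ⟩
      q * (n * N ^ k) + 2 * k * (n * n ^ k)              ≤⟨ +-monoˡ-≤ _ (*-monoʳ-≤ q nN) ⟩
      q * (q * q * (c * J * r ^ k)) + 2 * k * X          ≡⟨ cong (_+ 2 * k * X) (j₃ q c J (r ^ k)) ⟩
      c * Y + 2 * k * X                                  ∎
      where
      j₁ : ∀ q n x → q * (n * x) ≡ n * (q * x)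
      j₁ = solve-∀
      j₂ : ∀ q n k y x → n * (q * y + 2 * k * x) ≡ q * (n * y) + 2 * k * (n * x)
      j₂ = solve-∀
      j₃ : ∀ q c J x → q * (q * q * (c * J * x)) ≡ c * (q * (q * q) * (J * x))
      j₃ = solve-∀
    gap : suc (2 * k * r * X) ≤ c * X + q * X
    gap = begin
      suc (2 * k * r * X)                                     ≤⟨ +-monoˡ-≤ (2 * k * r * X) (m^n>0 n {{ℕ.>-nonZero n>0}} (1 + k)) ⟩
      X + 2 * k * r * X                                       ≤⟨ m≤m+n _ ((k * k * k + 4 * (k * k) + 9 * k + 8) * X) ⟩
      X + 2 * k * r * X + (k * k * k + 4 * (k * k) + 9 * k + 8) * X
                                                              ≡⟨ j₁ k X ⟩
      c * X + q * X                                           ∎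
      where
      j₁ : ∀ k X → let r = 2 + k in
           X + 2 * k * r * X + (k * k * k + 4 * (k * k) + 9 * k + 8) * X ≡ (1 + k) * X + r * r * r * X
      j₁ = solve-∀
    i₁ : ∀ k x w → suc ((1 + k) * x) + (w + x) ≡ (2 + k) * x + suc w
    i₁ = solve-∀
    i₃ : ∀ r x J → r * (r * r * r * (r * r * r * (r * r * r)) * (J * x))
                 ≡ r * (r * (r * (r * (r * (r * (r * (r * (r * (r * x))))))))) * J
    i₃ = solve-∀
    i₂ : ∀ k c r q X Y E → r * Y ≡ E → r * (c * Y + 2 * k * X) + (c * X + q * X) ≡ c * (E + X) + (2 * k * r * X + q * X)
    i₂ k c r q X Y _ refl = j₂ k c r q X Y
      where j₂ : ∀ k c r q X Y → r * (c * Y + 2 * k * X) + (c * X + q * X) ≡ c * (r * Y + X) + (2 * k * r * X + q * X)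
            j₂ = solve-∀

  -- From 4T ≤ n/4 follows 2N ≥ 3n/2, and the term in T takes at most 5n/8, so more than n/2 remains
  -- for Z. With n^k ≤ 2N^k the claim reduces to 4(r²-1) ≤ r⁴, with a further factor r to spare.
  clique⇒joint-arithmetic : ∀ k r q n N T J → r ≡ 2 + k → q ≡ r * r * r → 0 < n → N ≤ n → q * n ≤ q * N + 2 * n → n ≤ N + 4 * T → 2 * q * T ≤ n →
    N ^ k * (2 * N) ≤ r * (3 + k) * (r ^ (1 + k) * ((1 + k) * J)) + N ^ k * ((3 + k) * (k * k + 4 * k + 2) * T) →
    q * n ^ (1 + k) < r ^ (10 + k) * J + n ^ (1 + k)
  clique⇒joint-arithmetic k r q n N T J refl refl n>0 N≤n h₁ h₂ h₃ h₄ =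
    ≤-<-trans qX≤ (m<m+n _ (m^n>0 n {{ℕ.>-nonZero n>0}} (1 + k)))
    where
    open ≤-Reasoning
    Z coef : ℕ
    Z = r * (3 + k) * (r ^ (1 + k) * ((1 + k) * J))
    coef = (3 + k) * (k * k + 4 * k + 2)
    8T≤n : 16 * T ≤ n
    8T≤n = ≤-trans (≤-trans (m≤m+n _ _) (≤-reflexive (j k T))) h₃
      where j : ∀ k T → let r = 2 + k in 16 * T + 2 * (12 * k + 6 * (k * k) + k * k * k) * T ≡ 2 * (r * r * r) * T
            j = solve-∀
    coefT : 8 * (coef * T) ≤ 5 * n
    coefT = ≤-trans (≤-trans (m≤m+n _ _) (≤-reflexive (j k T))) (*-monoʳ-≤ 5 h₃)
      where j : ∀ k T → let r = 2 + k in
                8 * ((3 + k) * (k * k + 4 * k + 2) * T) + (32 + 8 * k + 4 * (k * k) + 2 * (k * k * k)) * T ≡ 5 * (2 * (r * r * r) * T)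
            j = solve-∀
    nN : N ^ k * n ≤ 2 * Z
    nN = *-cancelˡ-≤ 4 (begin
      4 * (N ^ k * n)                  ≤⟨ m≤m+n _ (3 * (N ^ k * n)) ⟩
      4 * (N ^ k * n) + 3 * (N ^ k * n) ≤⟨ ≤-from (N ^ k * (5 * n) + 4 * (N ^ k * (n + 4 * N + 16 * T)) + 8 * (N ^ k * (coef * T)))
          (+-mono-≤ (+-mono-≤ (*-monoʳ-≤ 8 h₄) (*-monoʳ-≤ (N ^ k) coefT)) (*-monoʳ-≤ 4 (*-monoʳ-≤ (N ^ k) (+-mono-≤ (*-monoʳ-≤ 4 h₂) 8T≤n))))
          (j₁ (N ^ k) n N T (coef * T)) (j₂ (N ^ k) n N T (coef * T) Z) ⟩
      8 * Z                            ≡⟨ *-assoc 4 2 Z ⟩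
      4 * (2 * Z)                      ∎)
      where
      j₁ : ∀ x n N T C → 4 * (x * n) + 3 * (x * n) + (x * (5 * n) + 4 * (x * (n + 4 * N + 16 * T)) + 8 * (x * C))
                       ≡ 8 * (x * (2 * N)) + x * (8 * C) + 4 * (x * (4 * n + 16 * T))
      j₁ = solve-∀
      j₂ : ∀ x n N T C Z → 8 * (Z + x * C) + x * (5 * n) + 4 * (x * (4 * (N + 4 * T) + n))
                         ≡ 8 * Z + (x * (5 * n) + 4 * (x * (n + 4 * N + 16 * T)) + 8 * (x * C))
      j₂ = solve-∀
    n^k≤ : n ^ k ≤ 2 * N ^ k
    n^k≤ = *-cancelˡ-≤ q (≤-from (q * n ^ k + 4 * k * n ^ k) (+-mono-≤ (*-monoʳ-≤ 2 (bernoulli q N n k N≤n h₁)) slack) (j₁ q (n ^ k) k) (j₂ q (N ^ k) k (n ^ k)))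
      where
      slack : 4 * k * n ^ k ≤ q * n ^ k
      slack = *-monoˡ-≤ (n ^ k) (≤-trans (m≤m+n (4 * k) (8 + 8 * k + 6 * (k * k) + k * k * k)) (≤-reflexive (j k)))
        where j : ∀ k → let r = 2 + k in 4 * k + (8 + 8 * k + 6 * (k * k) + k * k * k) ≡ r * r * r
              j = solve-∀
      j₁ : ∀ q x k → q * x + (q * x + 4 * k * x) ≡ 2 * (q * x) + 4 * k * x
      j₁ = solve-∀
      j₂ : ∀ q y k x → 2 * (q * y + 2 * k * x) + q * x ≡ q * (2 * y) + (q * x + 4 * k * x)
      j₂ = solve-∀
    qX≤ : q * n ^ (1 + k) ≤ r ^ (10 + k) * J
    qX≤ = begin
      q * (n * n ^ k)                    ≤⟨ *-monoʳ-≤ q (*-monoʳ-≤ n n^k≤) ⟩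
      q * (n * (2 * N ^ k))              ≡⟨ j₁ q n (N ^ k) ⟩
      2 * q * (N ^ k * n)                ≤⟨ *-monoʳ-≤ (2 * q) nN ⟩
      2 * q * (2 * Z)                    ≡⟨ j₂ k r (r ^ k) J ⟩
      4 * ((3 + k) * (1 + k)) * W        ≤⟨ *-monoˡ-≤ W (≤-trans (m≤m+n (4 * ((3 + k) * (1 + k))) (4 + 16 * k + 20 * (k * k) + 8 * (k * k * k) + k * k * (k * k))) (≤-reflexive (j₃ k))) ⟩
      r * r * (r * r) * W                ≤⟨ m≤n*m (r * r * (r * r) * W) r ⟩
      r * (r * r * (r * r) * W)          ≡⟨ j₄ r (r ^ k) J ⟩
      r ^ (10 + k) * J                   ∎
      where
      W : ℕ
      W = r * r * r * r * (r * r ^ k) * J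
      j₁ : ∀ q n y → q * (n * (2 * y)) ≡ 2 * q * (y * n)
      j₁ = solve-∀
      j₂ : ∀ k r x J → 2 * (r * r * r) * (2 * (r * (3 + k) * (r * x * ((1 + k) * J)))) ≡ 4 * ((3 + k) * (1 + k)) * (r * r * r * r * (r * x) * J)
      j₂ = solve-∀
      j₃ : ∀ k → let r = 2 + k in 4 * ((3 + k) * (1 + k)) + (4 + 16 * k + 20 * (k * k) + 8 * (k * k * k) + k * k * (k * k)) ≡ r * r * (r * r)
      j₃ = solve-∀
      j₄ : ∀ r x J → r * (r * r * (r * r) * (r * r * r * r * (r * x) * J)) ≡ r * (r * (r * (r * (r * (r * (r * (r * (r * (r * x))))))))) * J
      j₄ = solve-∀

  colouring-room : ∀ k r q n N T → r ≡ 2 + k → q ≡ r * r * r → 0 < T → 2 * q * T ≤ n → n ≤ N + 4 * T → (2 * k + 3) * (k + 3) * T < N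
  colouring-room k r q n N T refl refl T>0 h₁ h₂ = ≤-from (4 * T) (≤-trans (≤-trans (≤-trans (+-monoˡ-≤ _ T>0) (m≤m+n _ _)) (≤-reflexive (j k T))) (≤-trans h₁ h₂))
    refl refl
    where j : ∀ k T → let r = 2 + k in
              T + ((2 * k + 3) * (k + 3) * T + 4 * T) + (2 + 15 * k + 10 * (k * k) + 2 * (k * k * k)) * T ≡ 2 * (r * r * r) * T
          j = solve-∀

  -- This uses the smallness of α: 18q²rD < n² and 2rb² ≤ D give (6qrb)² < n² < (2q(T+1))², so 3rb ≤
  -- T, while g is close to 2T.
  threshold : ∀ r c q T g D n b → r ≡ suc c → 0 < q → n < 2 * q * suc T → 16 * r ≤ 2 * T + 1 → 2 * T ≡ g + c →
              18 * (q * q * r) * D < n * n → 2 * r * (b * b) ≤ D → r * suc b ≤ g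
  threshold r c q T g D n b refl q>0 h₁ h₂ h₃ h₄ h₅ = *-cancelˡ-≤ 48 (≤-from (48 * r + 96 * T)
    (+-mono-≤ (*-monoʳ-≤ 16 3rb≤T) (+-mono-≤ (*-monoʳ-≤ 6 h₂) (+-mono-≤ (*-monoʳ-≤ 48 (≤-reflexive h₃)) (z≤n {68 * T + 42}))))
    (j₁ r b T) (j₂ c T g))
    where
    j₁ : ∀ r b T → 48 * (r * suc b) + (48 * r + 96 * T) ≡ 16 * (3 * r * b) + (6 * (16 * r) + (48 * (2 * T) + 0))
    j₁ = solve-∀
    j₂ : ∀ c T g → 16 * T + (6 * (2 * T + 1) + (48 * (g + c) + (68 * T + 42))) ≡ 48 * g + (48 * suc c + 96 * T)
    j₂ = solve-∀
    instance
      2q≢0 : NonZero (2 * q)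
      2q≢0 = m*n≢0 2 q {{_}} {{ℕ.>-nonZero q>0}}
    3rb≤T : 3 * r * b ≤ T
    3rb≤T = ℕ.s≤s⁻¹ (*-cancelˡ-< (2 * q) _ _ (<-trans (square-cancel-< _ _ (≤-<-trans (≤-trans (≤-reflexive (j q r b)) (*-monoʳ-≤ (18 * (q * q * r)) h₅)) h₄)) h₁))
      where j : ∀ q r b → 2 * q * (3 * r * b) * (2 * q * (3 * r * b)) ≡ 18 * (q * q * r) * (2 * r * (b * b))
            j = solve-∀

  -- D r R² ≤ 2(r(b+1)R)² ≤ 2D², and D is cancelled; for D = 0 the first hypothesis already forces r
  -- R² = 0. The factor 2r in the choice of b makes R² ≤ 2D/r ≤ 4αn², the required 2n√α.
  removed-arithmetic : ∀ r b R D → r * suc b * R ≤ D → D < 2 * r * (suc b * suc b) → r * (R * R) ≤ 2 * D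
  removed-arithmetic r b R zero h₁ h₂ = ≤-trans (≤-trans (m≤m+n _ _) (≤-reflexive (j r b R))) (*-monoˡ-≤ R h₁)
    where j : ∀ r b R → r * (R * R) + r * b * (R * R) ≡ r * suc b * R * R
          j = solve-∀
  removed-arithmetic r b R D@(suc _) h₁ h₂ = *-cancelˡ-≤ D (begin
    D * (r * (R * R))                                       ≤⟨ *-monoˡ-≤ (r * (R * R)) (<⇒≤ h₂) ⟩
    2 * r * (suc b * suc b) * (r * (R * R))                 ≡⟨ j r (suc b) R ⟩
    2 * (r * suc b * R * (r * suc b * R))                   ≤⟨ *-monoʳ-≤ 2 (*-mono-≤ h₁ h₁) ⟩
    2 * (D * D)                                             ≡⟨ j′ D ⟩
    D * (2 * D)                                             ∎)
    where
    open ≤-Reasoning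
    j : ∀ r b R → 2 * r * (b * b) * (r * (R * R)) ≡ 2 * (r * b * R * (r * b * R))
    j = solve-∀
    j′ : ∀ D → 2 * (D * D) ≡ D * (2 * D)
    j′ = solve-∀

  -- (u + v + y)² ≤ 3(u² + v² + y²), where the three squares are at most 2rD, rD/2 and rD.
  deficit-arithmetic : ∀ r R b y D → r * (R * R) ≤ 2 * D → 2 * r * (b * b) ≤ D → y * y ≤ r * D →
                       let X = r * R + r * b + y in 2 * (X * X) ≤ 21 * (r * D)
  deficit-arithmetic r R b y D h₁ h₂ h₃ = ≤-from (6 * (u * u + v * v + y * y))
    (+-mono-≤ (+-mono-≤ (*-monoʳ-≤ 2 (+-mono-≤ (2ab≤a²+b² u v) (+-mono-≤ (2ab≤a²+b² v y) (2ab≤a²+b² u y))))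
      (≤-refl {2 * (u * u + v * v + y * y)}))
      (+-mono-≤ (*-monoʳ-≤ (6 * r) h₁) (+-mono-≤ (*-monoʳ-≤ (3 * r) h₂) (*-monoʳ-≤ 6 h₃))))
    (j₁ r R b y) (j₂ r u v y D)
    where
    u v : ℕ
    u = r * R
    v = r * b
    j₁ : ∀ r R b y → let u = r * R; v = r * b; X = u + v + y in
         2 * (X * X) + 6 * (u * u + v * v + y * y)
         ≡ 2 * (2 * (u * v) + (2 * (v * y) + 2 * (u * y))) + 2 * (u * u + v * v + y * y)
           + (6 * r * (r * (R * R)) + (3 * r * (2 * r * (b * b)) + 6 * (y * y)))
    j₁ = solve-∀
    j₂ : ∀ r u v y D → 2 * (u * u + v * v + (v * v + y * y + (u * u + y * y))) + 2 * (u * u + v * v + y * y)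
           + (6 * r * (2 * D) + (3 * r * D + 6 * (r * D)))
         ≡ 21 * (r * D) + 6 * (u * u + v * v + y * y)
    j₂ = solve-∀

  -- The dichotomy in integers

  -- D stands for 2rαn², and x for r times the amount by which a degree falls short of (1 - 1/r) n.
  record Partition {n : ℕ} (G : Graph n) (r c D : ℕ) : Set where
    field
      kept    : Fin n → Bool
      col     : Fin n → Fin r
      proper  : ∀ u v → kept u ≡ true → kept v ≡ true → adj G u v ≡ true → col u ≢ col v
      removed : ℕ
      size    : card kept + removed ≡ n
      few     : r * (removed * removed) ≤ 2 * D
      degrees : ∀ v → kept v ≡ true → ∃ λ x → c * n ≤ r * sumOn kept (λ w → 𝟙 (adj G v w)) + x × 2 * (x * x) ≤ 21 * (r * D)

  module Dichotomy {n : ℕ} (k q D : ℕ) (G : Graph n) (q≡r³ : q ≡ (2 + k) * (2 + k) * (2 + k)) (large : (2 + k) ^ 8 < n)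
                   (dense : (1 + k) * (n * n) ≤ (2 + k) * (2 * edges G) + D)
                   (D-small : 18 * (q * q * (2 + k)) * D < n * n) where

    private
      r c Jₙ : ℕ
      r = 2 + k
      c = 1 + k
      Jₙ = js G r

      V : Fin n → Bool
      V _ = true

    open Parameters (subst (λ q → Parameters r c q n) (sym q≡r³) (parameters k n large))
    open Deletion (adj G) (adj-sym G) (irrefl G) c T g D 2T≡g+c using (Stage; size; density; delete-all; HighDegrees)
    open Cliques (adj G) (adj-sym G) (irrefl G)

    Joint : Set
    Joint = q * n ^ (1 + k) < r ^ (10 + k) * Jₙ + n ^ (1 + k)

    n>0 : 0 < n
    n>0 = ≤-trans (s≤s z≤n) large

    T>0 : 0 < T
    T>0 = n≢0⇒n>0 λ T≡0 → <⇒≱ (subst (λ T → 2 * T + 1 < 16) (sym T≡0) (s≤s (s≤s z≤n))) (≤-trans (m≤m*n 16 r) 16r≤2T+1)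

    q>0 : 0 < q
    q>0 = subst (0 <_) (sym q≡r³) (s≤s z≤n)

    N-V : N V ≡ n
    N-V = trans (sum-const n 1) (*-identityʳ n)

    initial : Stage 0 V
    initial = record
      { size    = trans (+-identityʳ (N V)) N-V
      ; density = ≤-trans (≤-reflexive (trans (+-identityʳ _) (cong (λ m → c * (m * m)) N-V)))
                          (≤-trans dense (+-monoˡ-≤ D (*-monoʳ-≤ r (2edges≤ G)))) }

    ext≤ : ∀ P u v → P u ≡ true → P v ≡ true → adj G u v ≡ true → ext P (suc k) (v ∷ u ∷ []) ≤ suc k ! * Jₙ
    ext≤ P u v _ _ Auv = CliqueSets.ext≤js G P k u v Auv

    module _ (P : Fin n → Bool) (j : ℕ) (j≤ : j ≤ 4 * T + 0) (sz : N P + j ≡ n) where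

      N≤n : N P ≤ n
      N≤n = ≤-trans (m≤m+n (N P) j) (≤-reflexive sz)

      n≤N+4T : n ≤ N P + 4 * T
      n≤N+4T = ≤-trans (≤-reflexive (sym sz)) (+-monoʳ-≤ (N P) (≤-trans j≤ (≤-reflexive (+-identityʳ (4 * T)))))

      qn≤ : q * n ≤ q * N P + 2 * n
      qn≤ = ≤-trans (*-monoʳ-≤ q n≤N+4T) (≤-trans (≤-reflexive (i₁ q (N P) T)) (+-monoʳ-≤ (q * N P) (*-monoʳ-≤ 2 2qT≤n)))
        where i₁ : ∀ q N T → q * (N + 4 * T) ≡ q * N + 2 * (2 * q * T)
              i₁ = solve-∀

      room : (2 * k + 3) * (k + 3) * T < N P
      room = colouring-room k r q n (N P) T refl q≡r³ T>0 2qT≤n n≤N+4T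

      exhausted : 4 * T ≤ j → Stage j P → Joint
      exhausted 4T≤j st =
        let F , split , F-large = excess-arithmetic q D n (4 * T * g) n>0 36q²D (gain-arithmetic r c q T g n (s≤s z≤n) refl n<2q[T+1] 16r≤2T+1 2T≡g+c)
        in excess⇒joint k r q n (N P) F Jₙ refl q≡r³ n>0 N≤n qn≤ F-large
             (MoonMoser.Supersaturation.supersaturation (adj G) (adj-sym G) (irrefl G) P k F Jₙ (≤-trans (s≤s z≤n) room) (gain F split) (ext≤ P))
        where
        36q²D : 36 * (q * q) * D ≤ n * n
        36q²D = ≤-trans (*-monoˡ-≤ D (≤-trans (≤-reflexive (i₁ (q * q))) (*-monoʳ-≤ 18 (*-monoʳ-≤ (q * q) (m≤m+n 2 k))))) (<⇒≤ D-small)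
          where i₁ : ∀ x → 36 * x ≡ 18 * (x * 2)
                i₁ = solve-∀
        gain : ∀ F → 4 * T * g ≡ D + F → c * (N P * N P) + F ≤ r * e₂ P
        gain F split = ≤-from D (≤-trans (+-monoʳ-≤ (c * (N P * N P)) (*-monoˡ-≤ g 4T≤j)) (density st))
          (trans (i₁ (c * (N P * N P)) F D) (cong (c * (N P * N P) +_) (sym split))) refl
          where i₁ : ∀ a F D → a + F + D ≡ a + (D + F)
                i₁ = solve-∀

      stable : Stage j P → HighDegrees P → Joint ⊎ Partition G r c D
      stable st high = decide (ext P (3 + k) [] ℕ.≟ 0)
        where
        partition : (col : Fin n → Fin r) → (∀ u v → P u ≡ true → P v ≡ true → adj G u v ≡ true → col u ≢ col v) →
                    ∀ b → 2 * r * (b * b) ≤ D → D < 2 * r * (suc b * suc b) → r * suc b ≤ g → Partition G r c D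
        partition col proper b lo hi rq≤g = record
          { kept    = kept
          ; col     = col
          ; proper  = λ u v ku kv → proper u v (proj₁ (kept⇒P u ku)) (proj₁ (kept⇒P v kv))
          ; removed = removed
          ; size    = N-kept
          ; few     = R-bound
          ; degrees = λ v kv → r * removed + r * b + deviation (col v) , kept-degree v kv ,
                        deficit-arithmetic r removed b (deviation (col v)) D R-bound lo (≤-trans (m≤m+n _ _) (budget (col v))) }
          where
          open Deletion.Cleanup (adj G) (adj-sym G) (irrefl G) c T g D 2T≡g+c P st col proper b rq≤g
          R-bound : r * (removed * removed) ≤ 2 * D
          R-bound = removed-arithmetic r b removed D removed-bound hi
        decide : Dec (ext P (3 + k) [] ≡ 0) → Joint ⊎ Partition G r c D
        decide (no ¬0) = inj₁ (clique⇒joint-arithmetic k r q n (N P) T Jₙ refl q≡r³ n>0 N≤n qn≤ n≤N+4T 2qT≤n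
          (CliqueCase.clique⇒joint (adj G) (adj-sym G) (irrefl G) P k T Jₙ high (ext≤ P) (n≢0⇒n>0 ¬0)))
        decide (yes clique-free) =
          let col , proper = Colouring.colouring (adj G) (adj-sym G) (irrefl G) P k T high clique-free room
              b , lo , hi  = sqrt-between (2 * r) D (s≤s z≤n)
          in inj₂ (partition col proper b lo hi (threshold r c q T g D n b refl q>0 n<2q[T+1] 16r≤2T+1 2T≡g+c D-small lo))

    dichotomy : Joint ⊎ Partition G r c D
    dichotomy = conclude (delete-all (4 * T) V initial)
      where
      conclude : (∃ λ P → Stage (4 * T + 0) P) ⊎ (∃ λ P → ∃ λ j → j ≤ 4 * T + 0 × Stage j P × HighDegrees P) → Joint ⊎ Partition G r c D
      conclude (inj₁ (P , st))                 = inj₁ (exhausted P (4 * T + 0) ≤-refl (size st) (≤-reflexive (sym (+-identityʳ _))) st)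
      conclude (inj₂ (P , j , j≤ , st , high)) = stable P j j≤ (size st) st high

-- Rational arithmetic and clearing of denominators

module Rationals where

  open import Data.Nat as ℕ using (ℕ; suc)
  import Data.Nat.Properties as ℕ
  open import Data.Integer as ℤ using (+_; +≤+; +<+)
  import Data.Integer.Properties as ℤ
  open import Data.Rational
  open import Data.Rational.Properties
  open import Data.Rational.Unnormalised as ℚᵘ using (mkℚᵘ; *≡*; *≤*; *<*) renaming (_≃_ to _≃ᵘ_)
  import Data.Rational.Unnormalised.Properties as ℚᵘ
  open import Data.Rational.Solver using (module +-*-Solver)
  open import Data.Sum using (_⊎_; inj₁; inj₂)
  open import Relation.Nullary using (yes; no)
  open import Relation.Binary.PropositionalEquality
  open import Defs using (⟦_⟧; inv; _<_√_)
  open +-*-Solver using (solve; con; _:+_; _:*_; _:-_; :-_; _:=_)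

  ⟦⟧-toℚᵘ : ∀ m → toℚᵘ ⟦ m ⟧ ≃ᵘ mkℚᵘ (+ m) 0
  ⟦⟧-toℚᵘ m = toℚᵘ-fromℚᵘ (mkℚᵘ (+ m) 0)

  ⟦⟧-+ : ∀ a b → ⟦ a ℕ.+ b ⟧ ≡ ⟦ a ⟧ + ⟦ b ⟧
  ⟦⟧-+ a b = toℚᵘ-injective (ℚᵘ.≃-trans (⟦⟧-toℚᵘ (a ℕ.+ b)) (ℚᵘ.≃-trans (*≡* eq) (ℚᵘ.≃-sym
    (ℚᵘ.≃-trans (toℚᵘ-homo-+ ⟦ a ⟧ ⟦ b ⟧) (ℚᵘ.+-cong (⟦⟧-toℚᵘ a) (⟦⟧-toℚᵘ b))))))
    where eq : + (a ℕ.+ b) ℤ.* + 1 ≡ (+ a ℤ.* + 1 ℤ.+ + b ℤ.* + 1) ℤ.* + 1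
          eq = cong (ℤ._* + 1) (trans (ℤ.pos-+ a b) (sym (cong₂ ℤ._+_ (ℤ.*-identityʳ (+ a)) (ℤ.*-identityʳ (+ b)))))

  ⟦⟧-* : ∀ a b → ⟦ a ℕ.* b ⟧ ≡ ⟦ a ⟧ * ⟦ b ⟧
  ⟦⟧-* a b = toℚᵘ-injective (ℚᵘ.≃-trans (⟦⟧-toℚᵘ (a ℕ.* b)) (ℚᵘ.≃-trans (*≡* (cong (ℤ._* + 1) (ℤ.pos-* a b))) (ℚᵘ.≃-sym
    (ℚᵘ.≃-trans (toℚᵘ-homo-* ⟦ a ⟧ ⟦ b ⟧) (ℚᵘ.*-cong (⟦⟧-toℚᵘ a) (⟦⟧-toℚᵘ b))))))

  ⟦⟧-mono-≤ : ∀ a b → a ℕ.≤ b → ⟦ a ⟧ ≤ ⟦ b ⟧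
  ⟦⟧-mono-≤ a b h = toℚᵘ-cancel-≤ (ℚᵘ.≤-respˡ-≃ (ℚᵘ.≃-sym (⟦⟧-toℚᵘ a)) (ℚᵘ.≤-respʳ-≃ (ℚᵘ.≃-sym (⟦⟧-toℚᵘ b))
    (*≤* (ℤ.*-monoʳ-≤-nonNeg (+ 1) (+≤+ h)))))

  ⟦⟧-mono-< : ∀ a b → a ℕ.< b → ⟦ a ⟧ < ⟦ b ⟧
  ⟦⟧-mono-< a b h = toℚᵘ-cancel-< (ℚᵘ.<-respˡ-≃ (ℚᵘ.≃-sym (⟦⟧-toℚᵘ a)) (ℚᵘ.<-respʳ-≃ (ℚᵘ.≃-sym (⟦⟧-toℚᵘ b))
    (*<* (ℤ.*-monoʳ-<-pos (+ 1) (+<+ h)))))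

  ⟦⟧-cancel-< : ∀ a b → ⟦ a ⟧ < ⟦ b ⟧ → a ℕ.< b
  ⟦⟧-cancel-< a b h = ℕ.≰⇒> (λ b≤a → <-irrefl refl (<-≤-trans h (⟦⟧-mono-≤ b a b≤a)))

  inv-* : ∀ m → 0 ℕ.< m → inv m * ⟦ m ⟧ ≡ 1ℚ
  inv-* (suc m) _ = toℚᵘ-injective (ℚᵘ.≃-trans (toℚᵘ-homo-* (inv (suc m)) ⟦ suc m ⟧)
    (ℚᵘ.≃-trans (ℚᵘ.*-cong (toℚᵘ-fromℚᵘ (mkℚᵘ (+ 1) m)) (⟦⟧-toℚᵘ (suc m))) (*≡* eq)))
    where eq : (+ 1 ℤ.* + suc m) ℤ.* + 1 ≡ + 1 ℤ.* + (suc m ℕ.* 1)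
          eq = trans (ℤ.*-identityʳ _) (cong (λ x → + 1 ℤ.* + x) (sym (ℕ.*-identityʳ (suc m))))

  *-mono-< : ∀ {c x y} → 0ℚ < c → x < y → c * x < c * y
  *-mono-< {c} c>0 = *-monoʳ-<-pos c {{positive c>0}}

  *-mono-≤ : ∀ {c x y} → 0ℚ < c → x ≤ y → c * x ≤ c * y
  *-mono-≤ {c} c>0 = *-monoˡ-≤-nonNeg c {{nonNegative (<⇒≤ c>0)}}

  *-cancel-< : ∀ {c x y} → 0ℚ < c → c * x < c * y → x < y
  *-cancel-< {c} c>0 = *-cancelˡ-<-nonNeg c {{nonNegative (<⇒≤ c>0)}}

  *-cancel-≤ : ∀ {c x y} → 0ℚ < c → c * x ≤ c * y → x ≤ y
  *-cancel-≤ {c} c>0 = *-cancelˡ-≤-pos c {{positive c>0}}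

  *-pos : ∀ {x y} → 0ℚ < x → 0ℚ < y → 0ℚ < x * y
  *-pos {x} {y} x>0 y>0 = subst (_< x * y) (*-zeroʳ x) (*-mono-< x>0 y>0)

  square-mono : ∀ {x y} → 0ℚ ≤ x → x ≤ y → x * x ≤ y * y
  square-mono {x} {y} x≥0 x≤y = ≤-trans (*-monoˡ-≤-nonNeg x {{nonNegative x≥0}} x≤y) (*-monoʳ-≤-nonNeg y {{nonNegative (≤-trans x≥0 x≤y)}} x≤y)

  +-cancelˡ-< : ∀ a {x y} → a + x < a + y → x < y
  +-cancelˡ-< a {x} {y} h = subst₂ _<_ (back x) (back y) (+-monoʳ-< (- a) h)
    where back : ∀ x → - a + (a + x) ≡ x
          back x = solve 2 (λ a x → :- a :+ (a :+ x) := x) refl a x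

  edge-bound : ∀ a i m α s e → 0ℚ < m → i * m ≡ 1ℚ → (a * i - α) * s < e → a * s < m * e + m * α * s
  edge-bound a i m α s e m>0 im≡1 h = subst (_< m * e + m * α * s)
    (trans (solve 5 (λ a i m α s → m :* ((a :* i :- α) :* s) :+ m :* α :* s := a :* s :* (i :* m)) refl a i m α s)
           (trans (cong (a * s *_) im≡1) (*-identityʳ (a * s))))
    (+-monoˡ-< (m * α * s) (*-mono-< m>0 h))

  joint-bound : ∀ i iw q w X j → 0ℚ < q → 0ℚ < w → i * q ≡ 1ℚ → iw * w ≡ 1ℚ → q * X < q * w * j + X → (1ℚ - i) * X * iw < j
  joint-bound i iw q w X j q>0 w>0 iq iww h = *-cancel-< (*-pos q>0 w>0) (subst₂ _<_ left right (+-monoˡ-< (- X) h))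
    where
    left : q * X + - X ≡ q * w * ((1ℚ - i) * X * iw)
    left = sym (trans (solve 5 (λ q w i X iw → q :* w :* ((con 1ℚ :- i) :* X :* iw) := (q :- i :* q) :* X :* (iw :* w)) refl q w i X iw)
      (trans (cong₂ (λ a b → (q - a) * X * b) iq iww) (solve 2 (λ q X → (q :- con 1ℚ) :* X :* con 1ℚ := q :* X :+ :- X) refl q X)))
    right : q * w * j + X + - X ≡ q * w * j
    right = solve 2 (λ a X → a :+ X :+ :- X := a) refl (q * w * j) X

  removed-bound : ∀ r R D α n → 0ℚ < r → r * (R * R) ≤ ⟦ 2 ⟧ * D → D ≤ ⟦ 2 ⟧ * r * α * (n * n) → R * R ≤ (⟦ 2 ⟧ * n * (⟦ 2 ⟧ * n)) * α
  removed-bound r R D α n r>0 h₁ h₂ = *-cancel-≤ r>0 (≤-trans h₁ (≤-trans (*-mono-≤ (⟦⟧-mono-< 0 2 (ℕ.s≤s ℕ.z≤n)) h₂)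
    (≤-reflexive (solve 3 (λ r α n → con ⟦ 2 ⟧ :* (con ⟦ 2 ⟧ :* r :* α :* (n :* n)) := r :* ((con ⟦ 2 ⟧ :* n :* (con ⟦ 2 ⟧ :* n)) :* α)) refl r α n))))

  -- For y ≥ 0, r y ≤ x gives 2r²y² ≤ 21rD ≤ 42r²αn², against the 72r²αn² that the factor 6 allows;
  -- α > 0 makes the comparison strict. A negative y falls under the first alternative of the
  -- definition.
  deficit-bound : ∀ r i c n d x D α → 0ℚ < r → 0ℚ < α → 0ℚ < n → i * r ≡ 1ℚ → r ≡ 1ℚ + c → c * n ≤ r * d + x →
                  ⟦ 2 ⟧ * (x * x) ≤ ⟦ 21 ⟧ * (r * D) → D ≤ ⟦ 2 ⟧ * r * α * (n * n) →
                  ((1ℚ - i) * n - d) < (⟦ 6 ⟧ * n) √ α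
  deficit-bound r i c n d x D α r>0 α>0 n>0 ir r≡ h₁ h₂ h₃ = split (<-cmp′ y 0ℚ)
    where
    y : ℚ
    y = (1ℚ - i) * n - d
    <-cmp′ : ∀ a b → a < b ⊎ b ≤ a
    <-cmp′ a b with a <? b
    ... | yes p = inj₁ p
    ... | no ¬p = inj₂ (≮⇒≥ ¬p)
    ry≤x : r * y ≤ x
    ry≤x = subst₂ _≤_ left right (+-monoˡ-≤ (- (r * d)) h₁)
      where
      left : c * n + - (r * d) ≡ r * y
      left = sym (trans (solve 4 (λ r i n d → r :* ((con 1ℚ :- i) :* n :- d) := (r :- i :* r) :* n :+ :- (r :* d)) refl r i n d)
        (trans (cong (λ a → (r - a) * n + - (r * d)) ir)
        (trans (cong (λ s → (s - 1ℚ) * n + - (r * d)) r≡)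
               (solve 3 (λ c n e → (con 1ℚ :+ c :- con 1ℚ) :* n :+ :- e := c :* n :+ :- e) refl c n (r * d)))))
      right : r * d + x + - (r * d) ≡ x
      right = solve 2 (λ a x → a :+ x :+ :- a := x) refl (r * d) x
    two>0 : 0ℚ < ⟦ 2 ⟧
    two>0 = ⟦⟧-mono-< 0 2 (ℕ.s≤s ℕ.z≤n)
    u : ℚ
    u = r * r * (α * (n * n))
    u>0 : 0ℚ < u
    u>0 = *-pos (*-pos r>0 r>0) (*-pos α>0 (*-pos n>0 n>0))
    split : y < 0ℚ ⊎ 0ℚ ≤ y → y < (⟦ 6 ⟧ * n) √ α
    split (inj₁ y<0) = inj₁ y<0
    split (inj₂ y≥0) = inj₂ (*-cancel-< (*-pos two>0 (*-pos r>0 r>0)) (begin-strict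
      ⟦ 2 ⟧ * (r * r) * (y * y)          ≡⟨ solve 3 (λ t r y → t :* (r :* r) :* (y :* y) := t :* (r :* y :* (r :* y))) refl ⟦ 2 ⟧ r y ⟩
      ⟦ 2 ⟧ * (r * y * (r * y))          ≤⟨ *-mono-≤ two>0 (square-mono (subst (_≤ r * y) (*-zeroʳ r) (*-mono-≤ r>0 y≥0)) ry≤x) ⟩
      ⟦ 2 ⟧ * (x * x)                    ≤⟨ h₂ ⟩
      ⟦ 21 ⟧ * (r * D)                   ≤⟨ *-mono-≤ (⟦⟧-mono-< 0 21 (ℕ.s≤s ℕ.z≤n)) (*-mono-≤ r>0 h₃) ⟩
      ⟦ 21 ⟧ * (r * (⟦ 2 ⟧ * r * α * (n * n)))
                                         ≡⟨ solve 3 (λ r α n → con ⟦ 21 ⟧ :* (r :* (con ⟦ 2 ⟧ :* r :* α :* (n :* n))) := con ⟦ 42 ⟧ :* (r :* r :* (α :* (n :* n))) :+ con 0ℚ) refl r α n ⟩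
      ⟦ 42 ⟧ * u + 0ℚ                    <⟨ +-monoʳ-< (⟦ 42 ⟧ * u) (*-pos (⟦⟧-mono-< 0 30 (ℕ.s≤s ℕ.z≤n)) u>0) ⟩
      ⟦ 42 ⟧ * u + ⟦ 30 ⟧ * u            ≡⟨ solve 3 (λ r α n → con ⟦ 42 ⟧ :* (r :* r :* (α :* (n :* n))) :+ con ⟦ 30 ⟧ :* (r :* r :* (α :* (n :* n)))
                                                  := con ⟦ 2 ⟧ :* (r :* r) :* (con ⟦ 6 ⟧ :* n :* (con ⟦ 6 ⟧ :* n) :* α)) refl r α n ⟩
      ⟦ 2 ⟧ * (r * r) * (⟦ 6 ⟧ * n * (⟦ 6 ⟧ * n) * α) ∎))
      where open ≤-Reasoning

  -- For a ≤ b the difference is 0 and positivity of B decides. This covers graphs with at least the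
  -- Turán density, whose deficit `D` is 0.
  truncated-bound : ∀ a b B → 0ℚ < B → ⟦ a ⟧ < ⟦ b ⟧ + B → ⟦ a ℕ.∸ b ⟧ < B
  truncated-bound a b B B>0 h with ℕ.≤-total a b
  ... | inj₁ a≤b = subst (λ m → ⟦ m ⟧ < B) (sym (ℕ.m≤n⇒m∸n≡0 a≤b)) B>0
  ... | inj₂ b≤a = +-cancelˡ-< ⟦ b ⟧ (subst (_< ⟦ b ⟧ + B) (trans (cong ⟦_⟧ (sym (ℕ.m+[n∸m]≡n b≤a))) (⟦⟧-+ b (a ℕ.∸ b))) h)

  scaled-< : ∀ m α s → 0 ℕ.< m → α < inv m → 0ℚ < s → ⟦ m ⟧ * α * s < s
  scaled-< m α s m>0 h s>0 = subst₂ _<_ (*-comm s _) (*-identityʳ s)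
    (*-mono-< s>0 (subst (⟦ m ⟧ * α <_) (trans (*-comm ⟦ m ⟧ (inv m)) (inv-* m m>0)) (*-mono-< (⟦⟧-mono-< 0 m m>0) h)))

  cancel : ∀ a x → a + x - a ≡ x
  cancel a x = solve 2 (λ a x → a :+ x :- a := x) refl a x

-- From the integer dichotomy to the rational statement

open import Defs
open import Data.Nat using (ℕ; _^_; _∸_; _≤_)
open import Data.Nat as ℕ using ()
open import Data.Rational using (ℚ; _+_; _-_; _*_; _<_; 0ℚ; 1ℚ)
open import Data.Fin.Subset using (Subset; _∈_; ∣_∣)
open import Data.Product using (Σ; _×_)
open import Data.Sum using (_⊎_)
open import Data.Nat using (suc; s≤s; z≤n)
open import Data.Nat.Properties as ℕ using ()
open import Data.Nat.Tactic.RingSolver using (solve-∀)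
open import Data.Rational as ℚ using ()
open import Data.Rational.Properties using (<⇒≤; <-trans; *-assoc)
open import Data.Bool using (true)
open import Data.Bool.Properties using (T-≡)
open import Data.Product using (_,_)
open import Data.Sum using (inj₁; inj₂; [_,_]′)
open import Data.Vec using (tabulate)
open import Data.Vec.Properties using (lookup∘tabulate; []=⇒lookup)
open import Function using (_∘_; Equivalence)
open import Relation.Binary.PropositionalEquality as ≡ using (_≡_; cong; cong₂; trans; subst; subst₂)
open import Algebra.Properties.Semiring.Sum ℕ.+-*-semiring using (sum-cong-≗)
open Naturals using (Partition; module Dichotomy; 𝟙; card; sumOn; ∣∣≡card; degIn≡)
open Rationals

module Assembly {n : ℕ} (k : ℕ) (α : ℚ) (large : suc (suc k) ^ 8 ℕ.< n) (α>0 : 0ℚ < α)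
                (α-small : α < inv (36 ℕ.* suc (suc k) ^ 8)) (G : Graph n)
                (dense : (⟦ suc k ⟧ * inv (2 ℕ.* suc (suc k)) - α) * ⟦ n ℕ.* n ⟧ < ⟦ edges G ⟧) where

  r q W D : ℕ
  r = suc (suc k)
  q = r ^ 3
  W = r ^ (r ℕ.+ 5)
  D = suc k ℕ.* (n ℕ.* n) ∸ r ℕ.* (2 ℕ.* edges G)

  n>0 : 0ℚ < ⟦ n ⟧
  n>0 = ⟦⟧-mono-< 0 n (ℕ.≤-trans (s≤s z≤n) large)

  0<r : 0 ℕ.< r
  0<r = s≤s z≤n

  r>0 : 0ℚ < ⟦ r ⟧
  r>0 = ⟦⟧-mono-< 0 r 0<r

  n²>0 : 0ℚ < ⟦ n ℕ.* n ⟧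
  n²>0 = subst (0ℚ <_) (≡.sym (⟦⟧-* n n)) (*-pos n>0 n>0)

  budget : ℚ
  budget = ⟦ 2 ℕ.* r ⟧ * α * ⟦ n ℕ.* n ⟧

  budget≡ : budget ≡ ⟦ 2 ⟧ * ⟦ r ⟧ * α * (⟦ n ⟧ * ⟦ n ⟧)
  budget≡ = cong₂ (λ x y → x * α * y) (⟦⟧-* 2 r) (⟦⟧-* n n)

  D<budget : ⟦ D ⟧ < budget
  D<budget = truncated-bound (suc k ℕ.* (n ℕ.* n)) (r ℕ.* (2 ℕ.* edges G)) budget
    (*-pos (*-pos (⟦⟧-mono-< 0 (2 ℕ.* r) (s≤s z≤n)) α>0) n²>0)
    (subst₂ _<_ (≡.sym (⟦⟧-* (suc k) (n ℕ.* n)))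
                (cong (_+ budget) (trans (≡.sym (⟦⟧-* (2 ℕ.* r) (edges G))) (cong ⟦_⟧ (swap r (edges G)))))
      (edge-bound ⟦ suc k ⟧ (inv (2 ℕ.* r)) ⟦ 2 ℕ.* r ⟧ α ⟦ n ℕ.* n ⟧ ⟦ edges G ⟧
        (⟦⟧-mono-< 0 (2 ℕ.* r) (s≤s z≤n)) (inv-* (2 ℕ.* r) (s≤s z≤n)) dense))
    where swap : ∀ r e → 2 ℕ.* r ℕ.* e ≡ r ℕ.* (2 ℕ.* e)
          swap = solve-∀

  power>0 : ∀ m → 0 ℕ.< r ^ m
  power>0 m = ℕ.m^n>0 r m

  -- The product of 18q²r and the factor 2r of `budget` is 36r⁸, the denominator in the bound on α.
  D-small : 18 ℕ.* (q ℕ.* q ℕ.* r) ℕ.* D ℕ.< n ℕ.* n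
  D-small = ⟦⟧-cancel-< (m ℕ.* D) (n ℕ.* n) (<-trans
    (subst₂ _<_ (≡.sym (⟦⟧-* m D)) scale (*-mono-< m>0 D<budget))
    (scaled-< (36 ℕ.* r ^ 8) α ⟦ n ℕ.* n ⟧ (ℕ.*-mono-< {0} {36} (s≤s z≤n) (power>0 8)) α-small n²>0))
    where
    m : ℕ
    m = 18 ℕ.* (q ℕ.* q ℕ.* r)
    m>0 : 0ℚ < ⟦ m ⟧
    m>0 = ⟦⟧-mono-< 0 m (ℕ.*-mono-< {0} {18} (s≤s z≤n) (ℕ.*-mono-< (ℕ.*-mono-< (power>0 3) (power>0 3)) 0<r))
    product : ∀ r → 18 ℕ.* (r ℕ.* (r ℕ.* (r ℕ.* 1)) ℕ.* (r ℕ.* (r ℕ.* (r ℕ.* 1))) ℕ.* r) ℕ.* (2 ℕ.* r)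
                  ≡ 36 ℕ.* (r ℕ.* (r ℕ.* (r ℕ.* (r ℕ.* (r ℕ.* (r ℕ.* (r ℕ.* (r ℕ.* 1))))))))
    product = solve-∀
    scale : ⟦ m ⟧ * budget ≡ ⟦ 36 ℕ.* r ^ 8 ⟧ * α * ⟦ n ℕ.* n ⟧
    scale = trans (≡.sym (*-assoc ⟦ m ⟧ (⟦ 2 ℕ.* r ⟧ * α) ⟦ n ℕ.* n ⟧)) (cong (_* ⟦ n ℕ.* n ⟧)
      (trans (≡.sym (*-assoc ⟦ m ⟧ ⟦ 2 ℕ.* r ⟧ α)) (cong (_* α) (trans (≡.sym (⟦⟧-* m (2 ℕ.* r))) (cong ⟦_⟧ (product r))))))

  joint : q ℕ.* n ^ (suc k) ℕ.< r ^ (10 ℕ.+ k) ℕ.* js G r ℕ.+ n ^ (suc k) →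
          (1ℚ - inv q) * ⟦ n ^ suc k ⟧ * inv W < ⟦ js G r ⟧
  joint h = joint-bound (inv q) (inv W) ⟦ q ⟧ ⟦ W ⟧ ⟦ n ^ suc k ⟧ ⟦ js G r ⟧
    (⟦⟧-mono-< 0 q (power>0 3)) (⟦⟧-mono-< 0 W (power>0 (r ℕ.+ 5))) (inv-* q (power>0 3)) (inv-* W (power>0 (r ℕ.+ 5)))
    (subst₂ _<_ (⟦⟧-* q (n ^ suc k))
      (trans (⟦⟧-+ (r ^ (10 ℕ.+ k) ℕ.* js G r) (n ^ suc k)) (cong (_+ ⟦ n ^ suc k ⟧)
        (trans (⟦⟧-* (r ^ (10 ℕ.+ k)) (js G r)) (cong (_* ⟦ js G r ⟧) (trans (cong ⟦_⟧ powers) (⟦⟧-* q W))))))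
      (⟦⟧-mono-< (q ℕ.* n ^ suc k) (r ^ (10 ℕ.+ k) ℕ.* js G r ℕ.+ n ^ suc k) h))
    where
    exponent : ∀ k → 10 ℕ.+ k ≡ 3 ℕ.+ (suc (suc k) ℕ.+ 5)
    exponent = solve-∀
    powers : r ^ (10 ℕ.+ k) ≡ q ℕ.* W
    powers = trans (cong (r ^_) (exponent k)) (ℕ.^-distribˡ-+-* r 3 (r ℕ.+ 5))

  module _ (p : Partition G r (suc k) D) where

    open Partition p

    S : Subset n
    S = tabulate kept

    D≤ : ⟦ D ⟧ ℚ.≤ ⟦ 2 ⟧ * ⟦ r ⟧ * α * (⟦ n ⟧ * ⟦ n ⟧)
    D≤ = <⇒≤ (subst (⟦ D ⟧ <_) budget≡ D<budget)

    member : ∀ {v} → v ∈ S → kept v ≡ true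
    member {v} v∈S = trans (≡.sym (lookup∘tabulate kept v)) ([]=⇒lookup v∈S)

    chromatic : Chromatic G S r
    chromatic = col , λ u v u∈S v∈S a → proper u v (member u∈S) (member v∈S) (Equivalence.to T-≡ a)

    few-removed : (⟦ n ⟧ - ⟦ ∣ S ∣ ⟧) ≤ ⟦ 2 ℕ.* n ⟧ √ α
    few-removed = inj₂ (subst₂ ℚ._≤_ (cong₂ _*_ (≡.sym gap) (≡.sym gap)) (cong₂ (λ x y → x * y * α) (≡.sym (⟦⟧-* 2 n)) (≡.sym (⟦⟧-* 2 n)))
      (removed-bound ⟦ r ⟧ ⟦ removed ⟧ ⟦ D ⟧ α ⟦ n ⟧ r>0
        (subst₂ ℚ._≤_ (trans (⟦⟧-* r (removed ℕ.* removed)) (cong (⟦ r ⟧ *_) (⟦⟧-* removed removed))) (⟦⟧-* 2 D) (⟦⟧-mono-≤ (r ℕ.* (removed ℕ.* removed)) (2 ℕ.* D) few))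
        D≤))
      where
      ∣S∣≡ : ∣ S ∣ ≡ card kept
      ∣S∣≡ = trans (∣∣≡card S) (sum-cong-≗ (λ v → cong 𝟙 (lookup∘tabulate kept v)))
      gap : ⟦ n ⟧ - ⟦ ∣ S ∣ ⟧ ≡ ⟦ removed ⟧
      gap = trans (cong₂ (λ a b → a - ⟦ b ⟧) (trans (cong ⟦_⟧ (≡.sym size)) (⟦⟧-+ (card kept) removed)) ∣S∣≡)
                  (cancel ⟦ card kept ⟧ ⟦ removed ⟧)

    degIn-kept : ∀ v → degIn G S v ≡ sumOn kept (λ w → 𝟙 (adj G v w))
    degIn-kept v = trans (degIn≡ G S v) (sum-cong-≗ (λ w → cong (λ b → 𝟙 b ℕ.* 𝟙 (adj G v w)) (lookup∘tabulate kept w)))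

    high-degree : ∀ v → v ∈ S → ((1ℚ - inv r) * ⟦ n ⟧ - ⟦ degIn G S v ⟧) < ⟦ 6 ℕ.* n ⟧ √ α
    high-degree v v∈S =
      let x , h₁ , h₂ = degrees v (member v∈S)
          d = degIn G S v
      in subst (((1ℚ - inv r) * ⟦ n ⟧ - ⟦ d ⟧) <_√ α) (≡.sym (⟦⟧-* 6 n))
        (deficit-bound ⟦ r ⟧ (inv r) ⟦ suc k ⟧ ⟦ n ⟧ ⟦ d ⟧ ⟦ x ⟧ ⟦ D ⟧ α r>0 α>0 n>0 (inv-* r (s≤s z≤n)) (⟦⟧-+ 1 (suc k))
          (subst₂ ℚ._≤_ (⟦⟧-* (suc k) n) (trans (⟦⟧-+ (r ℕ.* d) x) (cong (_+ ⟦ x ⟧) (⟦⟧-* r d)))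
            (⟦⟧-mono-≤ (suc k ℕ.* n) (r ℕ.* d ℕ.+ x) (subst (λ d → suc k ℕ.* n ≤ r ℕ.* d ℕ.+ x) (≡.sym (degIn-kept v)) h₁)))
          (subst₂ ℚ._≤_ (trans (⟦⟧-* 2 (x ℕ.* x)) (cong (⟦ 2 ⟧ *_) (⟦⟧-* x x)))
                                    (trans (⟦⟧-* 21 (r ℕ.* D)) (cong (⟦ 21 ⟧ *_) (⟦⟧-* r D))) (⟦⟧-mono-≤ (2 ℕ.* (x ℕ.* x)) (21 ℕ.* (r ℕ.* D)) h₂))
          D≤)

  conclusion : ((1ℚ - inv (r ^ 3)) * ⟦ n ^ suc k ⟧ * inv (r ^ (r ℕ.+ 5)) < ⟦ js G r ⟧)
    ⊎ Σ (Subset n) (λ S →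
        Chromatic G S r
        × (⟦ n ⟧ - ⟦ ∣ S ∣ ⟧) ≤ (⟦ 2 ℕ.* n ⟧) √ α
        × (∀ v → v ∈ S → ((1ℚ - inv r) * ⟦ n ⟧ - ⟦ degIn G S v ⟧) < ⟦ 6 ℕ.* n ⟧ √ α))
  conclusion = [ inj₁ ∘ joint , (λ p → inj₂ (S p , chromatic p , few-removed p , high-degree p)) ]′
    (Dichotomy.dichotomy k q D G (cube r) large (ℕ.m≤n+m∸n (suc k ℕ.* (n ℕ.* n)) (r ℕ.* (2 ℕ.* edges G))) D-small)
    where cube : ∀ r → r ℕ.* (r ℕ.* (r ℕ.* 1)) ≡ r ℕ.* r ℕ.* r
          cube = solve-∀

theorem8 : (r n : ℕ) → 2 ≤ r → r ^ 8 ℕ.< n → (α : ℚ) → 0ℚ < α → α < inv (36 ℕ.* r ^ 8) →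
    (G : Graph n) →
    (⟦ r ∸ 1 ⟧ * inv (2 ℕ.* r) - α) * ⟦ n ℕ.* n ⟧ < ⟦ edges G ⟧ →
    ((1ℚ - inv (r ^ 3)) * ⟦ n ^ (r ∸ 1) ⟧ * inv (r ^ (r ℕ.+ 5)) < ⟦ js G r ⟧)
    ⊎ Σ (Subset n) (λ S →
        Chromatic G S r
        × (⟦ n ⟧ - ⟦ ∣ S ∣ ⟧) ≤ (⟦ 2 ℕ.* n ⟧) √ α
        × (∀ v → v ∈ S → ((1ℚ - inv r) * ⟦ n ⟧ - ⟦ degIn G S v ⟧) < ⟦ 6 ℕ.* n ⟧ √ α))
theorem8 1 n (s≤s ())
theorem8 (suc (suc k)) n _ large α α>0 α-small G dense = Assembly.conclusion k α large α>0 α-small G dense
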